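{- Consider the following problem: given a connected undirected graph $G=(V,E)$ with $n=|V|$, $m=|E|$, edge weights $w\colon E\to\mathbb{N}_{\ge 0}$, edge lengths $\ell\colon E\to\mathbb{N}_{\ge 1}$, a stretch factor $\alpha\ge1$ and $\overline{W}\in\mathbb{N}$, decide whether $G$ has an $\alpha$-spanner $H=(V,F)$ with $w(E\setminus F)\ge\overline{W}$. (i) There is an FPT algorithm for this problem w.r.t. the combined parameter $(\overline{W},\ell_{\max},\alpha)$, where $\ell_{\max}$ is an upper bound on the edge lengths; its running time is $$\mathcal{T}\in\mathcal{O}\big(\overline{W}^{\,2\overline{W}+1}\tau^{2\overline{W}}\cdot\mathrm{SPSP}(n,m)+\mathrm{APSP}_2(n,m)\big)\quad\text{with } \tau=\alpha\,\ell_{\max}.$$ (ii) For coupled instances (i.e., $w(e)=\ell(e)>0$ for all $e\in E$), there is an FPT algorithm w.r.t. $(\overline{W},\alpha)$ with running time $\mathcal{T}$ given by the same expression with $\tau=\alpha\,\overline{W}$. In both cases, a witness (such a spanner $H$, if it exists) can be identified in $\mathcal{O}(\mathcal{T})$ time.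
   Context: For a subgraph $G'\subseteq G$ and $u,v\in V$, $\ell_{G'}[u,v]$ is the length of a shortest $u$-$v$-path in $G'$ w.r.t. $\ell$. A subgraph $H=(V,F)$, $F\subseteq E$, is an $\alpha$-spanner of $G$ if $\ell_H[u,v]\le\alpha\,\ell_G[u,v]$ for all $u,v\in V$; equivalently, for all $\{u,v\}\in E$. For a set $X$ of edges, $w(X)=\sum_{e\in X}w(e)$. As a preprocessing convention, edges that do not settle themselves (i.e., edges $\{u,v\}$ with $\ell(\{u,v\})>\alpha\,\ell_G[u,v]$) are assumed to have been removed from the instance. $\mathrm{SPSP}(n,m)$ and $\mathrm{APSP}_2(n,m)$ denote the running time of suitable algorithms for the single-pair shortest path problem and for the all-pairs-2-shortest-paths problem (two shortest paths for each node pair), respectively, on a graph with $n$ nodes and $m$ edges; $\mathrm{APSP}_2(n,m)\in\mathcal{O}(nm+n^2\log n)$. An algorithm is FPT w.r.t. a (possibly combined) parameter $k$ if on instance $I$ it runs in $\mathcal{O}(f(k)\cdot p(\langle I\rangle))$ time for a computable function $f$ and a polynomial $p$ in the encoding length $\langle I\rangle$. -}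

module Defs where

open import Algebra.Bundles using (RawSemiring)
open import Algebra.Definitions.RawSemiring using () renaming (_^_ to pow)
open import Data.Bool using (Bool; true; false; if_then_else_)
open import Data.Fin using (Fin; toℕ) renaming (_<_ to _<ᶠ_)
open import Data.Fin.Subset using (Subset; _∈_; ⊤; ∁)
open import Data.Fin.Subset.Properties using (_∈?_)
open import Data.Integer using (+_; ∣_∣)
open import Data.List
  using (List; []; _∷_; _++_; map; foldr; filter; concatMap; allFin; applyUpTo; length)
open import Data.List.Relation.Unary.Unique.Propositional using (Unique)
open import Data.Maybe using (Maybe; just; nothing; maybe)
open import Data.Nat
  using (ℕ; zero; suc; _+_; _*_; _∸_; _^_; _⊔_; _≤_; _<_; _≡ᵇ_; _<ᵇ_; _/_; _%_; NonZero)
open import Data.Nat.ListAction using (sum)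
open import Data.Nat.Logarithm using (⌊log₂_⌋; ⌈log₂_⌉)
open import Data.Product using (Σ; _×_; _,_; proj₁; proj₂; ∃; ∃-syntax; Σ-syntax)
open import Data.Rational using (ℚ; 1ℚ; ↥_; ↧ₙ_)
  renaming (_/_ to _/ℚ_; _+_ to _+ℚ_; _*_ to _*ℚ_; _≤_ to _≤ℚ_; +-*-rawSemiring to ℚ-rawSemiring)
open import Data.Sum using (_⊎_)
open import Data.Unit using () renaming (⊤ to Unit)
open import Data.Vec using (Vec) renaming (_∷_ to _∷ᵛ_; [] to []ᵛ; toList to toListᵛ)
open import Relation.Binary.PropositionalEquality using (_≡_; _≢_)
open import Relation.Nullary using (¬_)

fromℕ : ℕ → ℚ
fromℕ n = + n /ℚ 1

infixr 8 _^ℚ_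
_^ℚ_ : ℚ → ℕ → ℚ
_^ℚ_ = pow ℚ-rawSemiring

------------------------------------------------------------------------
-- A word RAM, presented as a structured language.
--
-- A program uses finitely many registers and finitely many arrays, all
-- initially zero.  Every operation costs one unit, and every value that
-- is computed has to stay below a word limit, so that unit-cost
-- multiplication cannot be used to build huge numbers.

data Op : Set where
  add monus mul quot rem less equal : Op

fromBool : Bool → ℕ
fromBool b = if b then 1 else 0

applyOp : Op → ℕ → ℕ → ℕ
applyOp add   a b       = a + b
applyOp monus a b       = a ∸ b
applyOp mul   a b       = a * b
applyOp quot  a zero    = 0
applyOp quot  a (suc b) = a / suc b
applyOp rem   a zero    = 0
applyOp rem   a (suc b) = a % suc b
applyOp less  a b       = fromBool (a <ᵇ b)
applyOp equal a b       = fromBool (a ≡ᵇ b)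

data Expr : Set where
  lit  : ℕ → Expr
  reg  : ℕ → Expr
  cell : (array : ℕ) → Expr → Expr
  op   : Op → Expr → Expr → Expr

infixr 4 _⨾_

data Program : Set where
  skip   : Program
  _≔_    : (register : ℕ) → Expr → Program
  _[_]≔_ : (array : ℕ) → Expr → Expr → Program
  _⨾_    : Program → Program → Program
  cond   : Expr → Program → Program → Program
  while  : Expr → Program → Program
  -- call p a e b: run p in a fresh memory on the first e cells of array
  -- a, and copy its output to the beginning of array b.
  call   : Program → (source : ℕ) → Expr → (target : ℕ) → Program

record Store : Set where
  constructor store
  field
    regs   : ℕ → ℕ
    arrays : ℕ → ℕ → ℕ
open Store public

update : {A : Set} → ℕ → A → (ℕ → A) → ℕ → A
update i a f j = if i ≡ᵇ j then a else f j

setReg : ℕ → ℕ → Store → Store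
setReg r v σ = store (update r v (regs σ)) (arrays σ)

setArray : ℕ → (ℕ → ℕ) → Store → Store
setArray a f σ = store (regs σ) (update a f (arrays σ))

overwrite : List ℕ → (ℕ → ℕ) → ℕ → ℕ
overwrite []       f i       = f i
overwrite (x ∷ xs) f zero    = x
overwrite (x ∷ xs) f (suc i) = overwrite xs (λ j → f (suc j)) i

-- The input is found in array 0 and its length in register 0; the output
-- is left in array 1 and its length in register 1.

initial : List ℕ → Store
initial x =
  setReg 0 (length x) (setArray 0 (overwrite x (λ _ → 0)) (store (λ _ → 0) (λ _ _ → 0)))

output : Store → List ℕ
output σ = applyUpTo (arrays σ 1) (regs σ 1)

⟦_⟧ : Expr → Store → ℕ
⟦ lit v    ⟧ σ = v
⟦ reg r    ⟧ σ = regs σ r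
⟦ cell a e ⟧ σ = arrays σ a (⟦ e ⟧ σ)
⟦ op o d e ⟧ σ = applyOp o (⟦ d ⟧ σ) (⟦ e ⟧ σ)

cost : Expr → ℕ
cost (lit v)    = 1
cost (reg r)    = 1
cost (cell a e) = 1 + cost e
cost (op o d e) = 1 + cost d + cost e

SubFit : ℕ → Expr → Store → Set
Fits   : ℕ → Expr → Store → Set

Fits B e σ = ⟦ e ⟧ σ ≤ B × SubFit B e σ

SubFit B (lit v)    σ = Unit
SubFit B (reg r)    σ = Unit
SubFit B (cell a e) σ = Fits B e σ
SubFit B (op o d e) σ = Fits B d σ × Fits B e σ

-- Exec B p σ σ′ t: started in σ, the program p halts in σ′ after t units
-- of time, with all values at most B.
data Exec (B : ℕ) : Program → Store → Store → ℕ → Set where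
  skip   : ∀ {σ} → Exec B skip σ σ 1
  assign : ∀ {r e σ} → Fits B e σ →
           Exec B (r ≔ e) σ (setReg r (⟦ e ⟧ σ) σ) (1 + cost e)
  write  : ∀ {a d e σ} → Fits B d σ → Fits B e σ →
           Exec B (a [ d ]≔ e) σ
             (setArray a (update (⟦ d ⟧ σ) (⟦ e ⟧ σ) (arrays σ a)) σ)
             (1 + cost d + cost e)
  seq    : ∀ {p q σ σ₁ σ₂ s t} → Exec B p σ σ₁ s → Exec B q σ₁ σ₂ t →
           Exec B (p ⨾ q) σ σ₂ (s + t)
  then′  : ∀ {e p q σ σ₁ t} → Fits B e σ → ⟦ e ⟧ σ ≢ 0 → Exec B p σ σ₁ t →
           Exec B (cond e p q) σ σ₁ (1 + cost e + t)
  else′  : ∀ {e p q σ σ₁ t} → Fits B e σ → ⟦ e ⟧ σ ≡ 0 → Exec B q σ σ₁ t →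
           Exec B (cond e p q) σ σ₁ (1 + cost e + t)
  stop   : ∀ {e p σ} → Fits B e σ → ⟦ e ⟧ σ ≡ 0 →
           Exec B (while e p) σ σ (1 + cost e)
  loop   : ∀ {e p σ σ₁ σ₂ s t} → Fits B e σ → ⟦ e ⟧ σ ≢ 0 →
           Exec B p σ σ₁ s → Exec B (while e p) σ₁ σ₂ t →
           Exec B (while e p) σ σ₂ (1 + cost e + s + t)
  call   : ∀ {p a e b σ σ₁ t} → Fits B e σ →
           let x = applyUpTo (arrays σ a) (⟦ e ⟧ σ) in
           Exec B p (initial x) σ₁ t →
           Exec B (call p a e b) σ
             (setArray b (overwrite (output σ₁) (arrays σ b)) σ)
             (1 + cost e + length x + t + length (output σ₁))

-- Run B p x y t: on input x, p outputs y in time t, where reading the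
-- input and emitting the output are charged as well.
Run : ℕ → Program → List ℕ → List ℕ → ℕ → Set
Run B p x y t =
  ∃[ σ ] ∃[ s ] Exec B p (initial x) σ s × output σ ≡ y × t ≡ length x + s + length y

-- Words have O(log N) bits, N being the length of the input plus its
-- largest entry.
wordLimit : ℕ → List ℕ → ℕ
wordLimit k x = (2 + length x + foldr _⊔_ 0 x) ^ k

------------------------------------------------------------------------
-- Problems, algorithms and running times

record Problem : Set₁ where
  field
    Input  : Set
    encode : Input → List ℕ
    Answer : Input → List ℕ → Set
open Problem public

record Algorithm (P : Problem) : Set where
  field
    program      : Program
    wordExponent : ℕ
    answer       : Input P → List ℕ
    time         : Input P → ℕ
    runs         : ∀ i → Run (wordLimit wordExponent (encode P i)) program
                             (encode P i) (answer i) (time i)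
    correct      : ∀ i → Answer P i (answer i)
open Algorithm public

_∈O_ : {I : Set} → (I → ℕ) → (I → ℚ) → Set
f ∈O g = ∃[ c ] ∀ i → fromℕ (f i) ≤ℚ fromℕ c *ℚ g i

-- No fixed word limit here: values of f may be arbitrarily large.
Computable : ∀ {k} → (Vec ℕ k → ℕ) → Set
Computable f = ∃[ p ] ∀ v → ∃[ B ] ∃[ t ] Run B p (toListᵛ v) (f v ∷ []) t

evalPoly : List ℕ → ℕ → ℕ
evalPoly p x = foldr (λ a r → a + x * r) 0 p

-- Encoding length in bits.
size : List ℕ → ℕ
size x = sum (map (λ a → 1 + ⌊log₂ a ⌋) x)

IsFPT : ∀ {k} {P : Problem} → (Input P → Vec ℕ k) → Algorithm P → Set
IsFPT {k} {P} κ A =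
  Σ[ f ∈ (Vec ℕ k → ℕ) ] Computable f ×
  ∃[ p ] time A ∈O (λ i → fromℕ (f (κ i) * evalPoly p (size (encode P i))))

------------------------------------------------------------------------
-- Graphs and shortest paths

-- Finite simple undirected graphs; the edge {u , v} is stored with u < v.
record Graph : Set where
  field
    n m       : ℕ
    ends      : Fin m → Fin n × Fin n
    ordered   : ∀ e → proj₁ (ends e) <ᶠ proj₂ (ends e)
    injective : ∀ {e e′} → ends e ≡ ends e′ → e ≡ e′

record Network : Set where
  field
    graph    : Graph
  open Graph graph public
  field
    len      : Fin m → ℕ
    positive : ∀ e → 1 ≤ len e

module _ (N : Network) where
  open Network N

  Joins : Fin m → Fin n → Fin n → Set
  Joins e u v = ends e ≡ (u , v) ⊎ ends e ≡ (v , u)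

  data Walk (F : Subset m) : Fin n → Fin n → Set where
    nil  : ∀ {u} → Walk F u u
    cons : ∀ {u v x} (e : Fin m) → e ∈ F → Joins e u v → Walk F v x → Walk F u x

  vertices : ∀ {F u v} → Walk F u v → List (Fin n)
  vertices {u = u} nil            = u ∷ []
  vertices {u = u} (cons e _ _ p) = u ∷ vertices p

  edges : ∀ {F u v} → Walk F u v → List (Fin m)
  edges nil            = []
  edges (cons e _ _ p) = e ∷ edges p

  Path : Subset m → Fin n → Fin n → Set
  Path F u v = Σ[ p ∈ Walk F u v ] Unique (vertices p)

  pathEdges : ∀ {F u v} → Path F u v → List (Fin m)
  pathEdges p = edges (proj₁ p)

  pathLength : ∀ {F u v} → Path F u v → ℕ
  pathLength p = sum (map len (pathEdges p))

  Connected : Set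
  Connected = NonZero n × (∀ u v → Path ⊤ u v)

  -- Dist F u v d: ℓ_H[u , v] = d, where H = (V , F).
  Dist : Subset m → Fin n → Fin n → ℕ → Set
  Dist F u v d =
    (Σ[ p ∈ Path F u v ] pathLength p ≡ d) × (∀ (q : Path F u v) → d ≤ pathLength q)

  IsSpanner : ℚ → Subset m → Set
  IsSpanner α F =
    ∀ u v d → Dist ⊤ u v d → ∃[ d′ ] Dist F u v d′ × fromℕ d′ ≤ℚ α *ℚ fromℕ d

  data Shortest (u v : Fin n) : Maybe ℕ → Set where
    none : ¬ Path ⊤ u v → Shortest u v nothing
    some : ∀ {d} → Dist ⊤ u v d → Shortest u v (just d)

  -- The lengths of a shortest and of a second shortest path.
  data TwoShortest (u v : Fin n) : Maybe ℕ → Maybe ℕ → Set where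
    none : ¬ Path ⊤ u v → TwoShortest u v nothing nothing
    one  : (p : Path ⊤ u v) →
           (∀ (q : Path ⊤ u v) → pathEdges q ≡ pathEdges p) →
           TwoShortest u v (just (pathLength p)) nothing
    two  : (p p′ : Path ⊤ u v) → pathEdges p ≢ pathEdges p′ →
           (∀ (q : Path ⊤ u v) → pathLength p ≤ pathLength q) →
           (∀ (q : Path ⊤ u v) → pathEdges q ≢ pathEdges p → pathLength p′ ≤ pathLength q) →
           TwoShortest u v (just (pathLength p)) (just (pathLength p′))

  encodeNetwork : List ℕ
  encodeNetwork = n ∷ m ∷ concatMap
    (λ e → toℕ (proj₁ (ends e)) ∷ toℕ (proj₂ (ends e)) ∷ len e ∷ []) (allFin m)

encodeMaybe : Maybe ℕ → ℕ
encodeMaybe = maybe suc 0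

record PairQuery : Set where
  field
    network       : Network
    source target : Fin (Network.n network)

singlePair : Problem
singlePair = record
  { Input  = PairQuery
  ; encode = λ i → let open PairQuery i in
      toℕ source ∷ toℕ target ∷ encodeNetwork network
  ; Answer = λ i y → let open PairQuery i in
      ∃[ d ] Shortest network source target d × y ≡ encodeMaybe d ∷ []
  }

-- Only the lengths are demanded: writing down all paths explicitly may
-- already take time of order n³.
allPairsTwo : Problem
allPairsTwo = record
  { Input  = Network
  ; encode = encodeNetwork
  ; Answer = λ N y → let open Network N in
      Σ[ D ∈ (Fin n → Fin n → Maybe ℕ × Maybe ℕ) ]
        (∀ u v → TwoShortest N u v (proj₁ (D u v)) (proj₂ (D u v))) ×
        y ≡ concatMap (λ u → concatMap (λ v →
              encodeMaybe (proj₁ (D u v)) ∷ encodeMaybe (proj₂ (D u v)) ∷ [])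
              (allFin n)) (allFin n)
  }

-- SPSP(n , m) and APSP₂(n , m): running times of suitable algorithms.

IsSPSPTime : (ℕ → ℕ → ℕ) → Set
IsSPSPTime spsp =
  (Σ[ A ∈ Algorithm singlePair ] ∀ i → let open Network (PairQuery.network i) in
     time A i ≤ spsp n m) ×
  (∃[ c ] ∃[ d ] ∀ n m → spsp n m ≤ c * (1 + n + m) ^ d)

IsAPSP₂Time : (ℕ → ℕ → ℕ) → Set
IsAPSP₂Time apsp₂ =
  (Σ[ A ∈ Algorithm allPairsTwo ] ∀ i → let open Network i in time A i ≤ apsp₂ n m) ×
  -- n ≥ 2, since n m + n² log n vanishes on the one-vertex graph.
  (∃[ c ] ∀ n m → 2 ≤ n → apsp₂ n m ≤ c * (n * m + n ^ 2 * ⌈log₂ n ⌉))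

------------------------------------------------------------------------
-- The spanner problem

record Instance : Set where
  field
    network   : Network
  open Network network public
  field
    connected : Connected network
    weight    : Fin m → ℕ
    α         : ℚ
    1≤α       : 1ℚ ≤ℚ α
    W         : ℕ
    -- Edges that do not settle themselves have been removed.
    settled   : ∀ e d → Dist network ⊤ (proj₁ (ends e)) (proj₂ (ends e)) d →
                fromℕ (len e) ≤ℚ α *ℚ fromℕ d

  totalWeight : Subset m → ℕ
  totalWeight X = sum (map weight (filter (_∈? X) (allFin m)))

  Witness : Subset m → Set
  Witness F = IsSpanner network α F × W ≤ totalWeight (∁ F)

  numα denα : ℕ
  numα = ∣ ↥ α ∣
  denα = ↧ₙ α

  encodeInstance : List ℕ
  encodeInstance = n ∷ m ∷ W ∷ numα ∷ denα ∷ concatMap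
    (λ e → toℕ (proj₁ (ends e)) ∷ toℕ (proj₂ (ends e)) ∷ weight e ∷ len e ∷ []) (allFin m)

-- The bound ℓmax is not part of the encoded input.
record BoundedInstance : Set where
  field
    inst    : Instance
  open Instance inst public
  field
    ℓmax    : ℕ
    bounded : ∀ e → len e ≤ ℓmax

record CoupledInstance : Set where
  field
    inst    : Instance
  open Instance inst public
  field
    coupled : ∀ e → weight e ≡ len e × 0 < weight e

decision : {I : Set} → (I → Instance) → Problem
decision {I} inst = record
  { Input  = I
  ; encode = λ i → Instance.encodeInstance (inst i)
  ; Answer = λ i y → let open Instance (inst i) in
      (∃ Witness × y ≡ 1 ∷ []) ⊎ (¬ ∃ Witness × y ≡ 0 ∷ [])
  }

-- A subset of the edges is output as its characteristic vector.
search : {I : Set} → (I → Instance) → Problem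
search {I} inst = record
  { Input  = I
  ; encode = λ i → Instance.encodeInstance (inst i)
  ; Answer = λ i y → let open Instance (inst i) in
      (∃[ F ] Witness F × y ≡ 1 ∷ map fromBool (toListᵛ F)) ⊎ (¬ ∃ Witness × y ≡ 0 ∷ [])
  }

-- W^(2W+1) τ^(2W) SPSP + APSP₂
timeBound : (W : ℕ) (τ : ℚ) (spsp apsp₂ : ℕ) → ℚ
timeBound W τ spsp apsp₂ =
  fromℕ (W ^ (2 * W + 1)) *ℚ τ ^ℚ (2 * W) *ℚ fromℕ spsp +ℚ fromℕ apsp₂

module _ (spsp apsp₂ : ℕ → ℕ → ℕ) where

  boundedTime : BoundedInstance → ℚ
  boundedTime i = timeBound W (α *ℚ fromℕ ℓmax) (spsp n m) (apsp₂ n m)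
    where open BoundedInstance i

  coupledTime : CoupledInstance → ℚ
  coupledTime i = timeBound W (α *ℚ fromℕ W) (spsp n m) (apsp₂ n m)
    where open CoupledInstance i

boundedParameter : BoundedInstance → Vec ℕ 4
boundedParameter i = W ∷ᵛ ℓmax ∷ᵛ numα ∷ᵛ denα ∷ᵛ []ᵛ
  where open BoundedInstance i

coupledParameter : CoupledInstance → Vec ℕ 3
coupledParameter i = W ∷ᵛ numα ∷ᵛ denα ∷ᵛ []ᵛ
  where open CoupledInstance i

{-# OPTIONS --safe #-}

-- Only edges of positive weight with a detour, i.e. a path of length at most
-- α ℓ(e) between the ends of e that avoids e, are worth removing; the lengths
-- of two shortest paths between the ends of e tell whether there is one.  It
-- suffices to know 4 W T such candidates, where T bounds the lengths of the
-- detours: if none of them has weight W on its own, then W of them can be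
-- chosen so that no detour uses another chosen edge, by greedily taking a
-- vertex of low indegree in the digraph in which every candidate points to
-- the edges of its detour.  Hence it is enough to test all W-tuples of these
-- candidates.  A tuple passes if its edges have total weight at least W and
-- each of them has a detour avoiding the whole tuple, which takes W shortest
-- path computations.
module Submission where

open import Defs
open import Data.Bool using (Bool; true; false; if_then_else_; T; not)
open import Data.Empty using (⊥; ⊥-elim)
open import Data.Fin using (Fin; toℕ; fromℕ<; zero; suc) renaming (_≟_ to _≟ᶠ_)
open import Data.Fin.Properties using (toℕ<n; toℕ-fromℕ<; toℕ-injective) renaming (<⇒≢ to <⇒≢ᶠ)
open import Data.Fin.Subset using (Subset; _∈_; _∉_; ⊤; ∁)
open import Data.Fin.Subset.Properties using (_∈?_; ∈⊤; x∈∁p⇒x∉p; x∉p⇒x∈∁p; x∈p⇒x∉∁p)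
import Data.Integer as ℤ
import Data.Integer.Properties as ℤ
open import Data.List
  using (List; []; _∷_; _++_; _∷ʳ_; map; filter; length; take; foldr; applyUpTo; upTo; allFin; concatMap; tabulate; replicate)
open import Data.List.Membership.DecPropositional using () renaming (_∈?_ to member?)
open import Data.List.Membership.Propositional using (find; lose) renaming (_∈_ to _∈ˡ_; _∉_ to _∉ˡ_)
open import Data.List.Membership.Propositional.Properties
  using (∈-∃++; ∈-++⁻; ∈-++⁺ˡ; ∈-++⁺ʳ; ∈-filter⁻; ∈-filter⁺; ∈-map⁻; ∈-map⁺; ∈-allFin; ∈-applyUpTo⁻; ∈-applyUpTo⁺; ∈-concatMap⁺)
open import Data.List.Properties
  using (≡-dec; map-++; map-cong-local; map-∘; concatMap-++; ++-identityʳ; ++-assoc; length-++; length-map; length-take;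
         length-tabulate; length-applyUpTo; applyUpTo-∷ʳ; upTo-∷ʳ)
open import Data.List.Relation.Unary.All using (All; []; _∷_)
import Data.List.Relation.Unary.All as All
import Data.List.Relation.Unary.All.Properties as All
open import Data.List.Relation.Unary.AllPairs using (AllPairs; []; _∷_)
import Data.List.Relation.Unary.AllPairs as AllPairs
import Data.List.Relation.Unary.AllPairs.Properties as AllPairs
open import Data.List.Relation.Unary.Any using (here; there; any?)
open import Data.List.Relation.Unary.Unique.Propositional using (Unique)
import Data.List.Relation.Unary.Unique.Propositional.Properties as Unique
open import Data.Maybe using (Maybe; just; nothing)
open import Data.Nat
open import Data.Nat.DivMod
  using (m/n≤m; m/n*n≤m; m*n/n≡m; /-monoˡ-≤; m%n<n; m<n⇒m%n≡m; n%n≡0; [m+kn]%n≡m%n)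
open import Data.Nat.ListAction using (sum)
open import Data.Nat.ListAction.Properties using (sum-++)
open import Data.Nat.Logarithm using (⌊log₂_⌋; ⌈log₂_⌉; ⌈log₂⌉-mono-≤; ⌈log₂2^n⌉≡n)
open import Data.Nat.Properties
open import Data.Nat.Tactic.RingSolver using (solve-∀)
open import Data.Product using (_×_; _,_; proj₁; proj₂; ∃; ∃-syntax; Σ; Σ-syntax)
open import Data.Product.Properties using (,-injective)
open import Data.Rational using (ℚ; mkℚ; 1ℚ; ↥_; ↧ₙ_; toℚᵘ; NonNegative; nonNegative)
  renaming (_≤_ to _≤ℚ_; _+_ to _+ℚ_; _*_ to _*ℚ_; *≤* to *≤*ℚ)
import Data.Rational.Properties as ℚ
open import Data.Rational.Unnormalised using (mkℚᵘ; *≤*; *≡*) renaming (_≃_ to _≃ᵘ_; _*_ to _*ᵘ_)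
import Data.Rational.Unnormalised.Properties as ℚᵘ
open import Data.Sum using (_⊎_; inj₁; inj₂; [_,_]′)
open import Data.Unit using (tt) renaming (⊤ to Unit)
open import Data.Vec using (Vec) renaming (_∷_ to _∷ᵛ_; [] to []ᵛ)
import Data.Vec as Vec
import Data.Vec.Properties as Vec
open import Function using (_∘_; const; id; case_of_)
open import Function.Bundles using (_⇔_; mk⇔; Equivalence)
open import Relation.Binary.PropositionalEquality
open import Relation.Nullary using (¬_; yes; no; does; Dec)
open import Relation.Nullary.Decidable using (_⊎-dec_; ¬?; dec-true; dec-false)
open import Relation.Unary using (Decidable)

-- Executions on the word RAM

-- Every candidate also points to itself, so that independent candidates are distinct edges.
-- Outdegrees are then at most `1 + T ≤ 2 T`, and each chosen vertex excludes at most twice that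
-- number, whence `4 T` candidates per chosen edge. `T` has to bound the detours only of edges
-- lighter than `W`, so it is computed from the largest length of such an edge. This lets one
-- program serve both cases although it does not know `ℓmax`: such a length is at most `ℓmax`, and
-- below `W` in a coupled instance. There are at most `(4 W T) ^ W` tuples with `W` queries each;
-- since `4 ^ W ≤ 64 W ^ W`, this stays within a constant factor of `W ^ (2 W + 1) T ^ (2 W)`. The
-- given algorithms shape the rest. How `spsp` behaves when edges disappear is unknown, so queries
-- keep `n` and `m`. Their running times are at least the length of their input, which absorbs every
-- overhead linear in `m`. As words are polynomially bounded in the input, every intermediate value
-- needs a polynomial bound of fixed degree.

SubFit-mono : ∀ {B B′} → B ≤ B′ → ∀ e {σ} → SubFit B e σ → SubFit B′ e σ
Fits-mono   : ∀ {B B′} → B ≤ B′ → ∀ e {σ} → Fits B e σ → Fits B′ e σ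
Fits-mono B≤B′ e (v , s) = ≤-trans v B≤B′ , SubFit-mono B≤B′ e s
SubFit-mono B≤B′ (lit v)    s = tt
SubFit-mono B≤B′ (reg r)    s = tt
SubFit-mono B≤B′ (cell a e) s = Fits-mono B≤B′ e s
SubFit-mono B≤B′ (op o d e) (s , t) = Fits-mono B≤B′ d s , Fits-mono B≤B′ e t

Exec-mono : ∀ {B B′ p σ σ′ t} → B ≤ B′ → Exec B p σ σ′ t → Exec B′ p σ σ′ t
Exec-mono B≤ skip = skip
Exec-mono B≤ (assign {e = e} f) = assign (Fits-mono B≤ e f)
Exec-mono B≤ (write {d = d} {e} f g) = write (Fits-mono B≤ d f) (Fits-mono B≤ e g)
Exec-mono B≤ (seq x y) = seq (Exec-mono B≤ x) (Exec-mono B≤ y)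
Exec-mono B≤ (then′ {e = e} f n x) = then′ (Fits-mono B≤ e f) n (Exec-mono B≤ x)
Exec-mono B≤ (else′ {e = e} f n x) = else′ (Fits-mono B≤ e f) n (Exec-mono B≤ x)
Exec-mono B≤ (stop {e = e} f n) = stop (Fits-mono B≤ e f) n
Exec-mono B≤ (loop {e = e} f n x y) = loop (Fits-mono B≤ e f) n (Exec-mono B≤ x) (Exec-mono B≤ y)
Exec-mono B≤ (call {e = e} f x) = call (Fits-mono B≤ e f) (Exec-mono B≤ x)

update-all : {A : Set} (P : A → Set) → ∀ i v (f : ℕ → A) → P v → (∀ j → P (f j)) → ∀ j → P (update i v f j)
update-all P i v f pv pf j with i ≡ᵇ j
... | true  = pv
... | false = pf j

update-at : {A : Set} → ∀ i {v : A} (f : ℕ → A) → update i v f i ≡ v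
update-at i f with i ≡ᵇ i | ≡⇒≡ᵇ i i refl
... | true | _ = refl

update-≢ : {A : Set} → ∀ i {v : A} (f : ℕ → A) {j} → i ≢ j → update i v f j ≡ f j
update-≢ i f {j} i≢j with i ≡ᵇ j | ≡ᵇ⇒≡ i j
... | true  | eq = ⊥-elim (i≢j (eq tt))
... | false | _  = refl

overwrite-all : (P : ℕ → Set) → ∀ n {g} f → (∀ j → P (g j)) → (∀ j → P (f j)) →
                ∀ j → P (overwrite (applyUpTo g n) f j)
overwrite-all P zero    f pg pf j       = pf j
overwrite-all P (suc n) f pg pf zero    = pg 0
overwrite-all P (suc n) f pg pf (suc j) =
  overwrite-all P n (f ∘ suc) (pg ∘ suc) (pf ∘ suc) j

Bounded : ℕ → Store → Set
Bounded B σ = (∀ r → regs σ r ≤ B) × (∀ a i → arrays σ a i ≤ B)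

initial-bounded : ∀ {B} n g → n ≤ B → (∀ j → g j ≤ B) → Bounded B (initial (applyUpTo g n))
initial-bounded {B} n g n≤B g≤B =
  update-all (_≤ B) 0 (length (applyUpTo g n)) (λ _ → 0) (subst (_≤ B) (sym (length-applyUpTo g n)) n≤B) (λ _ → z≤n) ,
  update-all (λ f → ∀ i → f i ≤ B) 0 (overwrite (applyUpTo g n) (λ _ → 0)) (λ _ _ → 0) (overwrite-all (_≤ B) n _ g≤B (λ _ → z≤n)) (λ _ _ → z≤n)

-- Nothing is known about the output of a called program except that every value it computes
-- respects the word limit. This invariant is what bounds the target array after a call.
Exec-bounded : ∀ {B p σ σ′ t} → Exec B p σ σ′ t → Bounded B σ → Bounded B σ′
Exec-bounded skip b = b
Exec-bounded {B} (assign {r} {e} {σ} f) (b , c) = update-all (_≤ B) r (⟦ e ⟧ σ) (regs σ) (proj₁ f) b , c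
Exec-bounded {B} (write {a} {d} {e} {σ} f g) (b , c) =
  b , update-all (λ h → ∀ i → h i ≤ B) a (update (⟦ d ⟧ σ) (⟦ e ⟧ σ) (arrays σ a)) (arrays σ)
        (update-all (_≤ B) (⟦ d ⟧ σ) (⟦ e ⟧ σ) (arrays σ a) (proj₁ g) (c a)) c
Exec-bounded (seq x y) b = Exec-bounded y (Exec-bounded x b)
Exec-bounded (then′ f n x) b = Exec-bounded x b
Exec-bounded (else′ f n x) b = Exec-bounded x b
Exec-bounded (stop f n) b = b
Exec-bounded (loop f n x y) b = Exec-bounded y (Exec-bounded x b)
Exec-bounded {B} (call {a = a} {b = t} {σ = σ} {σ₁ = σ₁} f x) (b , c) =
  b , update-all (λ h → ∀ i → h i ≤ B) t (overwrite (output σ₁) (arrays σ t)) (arrays σ)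
        (overwrite-all (_≤ B) (regs σ₁ 1) (arrays σ t)
          (proj₂ (Exec-bounded x (initial-bounded _ (arrays σ a) (proj₁ f) (c a))) 1) (c t)) c

-- Both predicates compute to products of unit types on concrete programs, so the frame conditions
-- in `Agree` can be implicit arguments that are solved by eta.
UnmodifiedReg UnmodifiedArray : Program → ℕ → Set
UnmodifiedReg skip         q = Unit
UnmodifiedReg (r ≔ e)      q = T (not (r ≡ᵇ q))
UnmodifiedReg (a [ d ]≔ e) q = Unit
UnmodifiedReg (x ⨾ y)      q = UnmodifiedReg x q × UnmodifiedReg y q
UnmodifiedReg (cond e x y) q = UnmodifiedReg x q × UnmodifiedReg y q
UnmodifiedReg (while e x)  q = UnmodifiedReg x q
UnmodifiedReg (call _ _ _ _) q = Unit
UnmodifiedArray skip         q = Unit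
UnmodifiedArray (r ≔ e)      q = Unit
UnmodifiedArray (a [ d ]≔ e) q = T (not (a ≡ᵇ q))
UnmodifiedArray (x ⨾ y)      q = UnmodifiedArray x q × UnmodifiedArray y q
UnmodifiedArray (cond e x y) q = UnmodifiedArray x q × UnmodifiedArray y q
UnmodifiedArray (while e x)  q = UnmodifiedArray x q
UnmodifiedArray (call _ _ _ b) q = T (not (b ≡ᵇ q))

record Agree (p : Program) (σ σ′ : Store) : Set where
  constructor agree
  field
    keepReg   : ∀ r {u : UnmodifiedReg p r} → regs σ′ r ≡ regs σ r
    keepArray : ∀ a {u : UnmodifiedArray p a} → arrays σ′ a ≡ arrays σ a
open Agree public

update-other : {A : Set} → ∀ i {v : A} (f : ℕ → A) j → T (not (i ≡ᵇ j)) → update i v f j ≡ f j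
update-other i f j u with i ≡ᵇ j
... | false = refl

Exec-agree : ∀ {B p σ σ′ t} → Exec B p σ σ′ t → Agree p σ σ′
Exec-agree skip = agree (λ _ → refl) (λ _ → refl)
Exec-agree (assign {r} {σ = σ} f) = agree (λ q {u} → update-other r (regs σ) q u) (λ _ → refl)
Exec-agree (write {a} {σ = σ} f g) = agree (λ _ → refl) (λ q {u} → update-other a (arrays σ) q u)
Exec-agree (seq x y) with Exec-agree x | Exec-agree y
... | agree r a | agree s b =
  agree (λ q {u} → trans (s q {proj₂ u}) (r q {proj₁ u})) (λ q {u} → trans (b q {proj₂ u}) (a q {proj₁ u}))
Exec-agree (then′ f n x) with Exec-agree x
... | agree r a = agree (λ q {u} → r q {proj₁ u}) (λ q {u} → a q {proj₁ u})
Exec-agree (else′ f n x) with Exec-agree x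
... | agree r a = agree (λ q {u} → r q {proj₂ u}) (λ q {u} → a q {proj₂ u})
Exec-agree (stop f n) = agree (λ _ → refl) (λ _ → refl)
Exec-agree (loop f n x y) with Exec-agree x | Exec-agree y
... | agree r a | agree s b =
  agree (λ q {u} → trans (s q {u}) (r q {u})) (λ q {u} → trans (b q {u}) (a q {u}))
Exec-agree (call {b = b} {σ = σ} f x) = agree (λ _ → refl) (λ q {u} → update-other b (arrays σ) q u)

Agree-refl : ∀ {p σ} → Agree p σ σ
Agree-refl = agree (λ _ → refl) (λ _ → refl)

-- Junk on loops and calls.
run : Program → Store → Store
run skip         σ = σ
run (r ≔ e)      σ = setReg r (⟦ e ⟧ σ) σ
run (a [ d ]≔ e) σ = setArray a (update (⟦ d ⟧ σ) (⟦ e ⟧ σ) (arrays σ a)) σ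
run (p ⨾ q)      σ = run q (run p σ)
run (cond e p q) σ = if ⟦ e ⟧ σ ≡ᵇ 0 then run q σ else run p σ
run (while e p)  σ = σ
run (call _ _ _ _) σ = σ

-- A conditional is charged for both branches: a sum in place of a maximum costs only a constant
-- factor and keeps all time estimates additive.
duration : Program → ℕ
duration skip         = 1
duration (r ≔ e)      = 1 + cost e
duration (a [ d ]≔ e) = 1 + cost d + cost e
duration (p ⨾ q)      = duration p + duration q
duration (cond e p q) = 1 + cost e + (duration p + duration q)
duration (while e p)  = 0
duration (call _ _ _ _) = 0

-- A program logic with value bounds and time bounds

for : ℕ → ℕ → Program → Program
for i n p = i ≔ lit 0 ⨾ while (op less (reg i) (reg n)) (p ⨾ i ≔ op add (reg i) (lit 1))

-- Degrees give static bounds: a value of degree d is at most M ^ d, and one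
-- without a degree is only known to be at most the word limit.
maxDegree : ℕ
maxDegree = 40

infix 4 _⊑_
_⊑_ : Maybe ℕ → Maybe ℕ → Set
_      ⊑ nothing = Unit
just d ⊑ just e  = T (d ≤ᵇ e)
nothing ⊑ just e = ⊥

finite small : Maybe ℕ → Set
finite (just d) = T (d ≤ᵇ maxDegree)
finite nothing  = ⊥
small (just d) = T (d ≤ᵇ maxDegree)
small nothing  = Unit

combine : (ℕ → ℕ → ℕ) → Maybe ℕ → Maybe ℕ → Maybe ℕ
combine f (just d) (just e) = just (f d e)
combine f _        _        = nothing

module Static (Γr Γa : ℕ → Maybe ℕ) where

  -- A sum costs one additional degree because the base `M` is at least 2. A literal `v` has degree
  -- `v` because `v ≤ M ^ v`. A remainder is at most the divisor, also for divisor 0, where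
  -- `applyOp` returns 0.
  degree : Expr → Maybe ℕ
  degree (lit v)        = just v
  degree (reg r)        = Γr r
  degree (cell a e)     = Γa a
  degree (op add d e)   = combine (λ x y → suc (x ⊔ y)) (degree d) (degree e)
  degree (op monus d e) = degree d
  degree (op mul d e)   = combine _+_ (degree d) (degree e)
  degree (op quot d e)  = degree d
  degree (op rem d e)   = degree e
  degree (op less d e)  = just 0
  degree (op equal d e) = just 0

  Typed : Expr → Set
  Typed (lit v)        = finite (just v)
  Typed (reg r)        = small (Γr r)
  Typed (cell a e)     = small (Γa a) × Typed e
  Typed (op add d e)   = finite (degree (op add d e)) × Typed d × Typed e
  Typed (op mul d e)   = finite (degree (op mul d e)) × Typed d × Typed e
  Typed (op o d e)     = Typed d × Typed e

  Straight : Program → Set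
  Straight skip         = Unit
  Straight (r ≔ e)      = Typed e × degree e ⊑ Γr r
  Straight (a [ d ]≔ e) = Typed d × Typed e × degree e ⊑ Γa a
  Straight (p ⨾ q)      = Straight p × Straight q
  Straight (cond e p q) = Typed e × Straight p × Straight q
  Straight (while e p)  = ⊥
  Straight (call _ _ _ _) = ⊥

  module Logic (M B : ℕ) (2≤M : 2 ≤ M) (M^≤B : M ^ maxDegree ≤ B) where

    bound : Maybe ℕ → ℕ
    bound (just d) = M ^ d
    bound nothing  = B

    Ok : Store → Set
    Ok σ = (∀ r → regs σ r ≤ bound (Γr r)) × (∀ a i → arrays σ a i ≤ bound (Γa a))

    private instance
      M≢0 : NonZero M
      M≢0 = >-nonZero (≤-trans (s≤s z≤n) 2≤M)

    ^-grow : ∀ {d e} → d ≤ e → M ^ d ≤ M ^ e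
    ^-grow = ^-monoʳ-≤ M

    finite-bound : ∀ {d} → finite d → bound d ≤ B
    finite-bound {just d} u = ≤-trans (^-grow (≤ᵇ⇒≤ d maxDegree u)) M^≤B

    small-bound : ∀ d → small d → bound d ≤ B
    small-bound (just d) u = finite-bound {just d} u
    small-bound nothing  u = ≤-refl

    ⊑-bound : ∀ d e → small d → d ⊑ e → bound d ≤ bound e
    ⊑-bound d nothing s u = small-bound d s
    ⊑-bound (just d) (just e) s u = ^-grow (≤ᵇ⇒≤ d e u)

    m≤M^m : ∀ m → m ≤ M ^ m
    m≤M^m zero = z≤n
    m≤M^m (suc m) = begin
      suc m              ≡⟨ +-comm 1 m ⟩
      m + 1              ≤⟨ +-mono-≤ (m≤M^m m) (m^n>0 M m) ⟩
      M ^ m + M ^ m      ≡⟨ cong (M ^ m +_) (sym (+-identityʳ _)) ⟩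
      2 * M ^ m          ≤⟨ *-monoˡ-≤ (M ^ m) 2≤M ⟩
      M * M ^ m          ∎
      where open ≤-Reasoning

    +-bound : ∀ {x y} d e → x ≤ M ^ d → y ≤ M ^ e → x + y ≤ M ^ suc (d ⊔ e)
    +-bound {x} {y} d e p q = begin
      x + y                       ≤⟨ +-mono-≤ (≤-trans p (^-grow (m≤m⊔n d e))) (≤-trans q (^-grow (m≤n⊔m d e))) ⟩
      M ^ (d ⊔ e) + M ^ (d ⊔ e)   ≡⟨ cong (M ^ (d ⊔ e) +_) (sym (+-identityʳ _)) ⟩
      2 * M ^ (d ⊔ e)             ≤⟨ *-monoˡ-≤ (M ^ (d ⊔ e)) 2≤M ⟩
      M * M ^ (d ⊔ e)             ∎
      where open ≤-Reasoning

    *-bound : ∀ {x y} d e → x ≤ M ^ d → y ≤ M ^ e → x * y ≤ M ^ (d + e)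
    *-bound {x} {y} d e p q = ≤-trans (*-mono-≤ p q) (≤-reflexive (sym (^-distribˡ-+-* M d e)))

    add-value : ∀ d e {x y} → finite (combine (λ a b → suc (a ⊔ b)) d e) →
                x ≤ bound d → y ≤ bound e → x + y ≤ bound (combine (λ a b → suc (a ⊔ b)) d e)
    add-value (just d) (just e) _ p q = +-bound d e p q

    mul-value : ∀ d e {x y} → finite (combine _+_ d e) →
                x ≤ bound d → y ≤ bound e → x * y ≤ bound (combine _+_ d e)
    mul-value (just d) (just e) _ p q = *-bound d e p q

    fromBool≤1 : ∀ b → fromBool b ≤ 1
    fromBool≤1 true  = ≤-refl
    fromBool≤1 false = z≤n

    quot≤ : ∀ x y → applyOp quot x y ≤ x
    quot≤ x zero    = z≤n
    quot≤ x (suc y) = m/n≤m x (suc y)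

    rem≤ : ∀ x y → applyOp rem x y ≤ y
    rem≤ x zero    = z≤n
    rem≤ x (suc y) = <⇒≤ (m%n<n x (suc y))

    record Value (e : Expr) (σ : Store) : Set where
      constructor val
      field
        value≤ : ⟦ e ⟧ σ ≤ bound (degree e)
        fits   : Fits B e σ
        small-degree : small (degree e)
    open Value public

    finite⇒small : ∀ d → finite d → small d
    finite⇒small (just d) u = u

    value : ∀ e {σ} → Typed e → Ok σ → Value e σ
    binary : ∀ o d e {σ} → Typed d → Typed e → Ok σ → small (degree (op o d e)) →
             ⟦ op o d e ⟧ σ ≤ bound (degree (op o d e)) → Value (op o d e) σ
    binary o d e u v ok s le = val le
      (≤-trans le (small-bound (degree (op o d e)) s) , fits (value d u ok) , fits (value e v ok)) s
    value (lit v) u ok = val (m≤M^m v) (≤-trans (m≤M^m v) (finite-bound {just v} u) , tt) u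
    value (reg r) u ok = val (proj₁ ok r) (≤-trans (proj₁ ok r) (small-bound (Γr r) u) , tt) u
    value (cell a e) {σ} (u , v) ok =
      val (proj₂ ok a _) (≤-trans (proj₂ ok a _) (small-bound (Γa a) u) , fits (value e v ok)) u
    value (op add d e) (w , u , v) ok = binary add d e u v ok (finite⇒small (degree (op add d e)) w)
      (add-value (degree d) (degree e) w (value≤ (value d u ok)) (value≤ (value e v ok)))
    value (op mul d e) (w , u , v) ok = binary mul d e u v ok (finite⇒small (degree (op mul d e)) w)
      (mul-value (degree d) (degree e) w (value≤ (value d u ok)) (value≤ (value e v ok)))
    value (op monus d e) {σ} (u , v) ok = binary monus d e u v ok (small-degree (value d u ok))
      (≤-trans (m∸n≤m (⟦ d ⟧ σ) (⟦ e ⟧ σ)) (value≤ (value d u ok)))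
    value (op quot d e) {σ} (u , v) ok = binary quot d e u v ok (small-degree (value d u ok))
      (≤-trans (quot≤ (⟦ d ⟧ σ) (⟦ e ⟧ σ)) (value≤ (value d u ok)))
    value (op rem d e) {σ} (u , v) ok = binary rem d e u v ok (small-degree (value e v ok))
      (≤-trans (rem≤ (⟦ d ⟧ σ) (⟦ e ⟧ σ)) (value≤ (value e v ok)))
    value (op less d e) {σ} (u , v) ok = binary less d e u v ok tt (fromBool≤1 (⟦ d ⟧ σ <ᵇ ⟦ e ⟧ σ))
    value (op equal d e) {σ} (u , v) ok = binary equal d e u v ok tt (fromBool≤1 (⟦ d ⟧ σ ≡ᵇ ⟦ e ⟧ σ))

    update-bound : (Γ : ℕ → Maybe ℕ) {f : ℕ → ℕ} → ∀ i {v} → v ≤ bound (Γ i) →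
                   (∀ j → f j ≤ bound (Γ j)) → ∀ j → update i v f j ≤ bound (Γ j)
    update-bound Γ i v≤ f≤ j with i ≡ᵇ j | ≡ᵇ⇒≡ i j
    ... | true  | eq = subst (λ k → _ ≤ bound (Γ k)) (eq tt) v≤
    ... | false | _  = f≤ j

    setReg-ok : ∀ {σ} r {v} → v ≤ bound (Γr r) → Ok σ → Ok (setReg r v σ)
    setReg-ok {σ} r v≤ (f , g) = update-bound Γr {regs σ} r v≤ f , g

    setArray-ok : ∀ {σ} a {f} → (∀ i → f i ≤ bound (Γa a)) → Ok σ → Ok (setArray a f σ)
    setArray-ok {σ} a {f} f≤ (g , h) = g , lemma
      where
      lemma : ∀ j i → update a f (arrays σ) j i ≤ bound (Γa j)
      lemma j i with a ≡ᵇ j | ≡ᵇ⇒≡ a j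
      ... | true  | eq = subst (λ k → _ ≤ bound (Γa k)) (eq tt) (f≤ i)
      ... | false | _  = h j i

    -- A Hoare triple for total correctness with a time bound. It carries `Ok` along, so that proofs
    -- about particular programs never mention the word limit.
    record Reach (p : Program) (σ : Store) (time : ℕ) (Q : Store → Set) : Set where
      constructor reach
      field
        final  : Store
        steps  : ℕ
        exec   : Exec B p σ final steps
        within : steps ≤ time
        ok     : Ok final
        post   : Q final

    consequence : ∀ {p σ T} {P Q : Store → Set} → Reach p σ T P →
                  (∀ {σ′} → Ok σ′ → Agree p σ σ′ → P σ′ → Q σ′) → Reach p σ T Q
    consequence (reach σ′ t x w o q) f = reach σ′ t x w o (f o (Exec-agree x) q)

    -- Symbolic execution: the postcondition is asked of `run p σ`, which Agda normalises, so that
    -- many postconditions hold by computation.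
    straight : ∀ p {u : Straight p} {σ Q} → Ok σ → Q (run p σ) → Reach p σ (duration p) Q
    straight p {u} ok q with go p u ok
      where
      go : ∀ p {σ} → Straight p → Ok σ → Reach p σ (duration p) (_≡ run p σ)
      go skip u ok = reach _ _ skip ≤-refl ok refl
      go (r ≔ e) (u , v) ok with value e u ok
      ... | val le f s = reach _ _ (assign f) ≤-refl
                           (setReg-ok r (≤-trans le (⊑-bound (degree e) (Γr r) s v)) ok) refl
      go (a [ d ]≔ e) {σ} (u , v , w) ok with value d u ok | value e v ok
      ... | val _ g _ | val le f s = reach _ _ (write g f) ≤-refl
        (setArray-ok a (update-all (_≤ bound (Γa a)) (⟦ d ⟧ σ) (⟦ e ⟧ σ) (arrays σ a)
          (≤-trans le (⊑-bound (degree e) (Γa a) s w)) (proj₂ ok a)) ok) refl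
      go (p ⨾ q) (u , v) ok with go p u ok
      ... | reach σ₁ s x w ok₁ refl with go q v ok₁
      ...   | reach σ₂ t y w₂ ok₂ refl = reach σ₂ _ (seq x y) (+-mono-≤ w w₂) ok₂ refl
      go (cond e p q) {σ} (u , v , w) ok with ⟦ e ⟧ σ ≡ᵇ 0 in eq
      ... | true with go q w ok
      ...   | reach σ₁ t x l ok₁ r = reach σ₁ _
              (else′ (fits (value e u ok)) (≡ᵇ⇒≡ (⟦ e ⟧ σ) 0 (subst T (sym eq) tt)) x)
              (+-monoʳ-≤ (1 + cost e) (≤-trans l (m≤n+m (duration q) (duration p)))) ok₁ r
      go (cond e p q) {σ} (u , v , w) ok | false with go p v ok
      ...   | reach σ₁ t x l ok₁ r = reach σ₁ _
              (then′ (fits (value e u ok)) (λ z → subst T eq (≡⇒≡ᵇ (⟦ e ⟧ σ) 0 z)) x)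
              (+-monoʳ-≤ (1 + cost e) (≤-trans l (m≤m+n (duration p) (duration q)))) ok₁ r
    ... | reach σ′ t x w o refl = reach σ′ t x w o q

    infixr 4 _then_
    _then_ : ∀ {p q σ S T P Q} → Reach p σ S P →
             (∀ {σ′} → Ok σ′ → Agree p σ σ′ → P σ′ → Reach q σ′ T Q) → Reach (p ⨾ q) σ (S + T) Q
    reach σ₁ s x w o q then f with f o (Exec-agree x) q
    ... | reach σ₂ t y w₂ o₂ q₂ = reach σ₂ _ (seq x y) (+-mono-≤ w w₂) o₂ q₂

    branch : ∀ e {u : Typed e} {p q σ S T Q} → Ok σ →
             (⟦ e ⟧ σ ≢ 0 → Reach p σ S Q) → (⟦ e ⟧ σ ≡ 0 → Reach q σ T Q) →
             Reach (cond e p q) σ (1 + cost e + (S + T)) Q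
    branch e {u} {σ = σ} {S} {T} ok f g with ⟦ e ⟧ σ ≟ 0
    ... | yes z with g z
    ...   | reach σ₁ t x l ok₁ r = reach σ₁ _ (else′ (fits (value e u ok)) z x)
                                    (+-monoʳ-≤ (1 + cost e) (≤-trans l (m≤n+m T S))) ok₁ r
    branch e {u} {σ = σ} {S} {T} ok f g | no z with f z
    ...   | reach σ₁ t x l ok₁ r = reach σ₁ _ (then′ (fits (value e u ok)) z x)
                                    (+-monoʳ-≤ (1 + cost e) (≤-trans l (m≤m+n S T))) ok₁ r

    -- The index of `Inv` is fuel. The step has to find it positive whenever the guard holds, which
    -- yields termination and the time bound together. Each step also receives `Agree` with the
    -- initial store, so invariants need to mention only what the loop modifies.
    whilst : (e : Expr) {u : Typed e} (Inv : ℕ → Store → Set) → ∀ {p σ₀ T} →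
             (∀ {k σ} → Ok σ → Agree (while e p) σ₀ σ → Inv k σ → ⟦ e ⟧ σ ≢ 0 →
                ∃[ k′ ] k ≡ suc k′ × Reach p σ T (Inv k′)) →
             ∀ {k} → Ok σ₀ → Inv k σ₀ →
             Reach (while e p) σ₀ (1 + cost e + k * (1 + cost e + T))
               (λ σ → ⟦ e ⟧ σ ≡ 0 × ∃[ k′ ] Inv k′ σ)
    whilst e {u} Inv {p} {σ₀} {T} step {k} ok i = go k ok Agree-refl i
      where
      Agree-trans : ∀ {σ σ′} → Agree (while e p) σ₀ σ → Agree p σ σ′ → Agree (while e p) σ₀ σ′
      Agree-trans (agree r a) (agree s b) =
        agree (λ q {v} → trans (s q {v}) (r q {v})) (λ q {v} → trans (b q {v}) (a q {v}))
      go : ∀ k {σ} → Ok σ → Agree (while e p) σ₀ σ → Inv k σ →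
           Reach (while e p) σ (1 + cost e + k * (1 + cost e + T)) (λ σ → ⟦ e ⟧ σ ≡ 0 × ∃[ k′ ] Inv k′ σ)
      go k {σ} ok a i with ⟦ e ⟧ σ ≟ 0
      ... | yes z = reach σ _ (stop (fits (value e u ok)) z) (m≤m+n _ _) ok (z , k , i)
      ... | no n with step ok a i n
      ...   | k′ , refl , reach σ₁ s x w ok₁ i₁ with go k′ ok₁ (Agree-trans a (Exec-agree x)) i₁
      ...     | reach σ₂ t y w₂ ok₂ i₂ = reach σ₂ _ (loop (fits (value e u ok)) n x y) le ok₂ i₂
        where
        c = 1 + cost e
        le : c + s + t ≤ c + (c + T + k′ * (c + T))
        le = ≤-trans (+-mono-≤ (+-monoʳ-≤ c w) w₂) (≤-reflexive (regroup c T (k′ * (c + T))))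
          where
          regroup : ∀ c t x → c + t + (c + x) ≡ c + (c + t + x)
          regroup = solve-∀

    -- The increment of the counter cannot be typed statically, as every addition raises the degree.
    -- It is bounded by the loop limit instead; hence the common degree `d` of the two registers.
    iterate : ∀ i n {d} → Γr n ≡ just d → Γr i ≡ just d → {u : T (d ≤ᵇ maxDegree)} →
              (Inv : ℕ → Store → Set) → ∀ {p σ₀ N τ}
              {v : UnmodifiedReg p i × UnmodifiedReg p n} {w : T (not (i ≡ᵇ n))} →
              (∀ {σ} → Ok σ → Agree (for i n p) σ₀ σ → regs σ i < N → Inv (regs σ i) σ →
                 Reach p σ τ (λ σ′ → Inv (suc (regs σ i)) (setReg i (suc (regs σ i)) σ′))) →
              Ok σ₀ → regs σ₀ n ≡ N → Inv 0 (setReg i 0 σ₀) →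
              Reach (for i n p) σ₀ (6 + N * (8 + τ)) (Inv N)
    iterate i n {d} Γn Γi {u} Inv {p} {σ₀} {N} {τ} {v₁ , v₂} {w} step ok σn i₀ =
      reach _ _ (seq (assign ((z≤n , tt))) (exec ends)) time≤ (Reach.ok ends) post′
      where
      open Reach using (final; steps; exec; within; post)
      guard = op less (reg i) (reg n)
      Inv′ : ℕ → Store → Set
      Inv′ k σ = k + regs σ i ≡ N × regs σ n ≡ N × Inv (regs σ i) σ
      typed : Typed guard
      typed = subst small (sym Γi) u , subst small (sym Γn) u
      limit : ∀ {σ} → Ok σ → regs σ n ≤ M ^ d
      limit {σ} o = subst (λ e → regs σ n ≤ bound e) Γn (proj₁ o n)
      start = setReg i 0 σ₀
      start-ok = setReg-ok i {0} z≤n ok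
      start-inv : Inv′ N start
      start-inv = trans (cong (N +_) (update-at i (regs σ₀))) (+-identityʳ N) ,
                  trans (update-other i (regs σ₀) n w) σn ,
                  subst (λ k → Inv k start) (sym (update-at i (regs σ₀))) i₀
      body : ∀ {k σ} → Ok σ → Agree (while guard (p ⨾ i ≔ op add (reg i) (lit 1))) start σ → Inv′ k σ →
             ⟦ guard ⟧ σ ≢ 0 →
             ∃[ k′ ] k ≡ suc k′ × Reach (p ⨾ i ≔ op add (reg i) (lit 1)) σ (τ + 4) (Inv′ k′)
      body {zero} {σ} o a (eq , eqn , inv) ne = ⊥-elim (ne (cong fromBool (false-<ᵇ (≤-reflexive (trans eqn (sym eq))))))
        where
        false-<ᵇ : ∀ {x y} → y ≤ x → (x <ᵇ y) ≡ false
        false-<ᵇ {x} {y} y≤x with x <ᵇ y in e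
        ... | false = refl
        ... | true  = ⊥-elim (<⇒≱ (<ᵇ⇒< x y (subst T (sym e) tt)) y≤x)
      body {suc k} {σ} o (agree ar aa) (eq , eqn , inv) ne
        with step o (agree (λ q {m} → trans (ar q {proj₂ m}) (update-other i (regs σ₀) q (proj₁ m)))
                           (λ q {m} → aa q {proj₂ m}))
                  (subst (regs σ i <_) eq (s≤s (m≤n+m (regs σ i) k))) inv
      ... | reach σ₁ t x tw ok₁ inv₁ = k , refl ,
        reach (setReg i (regs σ₁ i + 1) σ₁) _ (seq x (assign fit)) (+-monoˡ-≤ 4 tw)
          (setReg-ok i (subst (λ e → _ ≤ bound e) (sym Γi) new≤) ok₁)
          ( trans (cong (k +_) (trans (update-at i (regs σ₁)) eq₁)) (trans (+-suc k _) eq)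
          , trans (update-other i (regs σ₁) n w) eqn₁
          , subst (λ y → Inv y (setReg i (regs σ₁ i + 1) σ₁)) (sym (trans (update-at i (regs σ₁)) eq₁))
              (subst (λ y → Inv (suc (regs σ i)) (setReg i y σ₁)) (sym eq₁) inv₁))
        where
        same : regs σ₁ i ≡ regs σ i
        same = keepReg (Exec-agree x) i {v₁}
        eqn₁ : regs σ₁ n ≡ N
        eqn₁ = trans (keepReg (Exec-agree x) n {v₂}) eqn
        eq₁ : regs σ₁ i + 1 ≡ suc (regs σ i)
        eq₁ = trans (+-comm _ 1) (cong suc same)
        new≤ : regs σ₁ i + 1 ≤ M ^ d
        new≤ = ≤-trans (≤-trans (≤-reflexive eq₁) (subst (suc (regs σ i) ≤_) eq (s≤s (m≤n+m (regs σ i) k))))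
                 (subst (_≤ M ^ d) eqn₁ (limit ok₁))
        fit : Fits B (op add (reg i) (lit 1)) σ₁
        fit = ≤-trans new≤ (finite-bound {just d} u) ,
              fits (value (reg i) {σ₁} (proj₁ typed) ok₁) , (≤-trans (m≤M^m 1) (finite-bound {just 1} tt) , tt)
      ends = whilst guard {typed} Inv′ {T = τ + 4} body start-ok start-inv
      post′ : Inv N (final ends)
      post′ with post ends
      ... | z , k , eq , eqn , inv = subst (λ y → Inv y (final ends)) full inv
        where
        full : regs (final ends) i ≡ N
        full = ≤-antisym (subst (regs (final ends) i ≤_) eq (m≤n+m _ k))
                 (≮⇒≥ (λ lt → 0≢1+n (trans (sym z) (cong fromBool (true-<ᵇ (subst (regs (final ends) i <_) (sym eqn) lt))))))
          where
          true-<ᵇ : ∀ {x y} → x < y → (x <ᵇ y) ≡ true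
          true-<ᵇ {x} {y} l with x <ᵇ y | <⇒<ᵇ l
          ... | true | _ = refl
      time≤ : 2 + steps ends ≤ 6 + N * (8 + τ)
      time≤ = +-monoʳ-≤ 2 (≤-trans (within ends) (+-monoʳ-≤ 4 (*-monoʳ-≤ N (≤-reflexive (cong (4 +_) (+-comm τ 4))))))

-- Walks, detours and reweighted networks

network : (G : Graph) (ℓ : Fin (Graph.m G) → ℕ) → (∀ e → 1 ≤ ℓ e) → Network
network G ℓ pos = record { graph = G ; len = ℓ ; positive = pos }

module _ {G : Graph} {ℓ ℓ′ : Fin (Graph.m G) → ℕ} {pos : ∀ e → 1 ≤ ℓ e} {pos′ : ∀ e → 1 ≤ ℓ′ e} where
  private
    N N′ : Network
    N  = network G ℓ pos
    N′ = network G ℓ′ pos′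

  -- Walks mention only the graph and the subset of edges, so they carry over between networks that
  -- differ in their lengths.
  convert : ∀ {F F′ u v} (p : Walk N F u v) → All (_∈ F′) (edges N p) → Walk N′ F′ u v
  convert nil a = nil
  convert (cons e _ j p) (i ∷ a) = cons e i j (convert p a)

  edges-convert : ∀ {F F′ u v} (p : Walk N F u v) (a : All (_∈ F′) (edges N p)) →
                  edges N′ (convert p a) ≡ edges N p
  edges-convert nil a = refl
  edges-convert (cons e _ j p) (i ∷ a) = cong (e ∷_) (edges-convert p a)

  vertices-convert : ∀ {F F′ u v} (p : Walk N F u v) (a : All (_∈ F′) (edges N p)) →
                     vertices N′ (convert p a) ≡ vertices N p
  vertices-convert nil a = refl
  vertices-convert {u = u} (cons e _ j p) (i ∷ a) = cong (u ∷_) (vertices-convert p a)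

  convertPath : ∀ {F F′ u v} (p : Path N F u v) → All (_∈ F′) (pathEdges N p) →
                Σ[ q ∈ Path N′ F′ u v ] pathEdges N′ q ≡ pathEdges N p
  convertPath (p , u) a = (convert p a , subst Unique (sym (vertices-convert p a)) u) , edges-convert p a

module Walks (N : Network) where
  open Network N

  source≢target : ∀ e → proj₁ (ends e) ≢ proj₂ (ends e)
  source≢target e = <⇒≢ᶠ (ordered e)

  joins-sym : ∀ {e u v} → Joins N e u v → Joins N e v u
  joins-sym (inj₁ x) = inj₂ x
  joins-sym (inj₂ x) = inj₁ x

  walkLength : ∀ {F u v} → Walk N F u v → ℕ
  walkLength p = sum (map len (edges N p))

  edges-in : ∀ {F u v} (p : Walk N F u v) → All (_∈ F) (edges N p)
  edges-in nil = []
  edges-in (cons e i j p) = i ∷ edges-in p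

  append : ∀ {F u v x} (p : Walk N F u v) (q : Walk N F v x) →
           Σ[ r ∈ Walk N F u x ] walkLength r ≡ walkLength p + walkLength q
  append nil q = q , refl
  append (cons e i j p) q with append p q
  ... | r , eq = cons e i j r , trans (cong (len e +_) eq) (sym (+-assoc (len e) _ _))

  backwards : ∀ {F u v} (p : Walk N F u v) → Σ[ r ∈ Walk N F v u ] walkLength r ≡ walkLength p
  backwards nil = nil , refl
  backwards (cons e i j p) with backwards p
  ... | r , eq with append r (cons e i (joins-sym j) nil)
  ...   | s , eq′ = s , trans eq′ (trans (cong₂ _+_ eq (+-identityʳ (len e))) (+-comm (walkLength p) (len e)))

  suffix : ∀ {F u v x} (p : Path N F u v) → x ∈ˡ vertices N (proj₁ p) →
           Σ[ q ∈ Path N F x v ] pathLength N q ≤ pathLength N p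
  suffix p@(nil , u) (here refl) = p , ≤-refl
  suffix p@(cons _ _ _ _ , u) (here refl) = p , ≤-refl
  suffix (cons e i j p , (_ ∷ u)) (there x∈) with suffix (p , u) x∈
  ... | q , le = q , ≤-trans le (m≤n+m _ _)

  erase : ∀ {F u v} (p : Walk N F u v) → Σ[ q ∈ Path N F u v ] pathLength N q ≤ walkLength p
  erase nil = (nil , [] ∷ []) , ≤-refl
  erase {u = u} (cons e i j p) with erase p
  ... | q , le with member? _≟ᶠ_ u (vertices N (proj₁ q))
  ...   | yes u∈ with suffix q u∈
  ...     | r , le′ = r , ≤-trans le′ (≤-trans le (m≤n+m _ _))
  erase {u = u} (cons e i j p) | q , le | no u∉ =
    (cons e i j (proj₁ q) , All.¬Any⇒All¬ _ u∉ ∷ proj₂ q) , +-monoʳ-≤ (len e) le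

  edgePath : ∀ {F} e → e ∈ F → Path N F (proj₁ (ends e)) (proj₂ (ends e))
  edgePath e i = cons e i (inj₁ refl) nil , ((source≢target e ∷ []) ∷ [] ∷ [])

  target∈ : ∀ {F u v} (p : Walk N F u v) → v ∈ˡ vertices N p
  target∈ nil = here refl
  target∈ (cons e i j p) = there (target∈ p)

  source∈ : ∀ {F u v} (p : Walk N F u v) → u ∈ˡ vertices N p
  source∈ nil = here refl
  source∈ (cons e i j p) = here refl

  endpoint∈ : ∀ {F u v e x y} (p : Walk N F u v) → e ∈ˡ edges N p → Joins N e x y → x ∈ˡ vertices N p
  endpoint∈ (cons e i (inj₁ a) p) (here refl) (inj₁ b) =
    here (proj₁ (,-injective (trans (sym b) a)))
  endpoint∈ (cons e i (inj₁ a) p) (here refl) (inj₂ b) =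
    there (subst (_∈ˡ vertices N p) (proj₂ (,-injective (trans (sym a) b))) (source∈ p))
  endpoint∈ (cons e i (inj₂ a) p) (here refl) (inj₁ b) =
    there (subst (_∈ˡ vertices N p) (proj₁ (,-injective (trans (sym a) b))) (source∈ p))
  endpoint∈ (cons e i (inj₂ a) p) (here refl) (inj₂ b) =
    here (proj₂ (,-injective (trans (sym b) a)))
  endpoint∈ (cons e i j p) (there e∈) k = there (endpoint∈ p e∈ k)

  -- If `e` is the first edge of a simple path between its ends, it leads straight to the last
  -- vertex, where the path must stop. If `e` occurs later, the source is visited twice.
  avoids : ∀ {F} e (p : Path N F (proj₁ (ends e)) (proj₂ (ends e))) →
           pathEdges N p ≢ e ∷ [] → e ∉ˡ pathEdges N p
  avoids e (p , un) = go refl p un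
    where
    go : ∀ {F u v} → ends e ≡ (u , v) → (p : Walk N F u v) → Unique (vertices N p) →
         edges N p ≢ e ∷ [] → e ∉ˡ edges N p
    go eq nil un ne ()
    go eq (cons e′ i j nil) un ne (here refl) = ne refl
    go eq (cons e′ i (inj₁ eq′) p) (_ ∷ un) ne (here refl) with p | un
    ... | nil | _ = ne refl
    ... | cons _ _ _ q | v∉ ∷ _ =
      All.lookup v∉ (target∈ q) (proj₂ (,-injective (trans (sym eq′) eq)))
    go eq (cons e′ i (inj₂ eq′) p) un ne (here refl) =
      source≢target e (trans (cong proj₁ eq) (sym (cong proj₂ eq′)))
    go eq (cons e′ i j p) (u∉ ∷ un) ne (there e∈) = All.lookup u∉ (endpoint∈ p e∈ (inj₁ eq)) refl

  edge-count : ∀ es → length es ≤ sum (map len es)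
  edge-count [] = z≤n
  edge-count (e ∷ es) = +-mono-≤ (positive e) (edge-count es)

-- Edges outside F are kept, but made longer than the threshold, so that the
-- numbers of vertices and edges do not change.
reweigh : (N : Network) → Subset (Network.m N) → ℕ → Network
reweigh N F t = network graph (λ e → if does (e ∈? F) then len e else suc t) pos
  where
  open Network N
  pos : ∀ e → 1 ≤ (if does (e ∈? F) then len e else suc t)
  pos e with does (e ∈? F)
  ... | true  = positive e
  ... | false = s≤s z≤n

module Reweigh (N : Network) (F : Subset (Network.m N)) (t : ℕ) where
  open Network N
  open Walks

  N′ : Network
  N′ = reweigh N F t

  len-in : ∀ {e} → e ∈ F → Network.len N′ e ≡ len e
  len-in {e} i with e ∈? F
  ... | yes _ = refl
  ... | no  n = ⊥-elim (n i)

  length-in : ∀ {es} → All (_∈ F) es → sum (map (Network.len N′) es) ≡ sum (map len es)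
  length-in a = cong sum (map-cong-local (All.map len-in a))

  restricted⇒reweighed : ∀ {u v} (p : Path N F u v) →
                         Σ[ q ∈ Path N′ ⊤ u v ] pathLength N′ q ≡ pathLength N p
  restricted⇒reweighed p with convertPath p (All.universal (λ _ → ∈⊤) _)
  ... | q , eq = q , trans (cong (sum ∘ map (Network.len N′)) eq) (length-in (edges-in N (proj₁ p)))

  short⇒in : ∀ es → sum (map (Network.len N′) es) ≤ t → All (_∈ F) es
  short⇒in [] le = []
  short⇒in (e ∷ es) le with e ∈? F
  ... | yes i = i ∷ short⇒in es (≤-trans (m≤n+m _ (len e)) le)
  ... | no  _ = ⊥-elim (1+n≰n (≤-trans (m≤m+n (suc t) _) le))

  reweighed⇒restricted : ∀ {u v} (q : Path N′ ⊤ u v) → pathLength N′ q ≤ t →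
                         Σ[ p ∈ Path N F u v ] pathLength N p ≡ pathLength N′ q
  reweighed⇒restricted q le with short⇒in _ le
  ... | a with convertPath q a
  ...   | p , eq = p , trans (cong (sum ∘ map len) eq) (sym (length-in a))

-- Supplied by the correctness of the given single-pair algorithm, so that shortest paths need no
-- existence proof of their own.
DistanceOracle : Set
DistanceOracle = ∀ N u v → ∃[ d ] Shortest N u v d

-- Distances in subgraphs exist, since a solution of the shortest path problem
-- on a reweighted network is given.
restrictedDistance : DistanceOracle → ∀ N F {u v} (p : Path N F u v) →
                     ∃[ d ] Dist N F u v d × d ≤ pathLength N p
-- With the length of `p` as threshold, a shortest path of the reweighted network is no longer than
-- `p` and therefore uses only edges of `F`.
restrictedDistance oracle N F {u} {v} p with oracle (reweigh N F (pathLength N p)) u v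
... | nothing , none n = ⊥-elim (n (proj₁ (Reweigh.restricted⇒reweighed N F (pathLength N p) p)))
... | just d , some ((q , refl) , least) = pathLength N q′ , ((q′ , refl) , least′) , least′ p
  where
  open Reweigh N F (pathLength N p)
  q≤ : pathLength N′ q ≤ pathLength N p
  q≤ with restricted⇒reweighed p
  ... | r , eq = ≤-trans (least r) (≤-reflexive eq)
  q′ = proj₁ (reweighed⇒restricted q q≤)
  least′ : ∀ r → pathLength N q′ ≤ pathLength N r
  least′ r with restricted⇒reweighed r
  ... | s , eq = ≤-trans (≤-reflexive (proj₂ (reweighed⇒restricted q q≤))) (≤-trans (least s) (≤-reflexive eq))

module _ (N : Network) (F : Subset (Network.m N)) (a b : ℕ)
         (detour : ∀ e → Σ[ p ∈ Path N F (proj₁ (Network.ends N e)) (proj₂ (Network.ends N e)) ]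
                     pathLength N p * b ≤ a * Network.len N e) where
  open Network N
  open Walks N

  replace : ∀ {u v} (p : Walk N ⊤ u v) → Σ[ q ∈ Walk N F u v ] walkLength q * b ≤ a * walkLength p
  replaceEdge : ∀ {u v} e → Joins N e u v → Σ[ q ∈ Walk N F u v ] walkLength q * b ≤ a * len e
  replaceEdge e j with detour e
  replaceEdge e (inj₁ eq) | (p , _) , le rewrite eq = p , le
  replaceEdge e (inj₂ eq) | (p , _) , le rewrite eq with backwards p
  ... | q , eq′ = q , ≤-trans (≤-reflexive (cong (_* b) eq′)) le
  replace nil = nil , z≤n
  replace (cons e i j p) with replaceEdge e j | replace p
  ... | q , le | r , le′ with append q r
  ...   | s , eq = s , (begin
    walkLength s * b                          ≡⟨ cong (_* b) eq ⟩
    (walkLength q + walkLength r) * b         ≡⟨ *-distribʳ-+ b (walkLength q) (walkLength r) ⟩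
    walkLength q * b + walkLength r * b       ≤⟨ +-mono-≤ le le′ ⟩
    a * len e + a * walkLength p              ≡⟨ sym (*-distribˡ-+ a (len e) (walkLength p)) ⟩
    a * walkLength (cons e i j p)             ∎)
    where open ≤-Reasoning

  -- Replacing each edge of a shortest path by its detour stretches every summand by at most
  -- `a / b`; erasing loops afterwards only shortens the walk. So the spanner condition for edges
  -- gives the one for all pairs.
  detours⇒spanner : DistanceOracle → ∀ u v d → Dist N ⊤ u v d → ∃[ d′ ] Dist N F u v d′ × d′ * b ≤ a * d
  detours⇒spanner oracle u v d ((p , refl) , _) with replace (proj₁ p)
  ... | q , le with erase q
  ...   | r , le′ with restrictedDistance oracle N F r
  ...     | d′ , dist , le″ = d′ , dist , ≤-trans (*-monoˡ-≤ b (≤-trans le″ le′)) le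

-- Lists and independent sets

sum-map-const1 : {A : Set} (xs : List A) → sum (map (const 1) xs) ≡ length xs
sum-map-const1 []       = refl
sum-map-const1 (x ∷ xs) = cong suc (sum-map-const1 xs)

unique-sum : {A : Set} (g : A → ℕ) {zs xs : List A} → Unique zs → (∀ {z} → z ∈ˡ zs → z ∈ˡ xs) →
             sum (map g zs) ≤ sum (map g xs)
unique-sum g {[]} u sub = z≤n
unique-sum g {z ∷ zs} (z∉ ∷ u) sub with ∈-∃++ (sub (here refl))
... | as , bs , refl = begin
  g z + sum (map g zs)                          ≤⟨ +-monoʳ-≤ (g z) (unique-sum g u sub′) ⟩
  g z + sum (map g (as ++ bs))                  ≡⟨ cong (g z +_) (split as bs) ⟩
  g z + (sum (map g as) + sum (map g bs))       ≡⟨ regroup (g z) (sum (map g as)) (sum (map g bs)) ⟩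
  sum (map g as) + (g z + sum (map g bs))       ≡⟨ sym (split as (z ∷ bs)) ⟩
  sum (map g (as ++ z ∷ bs))                    ∎
  where
  open ≤-Reasoning
  regroup : ∀ a b c → a + (b + c) ≡ b + (a + c)
  regroup = solve-∀
  split : ∀ as bs → sum (map g (as ++ bs)) ≡ sum (map g as) + sum (map g bs)
  split as bs = trans (cong sum (map-++ g as bs)) (sum-++ (map g as) (map g bs))
  sub′ : ∀ {y} → y ∈ˡ zs → y ∈ˡ as ++ bs
  sub′ y∈ with ∈-++⁻ as (sub (there y∈))
  ... | inj₁ i = ∈-++⁺ˡ i
  ... | inj₂ (here refl) = ⊥-elim (All.lookup z∉ y∈ refl)
  ... | inj₂ (there i) = ∈-++⁺ʳ as i

unique-length : {A : Set} {zs xs : List A} → Unique zs → (∀ {z} → z ∈ˡ zs → z ∈ˡ xs) → length zs ≤ length xs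
unique-length {zs = zs} {xs} u sub =
  subst₂ _≤_ (sum-map-const1 zs) (sum-map-const1 xs) (unique-sum (const 1) u sub)

module _ {A : Set} {P : A → Set} (P? : Decidable P) where

  length-filter-complement : ∀ xs → length xs ≡ length (filter P? xs) + length (filter (¬? ∘ P?) xs)
  length-filter-complement [] = refl
  length-filter-complement (x ∷ xs) with P? x
  ... | yes _ = cong suc (length-filter-complement xs)
  ... | no  _ = trans (cong suc (length-filter-complement xs)) (sym (+-suc _ _))

  length-filter-⊎ : {Q : A → Set} (Q? : Decidable Q) → ∀ xs →
    length (filter (λ x → P? x ⊎-dec Q? x) xs) ≤ length (filter P? xs) + length (filter Q? xs)
  length-filter-⊎ Q? [] = z≤n
  length-filter-⊎ Q? (x ∷ xs) with P? x | Q? x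
  ... | yes _ | yes _ = s≤s (≤-trans (length-filter-⊎ Q? xs) (+-monoʳ-≤ _ (n≤1+n _)))
  ... | yes _ | no  _ = s≤s (length-filter-⊎ Q? xs)
  ... | no  _ | yes _ = ≤-trans (s≤s (length-filter-⊎ Q? xs)) (≤-reflexive (sym (+-suc _ _)))
  ... | no  _ | no  _ = length-filter-⊎ Q? xs

module _ {A B : Set} {R : A → B → Set} (R? : ∀ x y → Dec (R x y)) where

  double-count : ∀ xs ys → sum (map (λ x → length (filter (R? x) ys)) xs) ≡
                           sum (map (λ y → length (filter (λ x → R? x y) xs)) ys)
  double-count [] ys = zeros ys
    where
    zeros : ∀ ys → 0 ≡ sum (map (λ _ → 0) ys)
    zeros []       = refl
    zeros (_ ∷ ys) = zeros ys
  double-count (x ∷ xs) ys = trans (cong (length (filter (R? x) ys) +_) (double-count xs ys)) (include ys)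
    where
    swap : ∀ a b c → a + (b + c) ≡ b + (a + c)
    swap = solve-∀
    include : ∀ ys → length (filter (R? x) ys) + sum (map (λ y → length (filter (λ x → R? x y) xs)) ys) ≡
                 sum (map (λ y → length (filter (λ x → R? x y) (x ∷ xs))) ys)
    include [] = refl
    include (y ∷ ys) with R? x y
    ... | yes _ = cong suc (trans (swap (length (filter (R? x) ys)) (length (filter (λ x → R? x y) xs)) _)
                                  (cong (length (filter (λ x → R? x y) xs) +_) (include ys)))
    ... | no _ = trans (swap (length (filter (R? x) ys)) (length (filter (λ x → R? x y) xs)) _)
                       (cong (length (filter (λ x → R? x y) xs) +_) (include ys))

below-average : {A : Set} (g : A → ℕ) (s : ℕ) → ∀ x xs → sum (map g (x ∷ xs)) ≤ length (x ∷ xs) * s →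
                ∃[ y ] y ∈ˡ x ∷ xs × g y ≤ s
below-average g s x xs le with g x ≤? s
... | yes p = x , here refl , p
below-average g s x [] le | no p = ⊥-elim (p (subst₂ _≤_ (+-identityʳ _) (+-identityʳ _) le))
below-average g s x (x′ ∷ xs) le | no p with below-average g s x′ xs
    (+-cancelˡ-≤ s _ _ (≤-trans (+-monoˡ-≤ _ (<⇒≤ (≰⇒> p))) le))
... | y , y∈ , q = y , there y∈ , q

sum-map-bounded : {A : Set} (g : A → ℕ) {s : ℕ} {xs : List A} → All (λ x → g x ≤ s) xs →
                  sum (map g xs) ≤ length xs * s
sum-map-bounded g []      = z≤n
sum-map-bounded g (p ∷ a) = +-mono-≤ p (sum-map-bounded g a)

module _ {m : ℕ} {A : Set} (key : A → Fin m) (Q : A → List (Fin m)) (s : ℕ) (1≤s : 1 ≤ s) where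

  private
    R? : ∀ x y → Dec (key x ∈ˡ Q y)
    R? x y = member? _≟ᶠ_ (key x) (Q y)

    Distinct : List A → Set
    Distinct = AllPairs (λ x y → key x ≢ key y)

    outdegree : ∀ {ys} → Distinct ys → ∀ y → length (filter (λ x → R? x y) ys) ≤ length (Q y)
    outdegree {ys} d y = subst (_≤ length (Q y)) (length-map key (filter (λ x → R? x y) ys))
      (unique-length (AllPairs.map⁺ (AllPairs.filter⁺ (λ x → R? x y) d)) sub)
      where
      sub : ∀ {z} → z ∈ˡ map key (filter (λ x → R? x y) ys) → z ∈ˡ Q y
      sub z∈ with ∈-map⁻ key z∈
      ... | x , x∈ , refl = proj₂ (∈-filter⁻ (λ x → R? x y) {xs = ys} x∈)

  -- A digraph with outdegrees at most s has a vertex with indegree at most s,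
  -- so adding it to the independent set excludes at most 2s vertices.
  independent : ∀ W ys → Distinct ys → All (λ y → length (Q y) ≤ s) ys → W * (2 * s) ≤ length ys →
                ∃[ zs ] length zs ≡ W × (∀ {z} → z ∈ˡ zs → z ∈ˡ ys) ×
                  AllPairs (λ x y → key x ∉ˡ Q y × key y ∉ˡ Q x) zs
  independent zero ys d a le = [] , refl , (λ ()) , []
  independent (suc W) [] d a le = ⊥-elim (<⇒≱ 1≤s (≤-trans (m≤m+n s _) (≤-trans (m≤m+n _ _) le)))
  independent (suc W) ys@(y ∷ ys₀) d a le
    -- Indegrees and outdegrees have the same sum, so some indegree is at most the bound on the
    -- outdegrees.
    with below-average (λ x → length (filter (R? x) ys)) s y ys₀
           (≤-trans (≤-reflexive (double-count R? ys ys))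
             (sum-map-bounded _ (All.map (λ {x} q → ≤-trans (outdegree d x) q) a)))
  ... | v , v∈ , in≤ with independent W (filter (¬? ∘ bad?) ys) (AllPairs.filter⁺ (¬? ∘ bad?) d)
                            (All.filter⁺ (¬? ∘ bad?) a) enough
    where
    bad? = λ x → R? v x ⊎-dec R? x v
    enough : W * (2 * s) ≤ length (filter (¬? ∘ bad?) ys)
    enough = +-cancelˡ-≤ (2 * s) _ _ (begin
      2 * s + W * (2 * s)
        ≤⟨ le ⟩
      length ys
        ≡⟨ length-filter-complement bad? ys ⟩
      length (filter bad? ys) + length (filter (¬? ∘ bad?) ys)
        ≤⟨ +-monoˡ-≤ _ (length-filter-⊎ (R? v) (λ x → R? x v) ys) ⟩
      length (filter (R? v) ys) + length (filter (λ x → R? x v) ys) + length (filter (¬? ∘ bad?) ys)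
        ≤⟨ +-monoˡ-≤ _ (+-mono-≤ in≤ (≤-trans (outdegree d v) (All.lookup a v∈))) ⟩
      s + s + length (filter (¬? ∘ bad?) ys)
        ≡⟨ cong (λ k → s + k + length (filter (¬? ∘ bad?) ys)) (sym (+-identityʳ s)) ⟩
      2 * s + length (filter (¬? ∘ bad?) ys)
        ∎)
      where open ≤-Reasoning
  ...   | zs , len , sub , ind = v ∷ zs , cong suc len , sub′ , All.tabulate free ∷ ind
    where
    bad? = λ x → R? v x ⊎-dec R? x v
    sub′ : ∀ {z} → z ∈ˡ v ∷ zs → z ∈ˡ ys
    sub′ (here refl) = v∈
    sub′ (there z∈)  = proj₁ (∈-filter⁻ (¬? ∘ bad?) (sub z∈))
    free : ∀ {z} → z ∈ˡ zs → key v ∉ˡ Q z × key z ∉ˡ Q v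
    free z∈ with proj₂ (∈-filter⁻ (¬? ∘ bad?) {xs = ys} (sub z∈))
    ... | n = n ∘ inj₁ , n ∘ inj₂

-- Each of the taken elements contributes at least 1; if there are fewer than `n` of them, nothing
-- has been dropped.
sum-take : {A : Set} (g : A → ℕ) → ∀ n {xs} → All (λ x → 0 < g x) xs →
           n ⊓ sum (map g xs) ≤ sum (map g (take n xs))
sum-take g zero    a  = z≤n
sum-take g (suc n) [] = z≤n
sum-take g (suc n) {x ∷ xs} (p ∷ a) = begin
  suc n ⊓ (g x + sum (map g xs))        ≤⟨ ⊓-monoˡ-≤ _ (+-monoˡ-≤ n p) ⟩
  (g x + n) ⊓ (g x + sum (map g xs))    ≡⟨ sym (+-distribˡ-⊓ (g x) n _) ⟩
  g x + (n ⊓ sum (map g xs))            ≤⟨ +-monoʳ-≤ (g x) (sum-take g n a) ⟩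
  g x + sum (map g (take n xs))         ∎
  where open ≤-Reasoning

sum-positive : {A : Set} (g : A → ℕ) → ∀ xs → sum (map g (filter (λ x → 0 <? g x) xs)) ≡ sum (map g xs)
sum-positive g [] = refl
sum-positive g (x ∷ xs) with g x in eq
... | zero  = trans (sum-positive g xs) refl
... | suc k = trans (cong (_+ sum (map g (filter (λ x → 0 <? g x) xs))) eq)
                    (cong (suc k +_) (sum-positive g xs))

-- Tuples of removed edges

toℚᵘ-fromℕ : ∀ n → toℚᵘ (fromℕ n) ≃ᵘ mkℚᵘ (ℤ.+ n) 0
toℚᵘ-fromℕ n = ℚ.toℚᵘ-fromℚᵘ (mkℚᵘ (ℤ.+ n) 0)

-- The program sees `α` only as numerator and denominator. As `1 ≤ α`, the absolute value of the
-- numerator is the numerator itself, and cross-multiplication turns the stretch condition into one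
-- between naturals.
≤α*⇔ : ∀ α → 1ℚ ≤ℚ α → ∀ x y →
       fromℕ x ≤ℚ α *ℚ fromℕ y ⇔ x * ↧ₙ α ≤ ℤ.∣ ↥ α ∣ * y
≤α*⇔ (mkℚ (ℤ.-[1+ n ]) d c) (*≤*ℚ ())
≤α*⇔ α@(mkℚ (ℤ.+ n) d c) 1≤α x y = mk⇔ to from
  where
  product : toℚᵘ (α *ℚ fromℕ y) ≃ᵘ toℚᵘ α *ᵘ mkℚᵘ (ℤ.+ y) 0
  product = ℚᵘ.≃-trans (ℚ.toℚᵘ-homo-* α (fromℕ y)) (ℚᵘ.*-cong (ℚᵘ.≃-refl {toℚᵘ α}) (toℚᵘ-fromℕ y))
  to : fromℕ x ≤ℚ α *ℚ fromℕ y → x * suc d ≤ n * y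
  to le with ℚᵘ.≤-trans (ℚᵘ.≤-reflexive (ℚᵘ.≃-sym (toℚᵘ-fromℕ x)))
               (ℚᵘ.≤-trans (ℚ.toℚᵘ-mono-≤ le) (ℚᵘ.≤-reflexive product))
  ... | *≤* le′ = ℤ.drop‿+≤+ (subst₂ ℤ._≤_
                    (trans (sym (ℤ.pos-* x (suc d * 1))) (cong (λ k → ℤ.+ (x * k)) (*-identityʳ (suc d))))
                    (trans (ℤ.*-identityʳ _) (sym (ℤ.pos-* n y))) le′)
  from : x * suc d ≤ n * y → fromℕ x ≤ℚ α *ℚ fromℕ y
  from le = ℚ.toℚᵘ-cancel-≤ (ℚᵘ.≤-trans (ℚᵘ.≤-reflexive (toℚᵘ-fromℕ x))
              (ℚᵘ.≤-trans (*≤* le′) (ℚᵘ.≤-reflexive (ℚᵘ.≃-sym product))))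
    where
    le′ = subst₂ ℤ._≤_
            (sym (trans (sym (ℤ.pos-* x (suc d * 1))) (cong (λ k → ℤ.+ (x * k)) (*-identityʳ (suc d)))))
            (sym (trans (ℤ.*-identityʳ _) (sym (ℤ.pos-* n y)))) (ℤ.+≤+ le)

1≤α⇒↧≤↥ : ∀ α → 1ℚ ≤ℚ α → ↧ₙ α ≤ ℤ.∣ ↥ α ∣
1≤α⇒↧≤↥ (mkℚ (ℤ.-[1+ n ]) d c) (*≤*ℚ ())
1≤α⇒↧≤↥ (mkℚ (ℤ.+ n) d c) (*≤*ℚ le) = ℤ.drop‿+≤+ (subst₂ ℤ._≤_ (ℤ.*-identityˡ _) (ℤ.*-identityʳ _) le)

≤/⇔*≤ : ∀ x y b .{{_ : NonZero b}} → x ≤ y / b ⇔ x * b ≤ y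
≤/⇔*≤ x y b = mk⇔ (λ le → ≤-trans (*-monoˡ-≤ b le) (m/n*n≤m y b))
                  (λ le → subst (_≤ y / b) (m*n/n≡m x b) (/-monoˡ-≤ b le))

1≤α⇒1≤/ : ∀ α → 1ℚ ≤ℚ α → ∀ {l} → 1 ≤ l → 1 ≤ ℤ.∣ ↥ α ∣ * l / ↧ₙ α
1≤α⇒1≤/ α 1≤α {l} 1≤l = Equivalence.from (≤/⇔*≤ 1 (a * l) b)
  (≤-trans (≤-reflexive (*-comm 1 b)) (*-mono-≤ (1≤α⇒↧≤↥ α 1≤α) 1≤l))
  where
  a = ℤ.∣ ↥ α ∣
  b = ↧ₙ α

-- The recursion peels off the last entry of the tuple, in step with the marking loop, which clears
-- one entry per round.
keep : (ℕ → ℕ) → ℕ → ℕ → Bool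
keep f zero    e = true
keep f (suc k) e = if f k ≡ᵇ e then false else keep f k e

keep-false : ∀ f k {e} → keep f k e ≡ false → ∃[ j ] j < k × f j ≡ e
keep-false f (suc k) {e} eq with f k ≡ᵇ e | ≡ᵇ⇒≡ (f k) e
... | true  | h = k , ≤-refl , h tt
... | false | _ with keep-false f k eq
...   | j , j<k , h = j , m≤n⇒m≤1+n j<k , h

keep-true : ∀ f k {e} → (∀ {j} → j < k → f j ≢ e) → keep f k e ≡ true
keep-true f zero n = refl
keep-true f (suc k) {e} n with f k ≡ᵇ e | ≡ᵇ⇒≡ (f k) e
... | true  | h = ⊥-elim (n ≤-refl (h tt))
... | false | _ = keep-true f k (n ∘ m≤n⇒m≤1+n)

removed-false : ∀ f k {j} → j < k → keep f k (f j) ≡ false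
removed-false f (suc k) {j} j<k with f k ≡ᵇ f j | ≡⇒≡ᵇ (f k) (f j)
... | true  | _ = refl
... | false | h with m≤n⇒m<n∨m≡n (≤-pred j<k)
...   | inj₁ lt   = removed-false f k lt
...   | inj₂ refl = ⊥-elim (h refl)

module Solutions (oracle : DistanceOracle) (I : Instance) where
  open Instance I
  open Walks (Instance.network I)
  private
    N = Instance.network I

  -- Path lengths are integers, so `α ℓ(e)` may be rounded down (`Detour⇔`).
  tolerance : Fin m → ℕ
  tolerance e = numα * len e / denα

  Detour : Subset m → Fin m → Set
  Detour F e = Σ[ p ∈ Path N F (proj₁ (ends e)) (proj₂ (ends e)) ] pathLength N p ≤ tolerance e

  Detour-mono : ∀ {F F′ e} → (∀ {e′} → e′ ∈ F → e′ ∈ F′) → Detour F e → Detour F′ e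
  Detour-mono sub (p , le) with convertPath p (All.map sub (edges-in (proj₁ p)))
  ... | q , eq = q , subst (_≤ _) (cong (sum ∘ map len) (sym eq)) le

  Detour⇔ : ∀ x e → x ≤ tolerance e ⇔ x * denα ≤ numα * len e
  Detour⇔ x e = ≤/⇔*≤ x (numα * len e) denα

  len≤tolerance : ∀ e → len e ≤ tolerance e
  len≤tolerance e = Equivalence.from (Detour⇔ (len e) e)
    (subst (_≤ numα * len e) (*-comm denα (len e)) (*-monoˡ-≤ (len e) (1≤α⇒↧≤↥ α 1≤α)))

  detours⇒witness : ∀ F → W ≤ totalWeight (∁ F) → (∀ e → e ∉ F → Detour F e) → Witness F
  detours⇒witness F w d = spanner , w
    where
    detour : ∀ e → Σ[ p ∈ Path N F (proj₁ (ends e)) (proj₂ (ends e)) ] pathLength N p * denα ≤ numα * len e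
    detour e with e ∈? F
    ... | yes i = edgePath e i , Equivalence.to (Detour⇔ _ e)
                    (≤-trans (≤-reflexive (+-identityʳ (len e))) (len≤tolerance e))
    ... | no  n with d e n
    ...   | p , le = p , Equivalence.to (Detour⇔ _ e) le
    spanner : IsSpanner N α F
    spanner u v x dist with detours⇒spanner N F numα denα detour oracle u v x dist
    ... | y , dist′ , le = y , dist′ , Equivalence.from (≤α*⇔ α 1≤α y x) le

  spanner⇒detour : ∀ {F} → IsSpanner N α F → ∀ e → Detour F e
  spanner⇒detour {F} sp e with restrictedDistance oracle N ⊤ (edgePath e ∈⊤)
  ... | d , dist , d≤ with sp _ _ d dist
  ...   | d′ , ((p , refl) , _) , le = p , Equivalence.from (Detour⇔ _ e)
    (≤-trans (Equivalence.to (≤α*⇔ α 1≤α (pathLength N p) d) le)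
      (*-monoʳ-≤ numα (≤-trans d≤ (≤-reflexive (+-identityʳ (len e))))))

  Avoiding : Fin m → Set
  Avoiding e = Σ[ p ∈ Path N ⊤ (proj₁ (ends e)) (proj₂ (ends e)) ]
                 pathLength N p ≤ tolerance e × e ∉ˡ pathEdges N p

  Candidate : Fin m → Set
  Candidate e = 0 < weight e × Avoiding e

  -- A path between the ends of e other than e itself is a shortest path if
  -- that is shorter than e, and a second shortest path otherwise.
  detourLength : Fin m → Maybe ℕ → Maybe ℕ → ℕ
  detourLength e d d′ = if encodeMaybe d ∸ 1 <ᵇ len e then encodeMaybe d else encodeMaybe d′

  -- The delicate case is a shortest path `p` as long as `e`, which may be `e` or a competitor. If
  -- it is `e`, a second shortest path avoids `e`. If it is a competitor, `p` itself avoids `e`, and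
  -- the second length is at most `len e` because `e` is another path, hence within the tolerance.
  -- Either way, comparing the second length with the tolerance gives the right answer.
  avoiding⇔ : ∀ e {d d′} → TwoShortest N (proj₁ (ends e)) (proj₂ (ends e)) d d′ →
    Avoiding e ⇔ (0 < detourLength e d d′ × detourLength e d d′ ∸ 1 ≤ tolerance e)
  avoiding⇔ e (none n) = ⊥-elim (n (edgePath e ∈⊤))
  avoiding⇔ e (one p same) with pathLength N p <ᵇ len e in eq
  ... | true = ⊥-elim (<⇒≢ {pathLength N p} (<ᵇ⇒< _ _ (subst T (sym eq) tt))
                 (trans (cong (sum ∘ map len) (sym (same (edgePath e ∈⊤)))) (+-identityʳ (len e))))
  ... | false = mk⇔ (λ (q , _ , e∉) → ⊥-elim (e∉ (subst (e ∈ˡ_) (trans (same (edgePath e ∈⊤)) (sym (same q))) (here refl))))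
                    (λ ())
  avoiding⇔ e (two p p′ p≢p′ least least′) with pathLength N p <ᵇ len e in eq
  ... | true = mk⇔ (λ (q , le , _) → s≤s z≤n , ≤-trans (least q) le)
                   (λ (_ , le) → p , le , avoids e p (λ p≡e → <⇒≢ (<ᵇ⇒< _ _ (subst T (sym eq) tt))
                     (trans (cong (sum ∘ map len) p≡e) (+-identityʳ (len e)))))
  ... | false = mk⇔ (λ (q , le , e∉) → s≤s z≤n , second q le e∉) (λ (_ , le) → back le)
    where
    same? = ≡-dec _≟ᶠ_
    shortest≤ : pathLength N p ≤ len e
    shortest≤ = ≤-trans (least (edgePath e ∈⊤)) (≤-reflexive (+-identityʳ (len e)))
    second : ∀ q → pathLength N q ≤ tolerance e → e ∉ˡ pathEdges N q → pathLength N p′ ≤ tolerance e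
    second q le e∉ with same? (pathEdges N q) (pathEdges N p)
    ... | no  q≢p = ≤-trans (least′ q q≢p) le
    ... | yes q≡p = ≤-trans (least′ (edgePath e ∈⊤) (λ eq → e∉ (subst (e ∈ˡ_) (trans eq (sym q≡p)) (here refl))))
                      (≤-trans (≤-reflexive (+-identityʳ (len e))) (len≤tolerance e))
    back : pathLength N p′ ≤ tolerance e → Avoiding e
    back le with same? (pathEdges N p) (e ∷ [])
    ... | no  p≢e = p , ≤-trans shortest≤ (len≤tolerance e) , avoids e p p≢e
    ... | yes p≡e = p′ , le , avoids e p′ (λ p′≡e → p≢p′ (trans p≡e (sym p′≡e)))

  remaining : (ℕ → ℕ) → Subset m
  remaining f = Vec.tabulate (λ e → keep f W (toℕ e))

  ∈remaining : ∀ f {e} → keep f W (toℕ e) ≡ true → e ∈ remaining f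
  ∈remaining f {e} eq = Vec.lookup⇒[]= e _ (trans (Vec.lookup∘tabulate _ e) eq)

  remaining∈ : ∀ f {e} → e ∈ remaining f → keep f W (toℕ e) ≡ true
  remaining∈ f {e} i = trans (sym (Vec.lookup∘tabulate _ e)) (Vec.[]=⇒lookup i)

  ∉remaining : ∀ f {e j} → j < W → f j ≡ toℕ e → e ∉ remaining f
  ∉remaining f {e} j<W eq i with trans (sym (remaining∈ f i)) (subst (λ k → keep f W k ≡ false) eq (removed-false f W j<W))
  ... | ()

  Pass : (ℕ → ℕ) → Set
  Pass f = W ≤ totalWeight (∁ (remaining f)) ×
           (∀ e {j} → j < W → f j ≡ toℕ e → Detour (remaining f) e)

  pass⇒witness : ∀ f → Pass f → Witness (remaining f)
  pass⇒witness f (w , d) = detours⇒witness (remaining f) w removed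
    where
    removed : ∀ e → e ∉ remaining f → Detour (remaining f) e
    removed e n with keep f W (toℕ e) in eq
    ... | true = ⊥-elim (n (∈remaining f eq))
    ... | false with keep-false f W eq
    ...   | j , j<W , h = d e j<W h

  -- The common target of the two arguments, `witness⇒removal` for few candidates and `many⇒removal`
  -- for many. `detours` speaks of every subgraph that contains the edges not removed, so it applies
  -- to `remaining` of a tuple without comparing subsets.
  record Removal (C : Fin m → Set) : Set where
    field
      removed : List (Fin m)
      unique  : Unique removed
      few     : length removed ≤ W
      heavy   : W ≤ sum (map weight removed)
      chosen  : All C removed
      detours : ∀ {F} → (∀ {e} → e ∉ˡ removed → e ∈ F) → All (Detour F) removed

  -- The edges of a removal are listed by a W-tuple, padded with repetitions.
  removal⇒pass : ∀ {C} (c : ℕ → ℕ) n → (∀ {e} → C e → toℕ e ∈ˡ applyUpTo c n) → Removal C →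
                 Σ[ D ∈ (ℕ → ℕ) ] (∀ {j} → j < W → D j < n) × Pass (c ∘ D)
  removal⇒pass {C} c n index R = go (Removal.removed R) refl
    where
    open Removal R
    finish : (f : ℕ → Fin m) (D : ℕ → ℕ) → (∀ j → c (D j) ≡ toℕ (f j)) → (∀ {j} → j < W → f j ∈ˡ removed) →
             (∀ {e} → e ∈ˡ removed → ∃[ j ] j < W × f j ≡ e) → Pass (c ∘ D)
    finish f D eq f∈ onto = ≤-trans heavy (unique-sum weight unique sub) , detour
      where
      sub : ∀ {e} → e ∈ˡ removed → e ∈ˡ filter (_∈? ∁ (remaining (c ∘ D))) (allFin m)
      sub {e} e∈ with onto e∈
      ... | j , j<W , refl = ∈-filter⁺ (_∈? ∁ (remaining (c ∘ D))) (∈-allFin e)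
                               (x∉p⇒x∈∁p (∉remaining (c ∘ D) j<W (eq j)))
      outside∈ : ∀ {e} → e ∉ˡ removed → e ∈ remaining (c ∘ D)
      outside∈ e∉ = ∈remaining (c ∘ D) (keep-true (c ∘ D) W
        (λ {j} j<W h → e∉ (subst (_∈ˡ removed) (toℕ-injective (trans (sym (eq j)) h)) (f∈ j<W))))
      detour : ∀ e {j} → j < W → c (D j) ≡ toℕ e → Detour (remaining (c ∘ D)) e
      detour e {j} j<W h = All.lookup (detours outside∈)
        (subst (_∈ˡ removed) (toℕ-injective (trans (sym (eq j)) h)) (f∈ j<W))
    go : ∀ es → es ≡ removed → Σ[ D ∈ (ℕ → ℕ) ] (∀ {j} → j < W → D j < n) × Pass (c ∘ D)
    -- No removed edges weigh 0, so `heavy` forces `W` to be 0 and any tuple will do.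
    go [] refl = (λ _ → 0) , (λ j<W → ⊥-elim (empty j<W)) ,
                 heavy′ , (λ e j<W → ⊥-elim (empty j<W))
      where
      empty : ∀ {j} → ¬ j < W
      empty j<W with ≤-trans j<W heavy
      ... | ()
      heavy′ : W ≤ totalWeight (∁ (remaining (c ∘ (λ _ → 0))))
      heavy′ = ≤-trans heavy z≤n
    go (e ∷ es) refl = D , (λ {j} _ → proj₁ (proj₂ (found j))) , finish f D (λ j → sym (proj₂ (proj₂ (found j)))) (λ {j} _ → f∈ j) onto
      where
      nth : Fin m → List (Fin m) → ℕ → Fin m
      -- The default, which will be the first removed edge, provides the padding, so the tuple names
      -- no further edge.
      nth d []       j       = d
      nth d (x ∷ xs) zero    = x
      nth d (x ∷ xs) (suc j) = nth d xs j
      f : ℕ → Fin m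
      f = nth e (e ∷ es)
      nth∈ : ∀ xs j → nth e xs j ∈ˡ e ∷ xs
      nth∈ []       j       = here refl
      nth∈ (x ∷ xs) zero    = there (here refl)
      nth∈ (x ∷ xs) (suc j) with nth∈ xs j
      ... | here eq  = here eq
      ... | there i  = there (there i)
      f∈ : ∀ j → f j ∈ˡ e ∷ es
      f∈ zero    = here refl
      f∈ (suc j) = nth∈ es j
      found : ∀ j → ∃[ i ] i < n × toℕ (f j) ≡ c i
      found j = ∈-applyUpTo⁻ c (index (All.lookup chosen (f∈ j)))
      D : ℕ → ℕ
      D j = proj₁ (found j)
      position : ∀ xs {x} → x ∈ˡ xs → ∃[ j ] j < length xs × nth e xs j ≡ x
      position (x ∷ xs) (here refl) = 0 , s≤s z≤n , refl
      position (x ∷ xs) (there i) with position xs i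
      ... | j , lt , eq = suc j , s≤s lt , eq
      onto : ∀ {x} → x ∈ˡ e ∷ es → ∃[ j ] j < W × f j ≡ x
      onto i with position (e ∷ es) i
      ... | j , lt , eq = j , ≤-trans lt few , eq

  -- Putting edges back preserves detours. So all removed edges of weight 0 can be restored, and all
  -- but `W` of the others: weights are integers, hence `W` edges of positive weight already weigh
  -- `W`. A removed edge is a candidate because its detour in `F` avoids it.
  witness⇒removal : ∀ {F C} → Witness F → (∀ {e} → Candidate e → C e) → Removal C
  witness⇒removal {F} {C} (sp , w) collect = record
    { removed = take W xs
    ; unique  = Unique.take⁺ W (Unique.filter⁺ (λ e → 0 <? weight e) (Unique.filter⁺ (_∈? ∁ F) (Unique.allFin⁺ m)))
    ; few     = subst (_≤ W) (sym (length-take W xs)) (m⊓n≤m W _)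
    ; heavy   = ≤-trans (⊓-glb ≤-refl (≤-trans w (≤-reflexive (sym (sum-positive weight (filter (_∈? ∁ F) (allFin m)))))))
                        (sum-take weight W (All.all-filter (λ e → 0 <? weight e) (filter (_∈? ∁ F) (allFin m))))
    ; chosen  = All.take⁺ W (All.tabulate (λ e∈ → collect (proj₁ (properties e∈) , avoiding (proj₂ (properties e∈)))))
    ; detours = λ sub → All.tabulate (λ {e} _ → Detour-mono (λ e′∈F → sub (λ e′∈ →
                  All.lookup (All.take⁺ W (All.tabulate (proj₂ ∘ properties))) e′∈ e′∈F)) (spanner⇒detour sp e))
    }
    where
    xs = filter (λ e → 0 <? weight e) (filter (_∈? ∁ F) (allFin m))
    properties : ∀ {e} → e ∈ˡ xs → 0 < weight e × e ∉ F
    properties e∈ with ∈-filter⁻ (λ e → 0 <? weight e) {xs = filter (_∈? ∁ F) (allFin m)} e∈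
    ... | i , p = p , x∈∁p⇒x∉p (proj₂ (∈-filter⁻ (_∈? ∁ F) {xs = allFin m} i))
    avoiding : ∀ {e} → e ∉ F → Avoiding e
    avoiding {e} e∉ with spanner⇒detour sp e
    ... | p , le with convertPath p (All.universal (λ _ → ∈⊤) _)
    ...   | q , eq = q , subst (_≤ tolerance e) (cong (sum ∘ map len) (sym eq)) le ,
                     (λ e∈ → e∉ (All.lookup (edges-in (proj₁ p)) (subst (e ∈ˡ_) eq e∈)))

  avoiding⇒detour : ∀ {e es} → (a : Avoiding e) → (∀ {x} → x ∈ˡ pathEdges N (proj₁ a) → x ∉ˡ es) →
                    ∀ {F} → (∀ {e} → e ∉ˡ es → e ∈ F) → Detour F e
  avoiding⇒detour {e} (p , le , _) disjoint sub with convertPath p (All.tabulate (λ x∈ → sub (disjoint x∈)))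
  ... | q , eq = q , subst (_≤ tolerance e) (cong (sum ∘ map len) (sym eq)) le

  -- `small` speaks only of edges lighter than `W`, since a heavier candidate is a removal on its
  -- own. In coupled instances this is what makes `α W` an upper bound for the tolerances that
  -- count.
  many⇒removal : ∀ {C} t → 1 ≤ t → (∀ e → weight e < W → tolerance e ≤ t) →
                 (ys : List (Σ (Fin m) Candidate)) → Unique (map proj₁ ys) → (∀ {e} → e ∈ˡ map proj₁ ys → C e) →
                 4 * W * t ≤ length ys → Removal C
  many⇒removal {C} t 1≤t small ys un collect le with W ≟ 0 | any? (λ y → W ≤? weight (proj₁ y)) ys
  ... | yes W≡0 | _ = record { removed = [] ; unique = [] ; few = z≤n ; heavy = ≤-reflexive W≡0
                           ; chosen = [] ; detours = λ _ → [] }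
  ... | no W≢0 | yes a with find a
  ...   | (e , _ , av) , e∈ , W≤ = record
    { removed = e ∷ []
    ; unique  = [] ∷ []
    ; few     = n≢0⇒n>0 W≢0
    ; heavy   = ≤-trans W≤ (m≤m+n _ _)
    ; chosen  = collect (∈-map⁺ proj₁ e∈) ∷ []
    ; detours = λ sub → avoiding⇒detour av (λ { x∈ (here refl) → proj₂ (proj₂ av) x∈ }) sub ∷ []
    }
  many⇒removal {C} t 1≤t small ys un collect le | no _ | no light
    with independent proj₁ Q (2 * t) (≤-trans 1≤t (m≤m+n t _)) W ys (AllPairs.map⁻ un) short enough
    where
    Q : Σ (Fin m) Candidate → List (Fin m)
    -- Listing `e` itself makes independent elements distinct. The list still has length at most
    -- `1 + t ≤ 2 * t`, as every edge of the detour has length at least 1.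
    Q (e , _ , p , _) = e ∷ pathEdges N p
    short : All (λ y → length (Q y) ≤ 2 * t) ys
    short = All.map (λ {y} n → ≤-trans (s≤s (≤-trans (edge-count (pathEdges N (proj₁ (proj₂ (proj₂ y)))))
                (≤-trans (proj₁ (proj₂ (proj₂ (proj₂ y)))) (small (proj₁ y) (≰⇒> n)))))
                (≤-trans (+-monoˡ-≤ t 1≤t) (≤-reflexive (cong (t +_) (sym (+-identityʳ t))))))
              (All.¬Any⇒All¬ ys light)
    enough : W * (2 * (2 * t)) ≤ length ys
    enough = ≤-trans (≤-reflexive (trans (cong (W *_) (sym (*-assoc 2 2 t)))
               (trans (sym (*-assoc W 4 t)) (cong (_* t) (*-comm W 4))))) le
  ... | zs , len≡ , sub , ind = record
    { removed = map proj₁ zs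
    ; unique  = AllPairs.map⁺ (AllPairs.map (λ (a , _) eq → a (here eq)) ind)
    ; few     = ≤-reflexive (trans (length-map proj₁ zs) len≡)
    ; heavy   = subst (_≤ sum (map weight (map proj₁ zs))) (trans (length-map proj₁ zs) len≡)
                  (positive-sum zs)
    ; chosen  = All.map⁺ (All.tabulate (λ z∈ → collect (∈-map⁺ proj₁ (sub z∈))))
    ; detours = λ s → All.map⁺ (All.tabulate (λ {z} z∈ →
        avoiding⇒detour (proj₂ (proj₂ z)) (disjoint z∈) s))
    }
    where
    positive-sum : ∀ (zs : List (Σ (Fin m) Candidate)) → length (map proj₁ zs) ≤ sum (map weight (map proj₁ zs))
    positive-sum [] = z≤n
    positive-sum ((e , p , _) ∷ zs) = +-mono-≤ p (positive-sum zs)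
    Free : Σ (Fin m) Candidate → Σ (Fin m) Candidate → Set
    Free z y = proj₁ y ∉ˡ pathEdges N (proj₁ (proj₂ (proj₂ z)))
    free : ∀ {zs : List (Σ (Fin m) Candidate)} {z y} →
           AllPairs (λ x y → Free x y × Free y x) zs → z ∈ˡ zs → y ∈ˡ zs → Free z y
    free {z = z} _ (here refl) (here refl) = proj₂ (proj₂ (proj₂ (proj₂ z)))
    free (a ∷ _) (here refl) (there y∈) = proj₁ (All.lookup a y∈)
    free (a ∷ _) (there z∈) (here refl) = proj₂ (All.lookup a z∈)
    free (_ ∷ as) (there z∈) (there y∈) = free as z∈ y∈
    disjoint : ∀ {z} → z ∈ˡ zs → ∀ {x} → x ∈ˡ pathEdges N (proj₁ (proj₂ (proj₂ z))) → x ∉ˡ map proj₁ zs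
    disjoint z∈ x∈ x∈zs with ∈-map⁻ proj₁ x∈zs
    ... | y , y∈ , refl = free (AllPairs.map (λ (a , b) → b ∘ there , a ∘ there) ind) z∈ y∈ x∈

-- Encodings in arrays, and calls of the given algorithms

overwrite-++ˡ : ∀ xs {ys f j} → j < length xs → overwrite (xs ++ ys) f j ≡ overwrite xs (λ _ → 0) j
overwrite-++ˡ (x ∷ xs) {j = zero}  lt       = refl
overwrite-++ˡ (x ∷ xs) {j = suc j} (s≤s lt) = overwrite-++ˡ xs lt

overwrite-++ʳ : ∀ xs {ys f} j → overwrite (xs ++ ys) f (length xs + j) ≡ overwrite ys (λ i → f (length xs + i)) j
overwrite-++ʳ []       j = refl
overwrite-++ʳ (x ∷ xs) j = overwrite-++ʳ xs j

-- Random access into an encoding made of blocks of equal length. It serves for the edge data of the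
-- input and, applied twice, for the table of path lengths of all pairs.
overwrite-block : ∀ {s k} {A : Set} {g : A → List ℕ} (h : Fin k → A) → (∀ e → length (g e) ≡ s) →
                  ∀ {f j} e → j < s →
                  overwrite (concatMap g (tabulate h)) f (j + toℕ e * s) ≡ overwrite (g (h e)) (λ _ → 0) j
overwrite-block {g = g} h len {f} {j} zero j<s = trans (cong (overwrite (g (h zero) ++ _) f) (+-identityʳ j))
  (overwrite-++ˡ (g (h zero)) (subst (j <_) (sym (len (h zero))) j<s))
overwrite-block {s} {suc k} {g = g} h len {f} {j} (suc e) j<s = trans
  (cong (overwrite (g (h zero) ++ concatMap g (tabulate (h ∘ suc))) f)
    (trans (trans (sym (+-assoc j s _)) (trans (cong (_+ toℕ e * s) (+-comm j s)) (+-assoc s j _)))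
      (cong (_+ (j + toℕ e * s)) (sym (len (h zero))))))
  (trans (overwrite-++ʳ (g (h zero)) (j + toℕ e * s)) (overwrite-block (h ∘ suc) len e j<s))

length-concatMap : ∀ {s} {A B : Set} {g : A → List B} {k} (h : Fin k → A) → (∀ e → length (g e) ≡ s) →
                   length (concatMap g (tabulate h)) ≡ k * s
length-concatMap {k = zero}  h len = refl
length-concatMap {g = g} {suc k} h len =
  trans (length-++ (g (h zero))) (cong₂ _+_ (len (h zero)) (length-concatMap (h ∘ suc) len))

concatMap-upTo : ∀ {A : Set} (g : ℕ → List A) {m} (g′ : Fin m → List A) → (∀ e → g (toℕ e) ≡ g′ e) →
                 concatMap g (upTo m) ≡ concatMap g′ (allFin m)
concatMap-upTo {A} g g′ eq = go id id eq
  where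
  go : ∀ {k} (h : ℕ → ℕ) (h′ : Fin k → Fin _) → (∀ e → g (h (toℕ e)) ≡ g′ (h′ e)) →
       concatMap g (applyUpTo h k) ≡ concatMap g′ (tabulate h′)
  go {zero}  h h′ eq = refl
  go {suc k} h h′ eq = cong₂ _++_ (eq zero) (go (h ∘ suc) (h′ ∘ suc) (eq ∘ suc))

concatMap-upTo-suc : ∀ {A : Set} (g : ℕ → List A) k → concatMap g (upTo (suc k)) ≡ concatMap g (upTo k) ++ g k
concatMap-upTo-suc g k = trans (cong (concatMap g) (sym (upTo-∷ʳ k)))
  (trans (concatMap-++ g (upTo k) (k ∷ [])) (cong (concatMap g (upTo k) ++_) (++-identityʳ (g k))))

applyUpTo-cong : ∀ {A : Set} {f g : ℕ → A} n → (∀ {j} → j < n → f j ≡ g j) → applyUpTo f n ≡ applyUpTo g n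
applyUpTo-cong zero    eq = refl
applyUpTo-cong (suc n) eq = cong₂ _∷_ (eq (s≤s z≤n)) (applyUpTo-cong n (eq ∘ s≤s))

applyUpTo-update : ∀ (g : ℕ → ℕ) {q v ys} → applyUpTo g q ≡ ys → applyUpTo (update q v g) (suc q) ≡ ys ++ v ∷ []
applyUpTo-update g {q} {v} refl = trans (sym (applyUpTo-∷ʳ (update q v g) q))
  (cong₂ _∷ʳ_ (applyUpTo-cong q (λ j<q → update-≢ q g (λ eq → <⇒≢ j<q (sym eq)))) (update-at q g))

applyUpTo-update₃ : ∀ {g : ℕ → ℕ} {q a b c ys} → applyUpTo g q ≡ ys →
  applyUpTo (update (2 + q) c (update (1 + q) b (update q a g))) (3 + q) ≡ ys ++ a ∷ b ∷ c ∷ []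
applyUpTo-update₃ {g} {q} {a} {b} {ys = ys} eq =
  trans (applyUpTo-update (update (1 + q) b (update q a g))
          (applyUpTo-update (update q a g) (applyUpTo-update g eq)))
    (trans (++-assoc (ys ++ _ ∷ []) (_ ∷ []) _) (++-assoc ys (_ ∷ []) _))

less≢0 : ∀ {x y} → fromBool (x <ᵇ y) ≢ 0 → x < y
less≢0 {x} {y} n with x <ᵇ y | <ᵇ⇒< x y
... | true  | h = h _
... | false | _ = ⊥-elim (n refl)

less≡0 : ∀ {x y} → fromBool (x <ᵇ y) ≡ 0 → y ≤ x
less≡0 {x} {y} z = ≮⇒≥ (λ lt → lemma (<⇒<ᵇ lt) z)
  where
  lemma : T (x <ᵇ y) → fromBool (x <ᵇ y) ≢ 0
  lemma t eq with x <ᵇ y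
  lemma t () | true

module _ (Γr Γa : ℕ → Maybe ℕ) (M B : ℕ) (2≤M : 2 ≤ M) (M^≤B : M ^ maxDegree ≤ B)
         (smallr : ∀ r → small (Γr r)) (smalla : ∀ a → small (Γa a)) where
  open Static Γr Γa
  open Logic M B 2≤M M^≤B

  foldr-⊔-bound : ∀ {g : ℕ → ℕ} {b} n → (∀ j → g j ≤ b) → foldr _⊔_ 0 (applyUpTo g n) ≤ b
  foldr-⊔-bound zero    g≤ = z≤n
  foldr-⊔-bound (suc n) g≤ = ⊔-lub (g≤ 0) (foldr-⊔-bound n (g≤ ∘ suc))

  -- The word limit of the callee is a power of `2 + length + maximum`. Length and maximum are at
  -- most `M ^ d`, and the two additions lead to at most `M ^ (2 + suc d)`. The output is only known
  -- to fit into a word, so the target array must be one without a degree.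
  invoke : ∀ {p a e b d k σ x y t T Q} → Typed e → degree e ⊑ just d → Γa a ⊑ just d → Γa b ≡ nothing →
           (M ^ (2 + suc d)) ^ k ≤ B → Ok σ → applyUpTo (arrays σ a) (⟦ e ⟧ σ) ≡ x →
           Run (wordLimit k x) p x y t → t ≤ T →
           Q (setArray b (overwrite y (arrays σ b)) σ) → Reach (call p a e b) σ (1 + cost e + T) Q
  invoke {p} {a} {e} {b} {d} {k} {σ} {T = T} {Q} te de da nb limit ok refl (σ₁ , s , exec , refl , refl) le q =
    reach _ _ (call (fits ve) exec′) time≤ (setArray-ok b bounded ok) q
    where
    ve = value e te ok
    xs = applyUpTo (arrays σ a) (⟦ e ⟧ σ)
    length≤ : ⟦ e ⟧ σ ≤ M ^ d
    length≤ = ≤-trans (value≤ ve) (⊑-bound (degree e) (just d) (small-degree ve) de)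
    entry≤ : ∀ j → arrays σ a j ≤ M ^ d
    entry≤ j = ≤-trans (proj₂ ok a j) (⊑-bound (Γa a) (just d) (smalla a) da)
    instance
      M≢0 : NonZero M
      M≢0 = >-nonZero (≤-trans (s≤s z≤n) 2≤M)
    _⟨≤⟩_ : ∀ {x y z} → x ≤ y → y ≡ z → x ≤ z
    p ⟨≤⟩ refl = p
    words≤ : wordLimit k xs ≤ B
    words≤ = ≤-trans (^-monoˡ-≤ k (≤-trans
      (+-bound (suc (suc d)) (suc (suc d))
        ((+-bound (suc d) (suc d)
          (≤-trans (≤-trans 2≤M (≤-reflexive (sym (^-identityʳ M)))) (^-grow {1} {suc d} (s≤s z≤n)))
          (≤-trans (≤-trans (≤-reflexive (length-applyUpTo (arrays σ a) (⟦ e ⟧ σ))) length≤) (^-grow (n≤1+n d))))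
         ⟨≤⟩ cong (λ z → M ^ suc z) (⊔-idem (suc d)))
        (≤-trans (foldr-⊔-bound (⟦ e ⟧ σ) entry≤) (^-grow {d} (≤-trans (n≤1+n d) (n≤1+n (suc d))))))
      (≤-reflexive (cong (λ z → M ^ suc z) (⊔-idem (suc (suc d))))))) limit
    exec′ = Exec-mono words≤ exec
    final = Exec-bounded exec′ (initial-bounded (⟦ e ⟧ σ) (arrays σ a) (proj₁ (fits ve))
              (λ j → ≤-trans (proj₂ ok a j) (small-bound (Γa a) (smalla a))))
    bounded : ∀ i → overwrite (output σ₁) (arrays σ b) i ≤ bound (Γa b)
    bounded = overwrite-all (_≤ bound (Γa b)) (regs σ₁ 1) (arrays σ b)
                (λ j → subst (λ z → arrays σ₁ 1 j ≤ bound z) (sym nb) (proj₂ final 1 j)) (proj₂ ok b)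
    time≤ : 1 + cost e + length xs + s + length (output σ₁) ≤ 1 + cost e + T
    time≤ = ≤-trans (≤-reflexive (trans (cong (_+ length (output σ₁)) (+-assoc (1 + cost e) (length xs) s))
                                        (+-assoc (1 + cost e) (length xs + s) _))) (+-monoʳ-≤ (1 + cost e) le)

-- Collecting the candidates

entry : List (Maybe ℕ) → ℕ → Maybe ℕ
entry []       i       = just 1
entry (d ∷ ds) zero    = d
entry (d ∷ ds) (suc i) = entry ds i

AllSmall : List (Maybe ℕ) → Set
AllSmall []       = Unit
AllSmall (d ∷ ds) = small d × AllSmall ds

entry-small : ∀ ds → {AllSmall ds} → ∀ i → small (entry ds i)
entry-small []               i       = tt
entry-small (d ∷ ds) {s , _} zero    = s
entry-small (d ∷ ds) {_ , s} (suc i) = entry-small ds {s} i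

-- Register 19 and arrays 3 and 8 receive results of the given algorithms.
registerDegrees arrayDegrees : List (Maybe ℕ)
registerDegrees = just 1 ∷ just 3 ∷ just 1 ∷ just 1 ∷ just 1 ∷ just 1 ∷ just 1 ∷ just 1 ∷ just 7 ∷ just 7 ∷
            just 1 ∷ just 1 ∷ just 1 ∷ just 1 ∷ just 1 ∷ just 2 ∷ just 1 ∷ just 1 ∷ just 1 ∷ nothing ∷
            just 8 ∷ []
arrayDegrees = just 1 ∷ just 1 ∷ just 1 ∷ nothing ∷ just 1 ∷ just 7 ∷ just 1 ∷ just 3 ∷ nothing ∷ []

registerDegree arrayDegree : ℕ → Maybe ℕ
registerDegree = entry registerDegrees
arrayDegree    = entry arrayDegrees

edgeCell : ℕ → Expr → Expr
edgeCell c e = cell 0 (op add (lit (5 + c)) (op mul e (lit 4)))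

sourceOf targetOf weightOf lengthOf toleranceOf : Expr → Expr
sourceOf = edgeCell 0
targetOf = edgeCell 1
weightOf = edgeCell 2
lengthOf = edgeCell 3
toleranceOf e = op quot (op mul (reg 5) (lengthOf e)) (reg 6)

-- Registers 2 to 6 hold n, m, W and the numerator and denominator of α;
-- 7 becomes the largest length of an edge lighter than W.
readParameters lengthBody : Program
readParameters = 2 ≔ cell 0 (lit 0) ⨾ 3 ≔ cell 0 (lit 1) ⨾ 4 ≔ cell 0 (lit 2) ⨾
                 5 ≔ cell 0 (lit 3) ⨾ 6 ≔ cell 0 (lit 4) ⨾ 7 ≔ lit 1
lengthBody = cond (op less (weightOf (reg 10)) (reg 4))
               (cond (op less (reg 7) (lengthOf (reg 10))) (7 ≔ lengthOf (reg 10)) skip) skip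

-- Register 8 holds the maximal number of candidates, register 9 how many of
-- them are still to be found, and array 2 the network.
prepare copyBody : Program
prepare = 8 ≔ op mul (op mul (lit 4) (reg 4)) (op quot (op mul (reg 5) (reg 7)) (reg 6)) ⨾
          9 ≔ reg 8 ⨾ 2 [ lit 0 ]≔ reg 2 ⨾ 2 [ lit 1 ]≔ reg 3
copyBody = 2 [ op add (lit 2) (op mul (reg 10) (lit 3)) ]≔ sourceOf (reg 10) ⨾
           2 [ op add (lit 3) (op mul (reg 10) (lit 3)) ]≔ targetOf (reg 10) ⨾
           2 [ op add (lit 4) (op mul (reg 10) (lit 3)) ]≔ lengthOf (reg 10)

pairCell : ℕ → Expr
pairCell c = cell 3 (op add (op add (lit c) (op mul (targetOf (reg 10)) (lit 2)))
                            (op mul (sourceOf (reg 10)) (op mul (reg 2) (lit 2))))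

-- Array 4 collects the candidates.
candidateBody : Program
candidateBody =
  (15 ≔ toleranceOf (reg 10) ⨾ 19 ≔ pairCell 0) ⨾
  cond (op less (op monus (reg 19) (lit 1)) (lengthOf (reg 10))) skip (19 ≔ pairCell 1) ⨾
  cond (weightOf (reg 10))
    (cond (reg 9)
      (cond (reg 19)
        (cond (op less (reg 15) (op monus (reg 19) (lit 1))) skip
          (4 [ op monus (reg 8) (reg 9) ]≔ reg 10 ⨾ 9 ≔ op monus (reg 9) (lit 1)))
        skip)
      skip)
    skip

module Verification (oracle : DistanceOracle) (I : Instance)
  (M B : ℕ) (2≤M : 2 ≤ M) (enough : M ^ maxDegree ≤ B) where

  open Instance I
  open Solutions oracle I
  open Static registerDegree arrayDegree public
  open Logic M B 2≤M enough public

  N : Network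
  N = Instance.network I

  input : ℕ → ℕ
  input = overwrite encodeInstance (λ _ → 0)

  input-edge : ∀ e → input (5 + toℕ e * 4) ≡ toℕ (proj₁ (ends e)) ×
                     input (6 + toℕ e * 4) ≡ toℕ (proj₂ (ends e)) ×
                     input (7 + toℕ e * 4) ≡ weight e × input (8 + toℕ e * 4) ≡ len e
  input-edge e = overwrite-block (λ e → e) (λ _ → refl) {j = 0} e (s≤s z≤n) ,
                 overwrite-block (λ e → e) (λ _ → refl) {j = 1} e (s≤s (s≤s z≤n)) ,
                 overwrite-block (λ e → e) (λ _ → refl) {j = 2} e (s≤s (s≤s (s≤s z≤n))) ,
                 overwrite-block (λ e → e) (λ _ → refl) {j = 3} e ≤-refl

  record Env (σ : Store) : Set where
    field
      n≡ : regs σ 2 ≡ n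
      m≡ : regs σ 3 ≡ m
      W≡ : regs σ 4 ≡ W
      a≡ : regs σ 5 ≡ numα
      b≡ : regs σ 6 ≡ denα
      input≡ : arrays σ 0 ≡ input
  open Env public

  KeepsEnv : Program → Set
  KeepsEnv p = (UnmodifiedReg p 2 × UnmodifiedReg p 3 × UnmodifiedReg p 4 × UnmodifiedReg p 5 × UnmodifiedReg p 6) ×
               UnmodifiedArray p 0

  keepEnv : ∀ {p σ σ′} {u : KeepsEnv p} → Agree p σ σ′ → Env σ → Env σ′
  keepEnv {u = (u₂ , u₃ , u₄ , u₅ , u₆) , v₀} (agree r a) env = record
    { n≡ = trans (r 2 {u₂}) (n≡ env) ; m≡ = trans (r 3 {u₃}) (m≡ env) ; W≡ = trans (r 4 {u₄}) (W≡ env)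
    ; a≡ = trans (r 5 {u₅}) (a≡ env) ; b≡ = trans (r 6 {u₆}) (b≡ env) ; input≡ = trans (a 0 {v₀}) (input≡ env) }

  edgeCell-value : ∀ c {r σ k} → Env σ → regs σ r ≡ k → ⟦ edgeCell c (reg r) ⟧ σ ≡ input (5 + c + k * 4)
  edgeCell-value c {r} env eq = cong₂ (λ f k → f (5 + c + k * 4)) (input≡ env) eq

  module _ {σ r} {e : Fin m} (env : Env σ) (eq : regs σ r ≡ toℕ e) where

    source-value : ⟦ sourceOf (reg r) ⟧ σ ≡ toℕ (proj₁ (ends e))
    source-value = trans (edgeCell-value 0 {r} env eq) (proj₁ (input-edge e))

    target-value : ⟦ targetOf (reg r) ⟧ σ ≡ toℕ (proj₂ (ends e))
    target-value = trans (edgeCell-value 1 {r} env eq) (proj₁ (proj₂ (input-edge e)))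

    weight-value : ⟦ weightOf (reg r) ⟧ σ ≡ weight e
    weight-value = trans (edgeCell-value 2 {r} env eq) (proj₁ (proj₂ (proj₂ (input-edge e))))

    length-value : ⟦ lengthOf (reg r) ⟧ σ ≡ len e
    length-value = trans (edgeCell-value 3 {r} env eq) (proj₂ (proj₂ (proj₂ (input-edge e))))

    tolerance-value : ⟦ toleranceOf (reg r) ⟧ σ ≡ tolerance e
    tolerance-value = trans (cong (applyOp quot _) (b≡ env))
      (cong₂ (λ x y → applyOp quot (x * y) denα) (a≡ env) length-value)

  index : ∀ {i} → i < m → ∃[ e ] toℕ e ≡ i
  index i<m = fromℕ< i<m , toℕ-fromℕ< i<m

  below-suc : ∀ {P : Fin m → Set} {i} e → toℕ e ≡ i → P e → (∀ e′ → toℕ e′ < i → P e′) → ∀ e′ → toℕ e′ < suc i → P e′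
  below-suc {P} e refl p q e′ lt with m≤n⇒m<n∨m≡n (≤-pred lt)
  ... | inj₁ lt′ = q e′ lt′
  ... | inj₂ eq  = subst P (toℕ-injective (sym eq)) p

  -- `L` starts at 1 and not at 0, so that the bound on the tolerances derived from it is positive,
  -- as the selection of independent candidates demands. `attained` later bounds `L` by `ℓmax` or by
  -- `W`.
  record Light (i L : ℕ) : Set where
    field
      1≤L      : 1 ≤ L
      covers   : ∀ e → toℕ e < i → weight e < W → len e ≤ L
      attained : L ≡ 1 ⊎ ∃[ e ] weight e < W × L ≡ len e
  open Light public

  lengths : ∀ {σ} → Ok σ → Env σ → regs σ 7 ≡ 1 →
            Reach (for 10 3 lengthBody) σ (6 + m * (8 + duration lengthBody)) (λ σ′ → Light m (regs σ′ 7))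
  lengths ok env eq = iterate 10 3 refl refl (λ i σ → Light i (regs σ 7)) step ok (m≡ env)
    record { 1≤L = ≤-reflexive (sym eq) ; covers = λ _ () ; attained = inj₁ eq }
    where
    step : ∀ {σ} → Ok σ → Agree (for 10 3 lengthBody) _ σ → regs σ 10 < m → Light (regs σ 10) (regs σ 7) →
           Reach lengthBody σ (duration lengthBody) (λ σ′ → Light (suc (regs σ 10)) (regs σ′ 7))
    step {σ} ok ag i<m inv with index i<m
    ... | e , e≡ = branch (op less (weightOf (reg 10)) (reg 4)) ok
      (λ w → let light = subst₂ _<_ w≡ (W≡ env′) (less≢0 w) in
        branch (op less (reg 7) (lengthOf (reg 10))) ok
          (λ l → let longer = subst (regs σ 7 <_) l≡ (less≢0 l) in
            straight (7 ≔ lengthOf (reg 10)) ok (subst (Light (suc (regs σ 10))) (sym l≡) record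
              { 1≤L = ≤-trans (1≤L inv) (<⇒≤ longer)
              ; covers = below-suc e e≡ (λ _ → ≤-refl) (λ e′ lt w′ → ≤-trans (covers inv e′ lt w′) (<⇒≤ longer))
              ; attained = inj₂ (e , light , refl) }))
          (λ l → straight skip ok record
            { 1≤L = 1≤L inv
            ; covers = below-suc e e≡ (λ _ → subst (_≤ regs σ 7) l≡ (less≡0 l)) (covers inv)
            ; attained = attained inv }))
      (λ w → straight skip ok record
        { 1≤L = 1≤L inv
        ; covers = below-suc e e≡ (λ w′ → ⊥-elim (<⇒≱ w′ (subst₂ _≤_ (W≡ env′) w≡ (less≡0 w)))) (covers inv)
        ; attained = attained inv })
      where
      env′ = keepEnv ag env
      w≡ = weight-value {σ} {10} {e} env′ (sym e≡)
      l≡ = length-value {σ} {10} {e} env′ (sym e≡)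

  networkBlock : ℕ → List ℕ
  networkBlock i = input (5 + i * 4) ∷ input (6 + i * 4) ∷ input (8 + i * 4) ∷ []

  copy : ∀ {σ} → Ok σ → Env σ → arrays σ 2 0 ≡ n → arrays σ 2 1 ≡ m →
         Reach (for 10 3 copyBody) σ (6 + m * (8 + duration copyBody))
           (λ σ′ → applyUpTo (arrays σ′ 2) (2 + m * 3) ≡ encodeNetwork N)
  copy ok env n≡ m≡′ = consequence
    (iterate 10 3 refl refl (λ i σ → applyUpTo (arrays σ 2) (2 + i * 3) ≡ n ∷ m ∷ concatMap networkBlock (upTo i))
      step ok (m≡ env) (cong₂ (λ x y → x ∷ y ∷ []) n≡ m≡′))
    (λ _ _ eq → trans eq (cong (λ l → n ∷ m ∷ l) (concatMap-upTo networkBlock _ (λ e →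
      cong₂ _∷_ (proj₁ (input-edge e)) (cong₂ (λ x y → x ∷ y ∷ [])
        (proj₁ (proj₂ (input-edge e))) (proj₂ (proj₂ (proj₂ (input-edge e)))))))))
    where
    step : ∀ {σ} → Ok σ → Agree (for 10 3 copyBody) _ σ → regs σ 10 < m →
           applyUpTo (arrays σ 2) (2 + regs σ 10 * 3) ≡ n ∷ m ∷ concatMap networkBlock (upTo (regs σ 10)) →
           Reach copyBody σ (duration copyBody) (λ σ′ → applyUpTo (arrays σ′ 2) (2 + suc (regs σ 10) * 3) ≡
             n ∷ m ∷ concatMap networkBlock (upTo (suc (regs σ 10))))
    step {σ} ok ag i<m inv = straight copyBody ok
      (trans (applyUpTo-update₃ {arrays σ 2} inv)
        (cong (λ l → n ∷ m ∷ l) (trans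
          (cong (λ f → concatMap networkBlock (upTo i) ++ f (5 + i * 4) ∷ f (6 + i * 4) ∷ f (8 + i * 4) ∷ [])
            (input≡ (keepEnv ag env)))
          (sym (concatMap-upTo-suc networkBlock i)))))
      where i = regs σ 10

  if-less : ∀ {A : Set} {x y} {s t : A} → x < y → (if x <ᵇ y then s else t) ≡ s
  if-less {x = x} {y} lt with x <ᵇ y | <⇒<ᵇ lt
  ... | true | _ = refl

  if-not-less : ∀ {A : Set} {x y} {s t : A} → y ≤ x → (if x <ᵇ y then s else t) ≡ t
  if-not-less {x = x} {y} le with x <ᵇ y | <ᵇ⇒< x y
  ... | true  | lt = ⊥-elim (<⇒≱ (lt tt) le)
  ... | false | _  = refl

  module Candidates (D : Fin n → Fin n → Maybe ℕ × Maybe ℕ)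
    (shortest : ∀ u v → TwoShortest N u v (proj₁ (D u v)) (proj₂ (D u v))) (K : ℕ) where

    pairBlock : Fin n → Fin n → List ℕ
    pairBlock u v = encodeMaybe (proj₁ (D u v)) ∷ encodeMaybe (proj₂ (D u v)) ∷ []

    table : List ℕ
    table = concatMap (λ u → concatMap (pairBlock u) (allFin n)) (allFin n)

    table-entry : ∀ {f j} u v → j < 2 → overwrite table f ((j + toℕ v * 2) + toℕ u * (n * 2)) ≡
                                       overwrite (pairBlock u v) (λ _ → 0) j
    table-entry {j = j} u v j<2 = trans
      (overwrite-block (λ u → u) (λ u → length-concatMap {2} {g = pairBlock u} (λ v → v) (λ _ → refl)) u
        (≤-trans (+-monoˡ-≤ (toℕ v * 2) j<2) (*-monoˡ-≤ 2 (toℕ<n v))))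
      (overwrite-block (λ v → v) (λ _ → refl) v j<2)

    Table : (ℕ → ℕ) → Set
    Table f = ∀ u v {j} → j < 2 → f ((j + toℕ v * 2) + toℕ u * (n * 2)) ≡ overwrite (pairBlock u v) (λ _ → 0) j

    -- `complete` records a dichotomy: either the list is full, or no candidate so far has been
    -- missed. `earlier` is what keeps the list free of repetitions when an edge is appended.
    record Collected (i room : ℕ) (c : ℕ → ℕ) : Set where
      field
        list     : List (Σ (Fin m) Candidate)
        count    : room + length list ≡ K
        stored   : applyUpTo c (length list) ≡ map (toℕ ∘ proj₁) list
        unique   : Unique (map proj₁ list)
        earlier  : All (λ y → toℕ (proj₁ y) < i) list
        complete : room ≡ 0 ⊎ (∀ e → toℕ e < i → Candidate e → e ∈ˡ map proj₁ list)
    open Collected public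

    unchanged : ∀ {i room c} → Collected i room c →
                (room ≡ 0 ⊎ (∀ e → toℕ e ≡ i → ¬ Candidate e)) → Collected (suc i) room c
    unchanged {i} col why = record
      { list = list col ; count = count col ; stored = stored col ; unique = unique col
      ; earlier = All.map m≤n⇒m≤1+n (earlier col) ; complete = lemma (complete col) why }
      where
      lemma : ∀ {room} → (room ≡ 0 ⊎ _) → (room ≡ 0 ⊎ _) → room ≡ 0 ⊎ _
      lemma (inj₁ z) _ = inj₁ z
      lemma (inj₂ _) (inj₁ z) = inj₁ z
      lemma (inj₂ all) (inj₂ never) = inj₂ λ e lt cand → [ (λ lt′ → all e lt′ cand) , (λ eq → ⊥-elim (never e eq cand)) ]′
                                                        (m≤n⇒m<n∨m≡n (≤-pred lt))

    extended : ∀ {i room c e} → Collected i room c → toℕ e ≡ i → Candidate e → 0 < room →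
               Collected (suc i) (room ∸ 1) (update (K ∸ room) i c)
    extended {i} {suc r} {c} {e} col refl cand _ = record
      { list = ys ++ (e , cand) ∷ []
      ; count = trans (cong (r +_) length≡) (trans (+-suc r _) (count col))
      ; stored = trans (cong (applyUpTo (update (K ∸ suc r) i c)) length≡)
          (trans (subst (λ z → applyUpTo (update z i c) (suc (length ys)) ≡ map (toℕ ∘ proj₁) ys ++ i ∷ [])
                    (sym place) (applyUpTo-update c (stored col)))
                 (sym (map-++ (toℕ ∘ proj₁) ys _)))
      ; unique = subst Unique (sym (map-++ proj₁ ys _)) (Unique.++⁺ (unique col) ([] ∷ []) fresh)
      ; earlier = All.++⁺ (All.map m≤n⇒m≤1+n (earlier col)) (≤-refl ∷ [])
      ; complete = inj₂ λ e′ lt cand′ → subst (e′ ∈ˡ_) (sym (map-++ proj₁ ys _)) (lemma e′ cand′ (m≤n⇒m<n∨m≡n (≤-pred lt)))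
      }
      where
      ys = list col
      length≡ : length (ys ++ (e , cand) ∷ []) ≡ suc (length ys)
      length≡ = trans (length-++ ys) (+-comm _ 1)
      place : K ∸ suc r ≡ length ys
      place = trans (cong (_∸ suc r) (sym (count col))) (m+n∸m≡n (suc r) (length ys))
      fresh : ∀ {x} → ¬ (x ∈ˡ map proj₁ ys × x ∈ˡ e ∷ [])
      fresh (x∈ , here refl) with ∈-map⁻ proj₁ x∈
      ... | y , y∈ , eq = <⇒≢ (All.lookup (earlier col) y∈) (cong toℕ (sym eq))
      lemma : ∀ e′ → Candidate e′ → (toℕ e′ < i) ⊎ (toℕ e′ ≡ i) → e′ ∈ˡ map proj₁ ys ++ e ∷ []
      lemma e′ cand′ (inj₂ eq) = ∈-++⁺ʳ (map proj₁ ys) (here (toℕ-injective eq))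
      lemma e′ cand′ (inj₁ lt) with complete col
      ... | inj₂ all = ∈-++⁺ˡ (all e′ lt cand′)

    collect : ∀ {σ} → Ok σ → Env σ → regs σ 8 ≡ K → regs σ 9 ≡ K → Table (arrays σ 3) →
              Reach (for 10 3 candidateBody) σ (6 + m * (8 + duration candidateBody))
                (λ σ′ → Collected m (regs σ′ 9) (arrays σ′ 4))
    collect {σ₀} ok env K≡ room≡ tab = iterate 10 3 refl refl (λ i σ → Collected i (regs σ 9) (arrays σ 4)) step ok (m≡ env)
      record { list = [] ; count = trans (+-identityʳ _) room≡ ; stored = refl ; unique = [] ; earlier = []
             ; complete = inj₂ λ _ () }
      where
      step : ∀ {σ} → Ok σ → Agree (for 10 3 candidateBody) σ₀ σ → regs σ 10 < m →
             Collected (regs σ 10) (regs σ 9) (arrays σ 4) →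
             Reach candidateBody σ (duration candidateBody) (λ σ′ → Collected (suc (regs σ 10)) (regs σ′ 9) (arrays σ′ 4))
      step {σ} ok ag i<m col with index i<m
      ... | e , e≡ =
        straight (15 ≔ toleranceOf (reg 10) ⨾ 19 ≔ pairCell 0)
          {Q = λ σ′ → regs σ′ 15 ≡ tolerance e × regs σ′ 19 ≡ encodeMaybe (proj₁ (D u v))} ok
          ( tolerance-value {σ} {10} {e} env₁ (sym e≡) , pair-value 0 {σ} env₁ tab₁ (s≤s z≤n) (sym e≡))
        then λ {σ₂} ok₂ ag₂ (t≡ , d≡) →
        let env₂ = keepEnv ag₂ env₁
            i≡₂ = trans (keepReg ag₂ 10) (sym e≡)
            l≡ = length-value {σ₂} {10} {e} env₂ i≡₂
        in
        branch (op less (op monus (reg 19) (lit 1)) (lengthOf (reg 10)))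
          {Q = λ σ′ → regs σ′ 15 ≡ tolerance e × regs σ′ 19 ≡ detourLength e (proj₁ (D u v)) (proj₂ (D u v))} ok₂
          (λ l → straight skip ok₂ (t≡ , trans d≡ (sym (if-less (subst₂ (λ x y → x ∸ 1 < y) d≡ l≡ (less≢0 l))))))
          (λ l → straight (19 ≔ pairCell 1) ok₂ (t≡ , trans
            (pair-value 1 env₂ (subst Table (sym (keepArray ag₂ 3)) tab₁) ≤-refl i≡₂)
            (sym (if-not-less (subst₂ (λ x y → y ≤ x ∸ 1) d≡ l≡ (less≡0 l))))))
        then λ {σ₃} ok₃ ag₃ (t≡ , d≡) →
        let env₃ = keepEnv ag₃ env₂
            i≡ = trans (keepReg ag₃ 10) (keepReg ag₂ 10)
            w≡ = weight-value {_} {10} {e} env₃ (sym (trans e≡ (sym i≡)))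
            room≡ = trans (keepReg ag₃ 9) (keepReg ag₂ 9)
            c≡ = trans (keepArray ag₃ 4) (keepArray ag₂ 4)
            K≡₃ = trans (keepReg ag₃ 8) (trans (keepReg ag₂ 8) (trans (keepReg ag 8) K≡))
            col₃ = subst₂ (Collected (regs σ 10)) (sym room≡) (sym c≡) col
            rejected = λ (no : ¬ Candidate e) → unchanged {c = arrays σ₃ 4} col₃
              (inj₂ (λ e′ eq → subst (λ e → ¬ Candidate e) (toℕ-injective (trans e≡ (sym eq))) no))
        in branch (weightOf (reg 10)) ok₃
          (λ w → branch (reg 9) ok₃
            (λ r → branch (reg 19) ok₃
              (λ d → branch (op less (reg 15) (op monus (reg 19) (lit 1))) ok₃
                (λ l → straight skip ok₃ (rejected (λ (_ , a) → <⇒≱ (less≢0 l)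
                  (subst₂ (λ x y → x ∸ 1 ≤ y) (sym d≡) (sym t≡) (proj₂ (Equivalence.to (avoiding⇔ e (shortest u v)) a))))))
                (λ l → straight (4 [ op monus (reg 8) (reg 9) ]≔ reg 10 ⨾ 9 ≔ op monus (reg 9) (lit 1)) ok₃
                  (subst (λ f → Collected (suc (regs σ 10)) (regs σ₃ 9 ∸ 1) f)
                    (cong₂ (λ x y → update (x ∸ regs σ₃ 9) y (arrays σ₃ 4)) (sym K≡₃) (sym i≡))
                    (extended col₃ e≡ (subst (0 <_) w≡ (n≢0⇒n>0 w) ,
                      Equivalence.from (avoiding⇔ e (shortest u v))
                        (subst (0 <_) d≡ (n≢0⇒n>0 d) , subst₂ (λ x y → x ∸ 1 ≤ y) d≡ t≡ (less≡0 l))) (n≢0⇒n>0 r)))))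
              (λ d → straight skip ok₃ (rejected (λ (_ , a) →
                <⇒≢ (proj₁ (Equivalence.to (avoiding⇔ e (shortest u v)) a)) (trans (sym d) d≡)))))
            (λ r → straight skip ok₃ (unchanged col₃ (inj₁ r))))
          (λ w → straight skip ok₃ (rejected (λ (p , _) → <⇒≢ p (trans (sym w) w≡))))
        where
        u = proj₁ (ends e)
        v = proj₂ (ends e)
        env₁ = keepEnv ag env
        tab₁ = subst Table (sym (keepArray ag 3)) tab
        pair-value : ∀ j {σ} → Env σ → Table (arrays σ 3) → j < 2 → regs σ 10 ≡ toℕ e →
                     ⟦ pairCell j ⟧ σ ≡ overwrite (pairBlock u v) (λ _ → 0) j
        pair-value j {σ} env tab j<2 eq = trans
          (cong (arrays σ 3) (cong₂ _+_ (cong (λ x → j + x * 2) (target-value {σ} {10} {e} env eq))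
            (cong₂ (λ x y → x * (y * 2)) (source-value {σ} {10} {e} env eq) (n≡ env))))
          (tab u v j<2)

-- Testing and enumerating tuples

-- Positional notation in base `b`, least significant digit first.
number : ℕ → (ℕ → ℕ) → ℕ → ℕ
number b D zero    = 0
number b D (suc k) = number b D k + D k * b ^ k

number-cong : ∀ b {D E} k → (∀ {j} → j < k → D j ≡ E j) → number b D k ≡ number b E k
number-cong b zero    eq = refl
number-cong b (suc k) eq = cong₂ (λ x y → x + y * b ^ k) (number-cong b k (eq ∘ m≤n⇒m≤1+n)) (eq ≤-refl)

number< : ∀ b {D} k → (∀ {j} → j < k → D j < b) → number b D k < b ^ k
number< b zero    lt = s≤s z≤n
number< b {D} (suc k) lt = ≤-trans (+-monoˡ-≤ (D k * b ^ k) (number< b k (lt ∘ m≤n⇒m≤1+n))) (*-monoˡ-≤ (b ^ k) (lt ≤-refl))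

-- The enumeration only records which numbers have been tried. By injectivity, a tuple with the
-- number of the current one is the current one as far as its first `k` digits go.
number-injective : ∀ b {D E} k → (∀ {j} → j < k → D j < b) → (∀ {j} → j < k → E j < b) →
                   number b D k ≡ number b E k → ∀ {j} → j < k → D j ≡ E j
number-injective b {D} {E} (suc k) D< E< eq {j} j<k with split
  where
  x<  = number< b {D} k (D< ∘ m≤n⇒m≤1+n)
  y<  = number< b {E} k (E< ∘ m≤n⇒m≤1+n)
  instance
    nz : NonZero (b ^ k)
    nz = >-nonZero (≤-trans (s≤s z≤n) x<)
  low : number b D k ≡ number b E k
  low = begin
    number b D k                            ≡⟨ sym (m<n⇒m%n≡m x<) ⟩
    number b D k % b ^ k                    ≡⟨ sym ([m+kn]%n≡m%n (number b D k) (D k) (b ^ k)) ⟩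
    (number b D k + D k * b ^ k) % b ^ k    ≡⟨ cong (_% b ^ k) eq ⟩
    (number b E k + E k * b ^ k) % b ^ k    ≡⟨ [m+kn]%n≡m%n (number b E k) (E k) (b ^ k) ⟩
    number b E k % b ^ k                    ≡⟨ m<n⇒m%n≡m y< ⟩
    number b E k                            ∎
    where open ≡-Reasoning
  split : number b D k ≡ number b E k × D k ≡ E k
  split = low , *-cancelʳ-≡ (D k) (E k) (b ^ k)
    (+-cancelˡ-≡ (number b D k) _ _ (trans eq (cong (_+ E k * b ^ k) (sym low))))
... | low , high with m≤n⇒m<n∨m≡n (≤-pred j<k)
...   | inj₁ lt   = number-injective b k (D< ∘ m≤n⇒m≤1+n) (E< ∘ m≤n⇒m≤1+n) low lt
...   | inj₂ refl = high

-- Here `x` is a digit plus a carry of at most 1, so `x ≤ b`. Hence `b ∸ 1 < x` singles out `x = b`,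
-- the one case in which the remainder drops to 0.
digit-carry : ∀ x b → 0 < b → x ≤ b →
              applyOp rem x b < b × applyOp rem x b + fromBool (b ∸ 1 <ᵇ x) * b ≡ x
digit-carry x (suc b) _ x≤b with b <ᵇ x in eq | <ᵇ⇒< b x | m≤n⇒m<n∨m≡n x≤b
... | true | h | inj₁ lt = ⊥-elim (<⇒≱ (h tt) (≤-pred lt))
... | true | h | inj₂ refl = subst (_< suc b) (sym (n%n≡0 (suc b))) (s≤s z≤n) ,
                             trans (cong (_+ (suc b + 0)) (n%n≡0 (suc b))) (+-identityʳ (suc b))
... | false | h | inj₁ lt = subst (_< suc b) (sym (m<n⇒m%n≡m lt)) lt , trans (+-identityʳ _) (m<n⇒m%n≡m lt)
... | false | h | inj₂ refl = ⊥-elim (subst T eq (<⇒<ᵇ {b} {suc b} ≤-refl))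

sum-applyUpTo-filter : ∀ {m} {P : Fin m → Set} (P? : ∀ e → Dec (P e)) (w : Fin m → ℕ) (g : ℕ → ℕ) →
  (∀ e → g (toℕ e) ≡ (if does (P? e) then w e else 0)) →
  sum (applyUpTo g m) ≡ sum (map w (filter P? (allFin m)))
sum-applyUpTo-filter P? w g eq = go g (λ e → e) eq
  where
  go : ∀ {k} (g : ℕ → ℕ) (h : Fin k → Fin _) → (∀ e → g (toℕ e) ≡ (if does (P? (h e)) then w (h e) else 0)) →
       sum (applyUpTo g k) ≡ sum (map w (filter P? (tabulate h)))
  go {zero}  g h eq = refl
  go {suc k} g h eq with does (P? (h zero)) | eq zero
  ... | true  | z = cong₂ _+_ z (go (g ∘ suc) (h ∘ suc) (eq ∘ suc))
  ... | false | z = trans (cong (_+ sum (applyUpTo (g ∘ suc) k)) z) (go (g ∘ suc) (h ∘ suc) (eq ∘ suc))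

sum-applyUpTo-suc : ∀ (g : ℕ → ℕ) k → sum (applyUpTo g (suc k)) ≡ sum (applyUpTo g k) + g k
sum-applyUpTo-suc g k = trans (cong sum (sym (applyUpTo-∷ʳ g k)))
  (trans (sum-++ (applyUpTo g k) (g k ∷ [])) (cong (sum (applyUpTo g k) +_) (+-identityʳ (g k))))

distanceOracle : Algorithm singlePair → DistanceOracle
distanceOracle S N u v with correct S (record { network = N ; source = u ; target = v })
... | d , shortest , _ = d , shortest

-- Array 5 holds the positions in array 4 of the edges of the current tuple,
-- array 6 the edges outside the tuple.
markAllBody markBody restBody queryBody odometerBody : Program
markAllBody = 6 [ reg 10 ]≔ lit 1
markBody = 6 [ cell 4 (cell 5 (reg 11)) ]≔ lit 0
restBody = cond (cell 6 (reg 10)) skip (12 ≔ op monus (reg 12) (weightOf (reg 10)))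
queryBody =
  (7 [ op add (lit 4) (op mul (reg 10) (lit 3)) ]≔ sourceOf (reg 10) ⨾
   7 [ op add (lit 5) (op mul (reg 10) (lit 3)) ]≔ targetOf (reg 10)) ⨾
  cond (cell 6 (reg 10))
    (7 [ op add (lit 6) (op mul (reg 10) (lit 3)) ]≔ lengthOf (reg 10))
    (7 [ op add (lit 6) (op mul (reg 10) (lit 3)) ]≔ op add (reg 15) (lit 1))
odometerBody = 20 ≔ op add (cell 5 (reg 11)) (reg 16) ⨾
               5 [ reg 11 ]≔ op rem (reg 20) (reg 9) ⨾
               16 ≔ op less (op monus (reg 9) (lit 1)) (reg 20)

queryHead testAnswer : Program
queryHead = 14 ≔ cell 4 (cell 5 (reg 11)) ⨾ 15 ≔ toleranceOf (reg 14) ⨾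
            7 [ lit 0 ]≔ sourceOf (reg 14) ⨾ 7 [ lit 1 ]≔ targetOf (reg 14) ⨾
            7 [ lit 2 ]≔ reg 2 ⨾ 7 [ lit 3 ]≔ reg 3
testAnswer = cond (op less (reg 15) (op monus (cell 8 (lit 0)) (lit 1))) (13 ≔ lit 0) skip

queryLength : Expr
queryLength = op add (lit 4) (op mul (reg 3) (lit 3))

module Tests (S : Algorithm singlePair) where

  testBody checkBody advance whileBody : Program
  testBody = queryHead ⨾ for 10 3 queryBody ⨾ call (program S) 7 queryLength 8 ⨾ testAnswer
  checkBody = for 10 3 markAllBody ⨾ for 11 4 markBody ⨾ 12 ≔ reg 4 ⨾ for 10 3 restBody ⨾
              13 ≔ op equal (reg 12) (lit 0) ⨾ for 11 4 testBody
  advance = 16 ≔ lit 1 ⨾ for 11 4 odometerBody ⨾ 17 ≔ op monus (lit 1) (reg 16)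
  whileBody = checkBody ⨾ cond (reg 13) (18 ≔ lit 1 ⨾ 17 ≔ lit 0) advance

  module Checking (I : Instance) (M B : ℕ) (2≤M : 2 ≤ M) (enough : M ^ maxDegree ≤ B)
           (fits-S : (M ^ 8) ^ wordExponent S ≤ B) (spsp : ℕ → ℕ → ℕ)
           (fast : ∀ i → time S i ≤ spsp (Network.n (PairQuery.network i)) (Network.m (PairQuery.network i))) where

    open Instance I
    open Solutions (distanceOracle S) I
    open Verification (distanceOracle S) I M B 2≤M enough

    queryTime testTime : ℕ
    queryTime = 6 + m * (8 + duration queryBody)
    testTime = duration queryHead + (queryTime + (6 + spsp n m + duration testAnswer))

    checkTime advanceTime bodyTime : ℕ
    checkTime = (6 + m * (8 + duration markAllBody)) + ((6 + W * (8 + duration markBody)) + (2 +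
                ((6 + m * (8 + duration restBody)) + (4 + (6 + W * (8 + testTime))))))
    advanceTime = 2 + ((6 + W * (8 + duration odometerBody)) + 4)
    bodyTime = checkTime + (2 + (4 + advanceTime))

    module Tuple (c D : ℕ → ℕ) (valid : ∀ {j} → j < W → Σ[ e ∈ Fin m ] toℕ e ≡ c (D j)) where

      f : ℕ → ℕ
      f = c ∘ D

      F : Subset m
      F = remaining f

      Marked : ℕ → (ℕ → ℕ) → Set
      Marked k r = ∀ {i} → i < m → r i ≡ fromBool (keep f k i)

      does-remaining : ∀ e → does (e ∈? F) ≡ keep f W (toℕ e)
      does-remaining e with keep f W (toℕ e) in eq
      ... | true  = dec-true (e ∈? F) (∈remaining f eq)
      ... | false = dec-false (e ∈? F) λ i → case trans (sym (remaining∈ f i)) eq of λ ()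

      markAll : ∀ {σ} → Ok σ → Env σ → Reach (for 10 3 markAllBody) σ (6 + m * (8 + duration markAllBody))
                                            (λ σ′ → Marked 0 (arrays σ′ 6))
      markAll ok env = iterate 10 3 refl refl (λ k σ → ∀ {i} → i < k → arrays σ 6 i ≡ 1)
        (λ {σ} ok _ _ inv → straight markAllBody ok (λ {i} lt → lemma {arrays σ 6} inv i lt)) ok (m≡ env) (λ ())
        where
        lemma : ∀ {r k} → (∀ {i} → i < k → r i ≡ 1) → ∀ i → i < suc k → update k 1 r i ≡ 1
        lemma {r} {k} inv i lt with k ≡ᵇ i | ≡⇒≡ᵇ k i
        ... | true  | _ = refl
        ... | false | h with m≤n⇒m<n∨m≡n (≤-pred lt)
        ...   | inj₁ lt′  = inv lt′
        ...   | inj₂ refl = ⊥-elim (h refl)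

      mark : ∀ {σ} → Ok σ → Env σ → arrays σ 4 ≡ c → arrays σ 5 ≡ D → Marked 0 (arrays σ 6) →
             Reach (for 11 4 markBody) σ (6 + W * (8 + duration markBody)) (λ σ′ → Marked W (arrays σ′ 6))
      mark ok env c≡ D≡ marked = iterate 11 4 refl refl (λ k σ → Marked k (arrays σ 6))
        (λ {σ} ok ag _ inv → straight markBody ok (λ {i} lt →
          subst (λ z → update z 0 (arrays σ 6) i ≡ fromBool (keep f (suc (regs σ 11)) i))
            (sym (cong₂ (λ g h → g (h (regs σ 11))) (trans (keepArray ag 4) c≡) (trans (keepArray ag 5) D≡)))
            (lemma (regs σ 11) {i} {arrays σ 6} (inv lt)))) ok (W≡ env) marked
        where
        lemma : ∀ k {i r} → r i ≡ fromBool (keep f k i) → update (f k) 0 r i ≡ fromBool (keep f (suc k) i)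
        lemma k {i} eq with f k ≡ᵇ i
        ... | true  = refl
        ... | false = eq

      lost : ℕ → ℕ
      lost i = if keep f W i then 0 else input (7 + i * 4)

      lost-total : sum (applyUpTo lost m) ≡ totalWeight (∁ F)
      lost-total = sum-applyUpTo-filter (_∈? ∁ F) weight lost lemma
        where
        lemma : ∀ e → lost (toℕ e) ≡ (if does (e ∈? ∁ F) then weight e else 0)
        lemma e with keep f W (toℕ e) in eq
        ... | true  rewrite dec-false (e ∈? ∁ F) (x∈p⇒x∉∁p (∈remaining f eq)) = refl
        ... | false rewrite dec-true (e ∈? ∁ F) (x∉p⇒x∈∁p {x = e} {p = F} λ i → case trans (sym (remaining∈ f i)) eq of λ ()) =
          proj₁ (proj₂ (proj₂ (input-edge e)))

      -- Register 12 counts down from `W` by truncated subtraction and reaches 0 exactly if the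
      -- removed edges weigh at least `W`. Counting down keeps its degree, whereas a growing sum
      -- could not be typed.
      rest : ∀ {σ} → Ok σ → Env σ → Marked W (arrays σ 6) → regs σ 12 ≡ W →
             Reach (for 10 3 restBody) σ (6 + m * (8 + duration restBody))
               (λ σ′ → regs σ′ 12 ≡ W ∸ totalWeight (∁ F))
      rest ok env marked eq = consequence
        (iterate 10 3 refl refl (λ k σ → regs σ 12 ≡ W ∸ sum (applyUpTo lost k)) step ok (m≡ env) eq)
        (λ _ _ eq → trans eq (cong (W ∸_) lost-total))
        where
        step : ∀ {σ} → Ok σ → Agree (for 10 3 restBody) _ σ → regs σ 10 < m →
               regs σ 12 ≡ W ∸ sum (applyUpTo lost (regs σ 10)) →
               Reach restBody σ (duration restBody) (λ σ′ → regs σ′ 12 ≡ W ∸ sum (applyUpTo lost (suc (regs σ 10))))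
        step {σ} ok ag i<m inv = branch (cell 6 (reg 10)) ok
          (λ r → straight skip ok (trans inv (shrink (lemma (λ z → r (trans mark≡ (cong fromBool z)))))))
          (λ r → straight (12 ≔ op monus (reg 12) (weightOf (reg 10))) ok
            (trans (cong₂ _∸_ inv (edgeCell-value 2 {10} {σ} env′ refl))
              (shrink (lemma₂ (trans (sym mark≡) r)))))
          where
          i = regs σ 10
          env′ = keepEnv ag env
          mark≡ : arrays σ 6 i ≡ fromBool (keep f W i)
          mark≡ = trans (cong (λ a → a i) (keepArray ag 6)) (marked i<m)
          shrink : ∀ {x} → lost i ≡ x → W ∸ sum (applyUpTo lost i) ∸ x ≡ W ∸ sum (applyUpTo lost (suc i))
          shrink refl = trans (∸-+-assoc W (sum (applyUpTo lost i)) (lost i)) (cong (W ∸_) (sym (sum-applyUpTo-suc lost i)))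
          lemma : keep f W i ≢ false → lost i ≡ 0
          lemma n with keep f W i
          ... | true  = refl
          ... | false = ⊥-elim (n refl)
          lemma₂ : fromBool (keep f W i) ≡ 0 → lost i ≡ input (7 + i * 4)
          lemma₂ z with keep f W i
          ... | false = refl

      queryBlock : ℕ → ℕ → List ℕ
      queryBlock t i = input (5 + i * 4) ∷ input (6 + i * 4) ∷ (if keep f W i then input (8 + i * 4) else suc t) ∷ []

      query-encoding : ∀ t → n ∷ m ∷ concatMap (queryBlock t) (upTo m) ≡ encodeNetwork (reweigh N F t)
      query-encoding t = cong (λ l → n ∷ m ∷ l) (concatMap-upTo (queryBlock t) _ (λ e →
        cong₂ _∷_ (proj₁ (input-edge e)) (cong₂ (λ x y → x ∷ y ∷ []) (proj₁ (proj₂ (input-edge e)))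
          (trans (cong (λ x → if keep f W (toℕ e) then x else suc t) (proj₂ (proj₂ (proj₂ (input-edge e)))))
                 (cong (λ b → if b then len e else suc t) (sym (does-remaining e)))))))

      query : ∀ {σ x y t} → Ok σ → Env σ → Marked W (arrays σ 6) → regs σ 15 ≡ t →
              applyUpTo (arrays σ 7) 4 ≡ x ∷ y ∷ n ∷ m ∷ [] →
              Reach (for 10 3 queryBody) σ queryTime
                (λ σ′ → applyUpTo (arrays σ′ 7) (4 + m * 3) ≡ x ∷ y ∷ encodeNetwork (reweigh N F t))
      query {σ₀} {x} {y} {t} ok env marked t≡ eq = consequence
        (iterate 10 3 refl refl (λ i σ → Holds i (arrays σ 7)) step ok (m≡ env) eq)
        (λ _ _ eq → trans eq (cong (λ l → x ∷ y ∷ l) (query-encoding t)))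
        where
        Holds : ℕ → (ℕ → ℕ) → Set
        Holds i a = applyUpTo a (4 + i * 3) ≡ x ∷ y ∷ n ∷ m ∷ concatMap (queryBlock t) (upTo i)
        step : ∀ {σ} → Ok σ → Agree (for 10 3 queryBody) σ₀ σ → regs σ 10 < m → Holds (regs σ 10) (arrays σ 7) →
               Reach queryBody σ (duration queryBody) (λ σ′ → Holds (suc (regs σ 10)) (arrays σ′ 7))
        step {σ} ok ag i<m inv =
          straight (7 [ op add (lit 4) (op mul (reg 10) (lit 3)) ]≔ sourceOf (reg 10) ⨾
                    7 [ op add (lit 5) (op mul (reg 10) (lit 3)) ]≔ targetOf (reg 10))
            {Q = λ σ′ → arrays σ′ 7 ≡ update (5 + i * 3) (arrays σ 0 (6 + i * 4))
                                      (update (4 + i * 3) (arrays σ 0 (5 + i * 4)) (arrays σ 7))} ok refl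
          then λ {σ₂} ok₂ ag₂ a≡ →
          let env₂ = keepEnv ag₂ env′
              i≡ = keepReg ag₂ 10
              r≡ = trans (cong₂ (λ a j → a j) (keepArray ag₂ 6) i≡) mark≡
          in branch (cell 6 (reg 10)) ok₂
            (λ r → straight (7 [ op add (lit 6) (op mul (reg 10) (lit 3)) ]≔ lengthOf (reg 10)) ok₂
              (written (cong (λ j → 6 + j * 3) i≡) a≡ (trans (edgeCell-value 3 {10} {σ₂} env₂ i≡)
                (kept (λ z → r (trans r≡ (cong fromBool z)))))))
            (λ r → straight (7 [ op add (lit 6) (op mul (reg 10) (lit 3)) ]≔ op add (reg 15) (lit 1)) ok₂
              (written (cong (λ j → 6 + j * 3) i≡) a≡ (trans (trans (+-comm _ 1)
                (cong suc (trans (keepReg ag₂ 15) (trans (keepReg ag 15) t≡)))) (dropped (trans (sym r≡) r)))))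
          where
          i = regs σ 10
          env′ = keepEnv ag env
          mark≡ : arrays σ 6 i ≡ fromBool (keep f W i)
          mark≡ = trans (cong (λ a → a i) (keepArray ag 6)) (marked i<m)
          entry′ : ℕ
          entry′ = if keep f W i then input (8 + i * 4) else suc t
          kept : keep f W i ≢ false → input (8 + i * 4) ≡ entry′
          kept n with keep f W i
          ... | true  = refl
          ... | false = ⊥-elim (n refl)
          dropped : fromBool (keep f W i) ≡ 0 → suc t ≡ entry′
          dropped z with keep f W i
          ... | false = refl
          written : ∀ {p v a} → p ≡ 6 + i * 3 →
                    a ≡ update (5 + i * 3) (arrays σ 0 (6 + i * 4)) (update (4 + i * 3) (arrays σ 0 (5 + i * 4)) (arrays σ 7)) →
                    v ≡ entry′ → Holds (suc i) (update p v a)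
          written refl refl refl = trans (applyUpTo-update₃ {arrays σ 7} inv)
            (cong (λ l → x ∷ y ∷ n ∷ m ∷ l) (trans
              (cong (λ g → concatMap (queryBlock t) (upTo i) ++ g (5 + i * 4) ∷ g (6 + i * 4) ∷ entry′ ∷ []) (input≡ env′))
              (sym (concatMap-upTo-suc (queryBlock t) i))))

      Verdict : ℕ → ℕ → Set
      Verdict k v = (v ≡ 1 × W ≤ totalWeight (∁ F) × (∀ e {j} → j < k → f j ≡ toℕ e → Detour F e)) ⊎
                    (v ≡ 0 × ¬ Pass f)

      test : ∀ {σ} → Ok σ → Env σ → arrays σ 4 ≡ c → arrays σ 5 ≡ D → Marked W (arrays σ 6) → Verdict 0 (regs σ 13) →
             Reach (for 11 4 testBody) σ (6 + W * (8 + testTime)) (λ σ′ → Verdict W (regs σ′ 13))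
      test {σ₀} ok env c≡ D≡ marked v = iterate 11 4 refl refl (λ k σ → Verdict k (regs σ 13)) step ok (W≡ env) v
        where
        step : ∀ {σ} → Ok σ → Agree (for 11 4 testBody) σ₀ σ → regs σ 11 < W → Verdict (regs σ 11) (regs σ 13) →
               Reach testBody σ testTime (λ σ′ → Verdict (suc (regs σ 11)) (regs σ′ 13))
        step {σ} ok ag j<W inv with valid j<W
        ... | e , e≡ =
          straight queryHead {Q = λ σ′ → regs σ′ 15 ≡ tolerance e × applyUpTo (arrays σ′ 7) 4 ≡ toℕ u ∷ toℕ v′ ∷ n ∷ m ∷ []}
            ok (tolerance-value {_} {14} {e} env₁ e≡₁ , cong₂ _∷_ (source-value {_} {14} {e} env₁ e≡₁)
              (cong₂ _∷_ (target-value {_} {14} {e} env₁ e≡₁) (cong₂ (λ x y → x ∷ y ∷ []) (n≡ env₁) (m≡ env₁))))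
          then λ ok₂ ag₂ (t≡ , head≡) →
          query ok₂ (keepEnv ag₂ env₀) (λ {i} lt → trans (cong (λ a → a i) (trans (keepArray ag₂ 6) (keepArray ag 6))) (marked lt)) t≡ head≡
          then λ {σ₃} ok₃ ag₃ code≡ →
          let env₃ = keepEnv ag₃ (keepEnv ag₂ env₀) in
          invoke registerDegree arrayDegree M B 2≤M enough (entry-small registerDegrees) (entry-small arrayDegrees)
            -- `queryLength` has degree 5, so `invoke` needs the base `M ^ (2 + 6)`; this is the 8
            -- in `fits-S`.
            {d = 5} {k = wordExponent S} {Q = λ σ′ → arrays σ′ 8 0 ≡ encodeMaybe answer′}
            _ tt tt refl fits-S ok₃
            (trans (cong (λ z → applyUpTo (arrays σ₃ 7) (4 + z * 3)) (m≡ env₃)) code≡)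
            (runs S q) (fast q) (answer≡ (arrays σ₃ 8))
          then λ {σ₄} ok₄ ag₄ a≡ →
          let t≡₄ = trans (keepReg ag₄ 15) (trans (keepReg ag₃ 15) t≡)
              v≡₄ = trans (keepReg ag₄ 13) (trans (keepReg ag₃ 13) (keepReg ag₂ 13))
          in branch (op less (reg 15) (op monus (cell 8 (lit 0)) (lit 1))) ok₄
            (λ l → straight (13 ≔ lit 0) ok₄ (inj₂ (refl , λ (_ , detours) →
              far shortest (subst₂ (λ x y → x < y ∸ 1) t≡₄ a≡ (less≢0 l)) (detours e j<W (sym e≡)))))
            (λ l → straight skip ok₄ (subst (Verdict (suc (regs σ 11))) (sym v≡₄)
              (extend (near shortest (subst₂ (λ x y → y ∸ 1 ≤ x) t≡₄ a≡ (less≡0 l))) inv)))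
          where
          u = proj₁ (ends e)
          v′ = proj₂ (ends e)
          t = tolerance e
          q = record { network = reweigh N F t ; source = u ; target = v′ }
          answer′ = proj₁ (correct S q)
          shortest = proj₁ (proj₂ (correct S q))
          answer≡ : ∀ a → overwrite (answer S q) a 0 ≡ encodeMaybe answer′
          answer≡ a = cong (λ l → overwrite l a 0) (proj₂ (proj₂ (correct S q)))
          env₀ = keepEnv ag env
          σ₁ = setReg 14 (arrays σ 4 (arrays σ 5 (regs σ 11))) σ
          env₁ : Env σ₁
          env₁ = record { n≡ = n≡ env₀ ; m≡ = m≡ env₀ ; W≡ = W≡ env₀ ; a≡ = a≡ env₀ ; b≡ = b≡ env₀ ; input≡ = input≡ env₀ }
          e≡₁ : regs σ₁ 14 ≡ toℕ e
          e≡₁ = trans (cong₂ (λ g h → g (h (regs σ 11))) (trans (keepArray ag 4) c≡) (trans (keepArray ag 5) D≡)) (sym e≡)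
          open Reweigh N F t
          open Walks N′ using () renaming (edgePath to edgePath′)
          -- The threshold is the tolerance of `e`: every path of the reweighted network that leaves
          -- `F` is too long to count as a detour, so its distance decides whether `F` contains one.
          far : ∀ {d} → Shortest (reweigh N F t) u v′ d → t < encodeMaybe d ∸ 1 → ¬ Detour F e
          far (some (_ , least)) lt (p , le) with restricted⇒reweighed p
          ... | p′ , eq = <⇒≱ lt (≤-trans (least p′) (≤-trans (≤-reflexive eq) le))
          -- The code 0 of an unreachable pair would also pass the comparison, but it cannot occur:
          -- the reweighted network still contains `e`.
          near : ∀ {d} → Shortest (reweigh N F t) u v′ d → encodeMaybe d ∸ 1 ≤ t → Detour F e
          near (none no-path) _ = ⊥-elim (no-path (edgePath′ e ∈⊤))
          near (some ((p , refl) , _)) le with reweighed⇒restricted p le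
          ... | p′ , eq = p′ , subst (_≤ t) (sym eq) le
          extend : Detour F e → ∀ {v} → Verdict (regs σ 11) v → Verdict (suc (regs σ 11)) v
          extend d (inj₂ fail) = inj₂ fail
          extend d (inj₁ (v≡ , w , ds)) = inj₁ (v≡ , w , lemma)
            where
            lemma : ∀ e′ {j} → j < suc (regs σ 11) → f j ≡ toℕ e′ → Detour F e′
            lemma e′ {j} j<k eq with m≤n⇒m<n∨m≡n (≤-pred j<k)
            ... | inj₁ lt   = ds e′ lt eq
            ... | inj₂ refl = subst (Detour F) (toℕ-injective (trans e≡ eq)) d

      check : ∀ {σ} → Ok σ → Env σ → arrays σ 4 ≡ c → arrays σ 5 ≡ D →
              Reach checkBody σ checkTime (λ σ′ → Marked W (arrays σ′ 6) × Verdict W (regs σ′ 13))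
      check ok env c≡ D≡ =
        markAll ok env then λ ok₁ ag₁ marked₁ →
        let env₁ = keepEnv ag₁ env in
        mark ok₁ env₁ (trans (keepArray ag₁ 4) c≡) (trans (keepArray ag₁ 5) D≡) marked₁ then λ ok₂ ag₂ marked₂ →
        let env₂ = keepEnv ag₂ env₁ in
        straight (12 ≔ reg 4) {Q = λ σ′ → regs σ′ 12 ≡ W} ok₂ (W≡ env₂) then λ {σ₃} ok₃ ag₃ W≡₃ →
        let env₃ = keepEnv ag₃ env₂
            marked₃ = λ {i} (lt : i < m) → trans (cong (λ a → a i) (keepArray ag₃ 6)) (marked₂ lt) in
        rest ok₃ env₃ marked₃ W≡₃ then λ {σ₄} ok₄ ag₄ rest≡ →
        let env₄ = keepEnv ag₄ env₃
            marked₄ = λ {i} (lt : i < m) → trans (cong (λ a → a i) (keepArray ag₄ 6)) (marked₃ lt) in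
        straight (13 ≔ op equal (reg 12) (lit 0)) {Q = λ σ′ → Verdict 0 (regs σ′ 13)} ok₄ (verdict₀ rest≡) then λ ok₅ ag₅ v →
        let marked₅ = λ {i} (lt : i < m) → trans (cong (λ a → a i) (keepArray ag₅ 6)) (marked₄ lt) in
        consequence (test ok₅ (keepEnv ag₅ env₄)
            (trans (keepArray ag₅ 4) (trans (keepArray ag₄ 4) (trans (keepArray ag₃ 4) (trans (keepArray ag₂ 4) (trans (keepArray ag₁ 4) c≡)))))
            (trans (keepArray ag₅ 5) (trans (keepArray ag₄ 5) (trans (keepArray ag₃ 5) (trans (keepArray ag₂ 5) (trans (keepArray ag₁ 5) D≡)))))
            (λ {i} lt → marked₅ {i} lt) v)
          (λ _ ag₆ verdict → (λ {i} lt → trans (cong (λ a → a i) (keepArray ag₆ 6)) (marked₅ lt)) , verdict)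
        where
        verdict₀ : ∀ {x} → x ≡ W ∸ totalWeight (∁ F) → Verdict 0 (fromBool (x ≡ᵇ 0))
        verdict₀ {zero}  eq = inj₁ (refl , m∸n≡0⇒m≤n (sym eq) , λ _ ())
        verdict₀ {suc x} eq = inj₂ (refl , λ (w , _) → 0≢1+n (sym (trans eq (m≤n⇒m∸n≡0 w))))

    -- The invariant of adding 1 with a ripple carry: the digits of `E` below `k` are already
    -- updated, the others are still those of `D`, and the carry counts at position `k`.
    record Counted (b : ℕ) (D : ℕ → ℕ) (k : ℕ) (E : ℕ → ℕ) (carry : ℕ) : Set where
      field
        digits : ∀ {j} → j < k → E j < b
        later  : ∀ {j} → k ≤ j → E j ≡ D j
        total  : number b E k + carry * b ^ k ≡ suc (number b D k)
        bit    : carry ≤ 1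
    open Counted

    count-step : ∀ {b D k E carry} → D k < b → Counted b D k E carry →
                 Counted b D (suc k) (update k (applyOp rem (E k + carry) b) E) (fromBool (b ∸ 1 <ᵇ E k + carry))
    count-step {b} {D} {k} {E} {c} Dk<b cnt = record
      { digits = digits′ ; later = later′ ; total = total′ ; bit = fromBool≤1 (b ∸ 1 <ᵇ x) }
      where
      x = E k + c
      r = applyOp rem x b
      E′ = update k r E
      x≤b : x ≤ b
      x≤b = ≤-trans (≤-trans (≤-reflexive (+-comm (E k) c)) (+-mono-≤ (bit cnt) (≤-reflexive (later cnt ≤-refl)))) Dk<b
      rc = digit-carry x b (≤-trans (s≤s z≤n) Dk<b) x≤b
      old : ∀ {j} → k ≢ j → E′ j ≡ E j
      old = update-≢ k E
      digits′ : ∀ {j} → j < suc k → E′ j < b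
      digits′ {j} lt with m≤n⇒m<n∨m≡n (≤-pred lt)
      ... | inj₁ lt′  = subst (_< b) (sym (old (λ eq → <⇒≢ lt′ (sym eq)))) (digits cnt lt′)
      ... | inj₂ refl = subst (_< b) (sym (update-at k E)) (proj₁ rc)
      later′ : ∀ {j} → suc k ≤ j → E′ j ≡ D j
      later′ lt = trans (old (<⇒≢ lt)) (later cnt (<⇒≤ lt))
      c′ = fromBool (b ∸ 1 <ᵇ x)
      total′ : number b E′ k + E′ k * b ^ k + c′ * (b * b ^ k) ≡ suc (number b D k + D k * b ^ k)
      total′ = begin
        number b E′ k + E′ k * b ^ k + c′ * (b * b ^ k)
          ≡⟨ cong₂ (λ y z → y + z * b ^ k + c′ * (b * b ^ k))
               (number-cong b k (λ lt → old (λ eq → <⇒≢ lt (sym eq)))) (update-at k E) ⟩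
        number b E k + r * b ^ k + c′ * (b * b ^ k)
          ≡⟨ carry-over (number b E k) r c′ b (b ^ k) ⟩
        number b E k + (r + c′ * b) * b ^ k
          ≡⟨ cong (λ y → number b E k + y * b ^ k) (trans (proj₂ rc) (cong (_+ c) (later cnt ≤-refl))) ⟩
        number b E k + (D k + c) * b ^ k
          ≡⟨ regroup (number b E k) (D k) c (b ^ k) ⟩
        number b E k + c * b ^ k + D k * b ^ k
          ≡⟨ cong (_+ D k * b ^ k) (total cnt) ⟩
        suc (number b D k + D k * b ^ k)
          ∎
        where
        open ≡-Reasoning
        carry-over : ∀ x r c b p → x + r * p + c * (b * p) ≡ x + (r + c * b) * p
        carry-over = solve-∀
        regroup : ∀ x d c p → x + (d + c) * p ≡ x + c * p + d * p
        regroup = solve-∀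

    odometer : ∀ {σ b D} → Ok σ → Env σ → regs σ 9 ≡ b → arrays σ 5 ≡ D → (∀ {j} → j < W → D j < b) → regs σ 16 ≡ 1 →
               Reach (for 11 4 odometerBody) σ (6 + W * (8 + duration odometerBody))
                 (λ σ′ → Counted b D W (arrays σ′ 5) (regs σ′ 16))
    odometer {σ₀} {b} {D} ok env b≡ D≡ valid c≡ = iterate 11 4 refl refl (λ k σ → Counted b D k (arrays σ 5) (regs σ 16))
      (λ {σ} ok ag lt inv → straight odometerBody ok
        (subst (λ z → Counted b D (suc (regs σ 11)) (update (regs σ 11) (applyOp rem (arrays σ 5 (regs σ 11) + regs σ 16) z) (arrays σ 5))
                        (fromBool (z ∸ 1 <ᵇ arrays σ 5 (regs σ 11) + regs σ 16)))
          (sym (trans (keepReg ag 9) b≡)) (count-step {carry = regs σ 16} (valid lt) inv)))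
      ok (W≡ env) record { digits = λ () ; later = λ {j} _ → cong (λ a → a j) D≡ ; total = trans (*-identityʳ _) c≡ ; bit = ≤-reflexive c≡ }

    keep-cong : ∀ {f g : ℕ → ℕ} k e → (∀ {j} → j < k → f j ≡ g j) → keep f k e ≡ keep g k e
    keep-cong zero    e eq = refl
    keep-cong (suc k) e eq = cong₂ (λ x y → if x ≡ᵇ e then false else y) (eq ≤-refl) (keep-cong k e (eq ∘ m≤n⇒m≤1+n))

    -- Tuples are functions on all of `ℕ` that are compared only below `W`; passing depends on those
    -- values alone, as they determine the subset `remaining`.
    pass-cong : ∀ {f g} → (∀ {j} → j < W → f j ≡ g j) → Pass f → Pass g
    pass-cong {f} {g} eq (w , d) = subst (λ F → W ≤ totalWeight (∁ F)) same w ,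
      λ e j<W h → subst (λ F → Detour F e) same (d e j<W (trans (eq j<W) h))
      where
      same : remaining f ≡ remaining g
      same = Vec.tabulate-cong (λ e → keep-cong W (toℕ e) eq)

    module Enumeration (c : ℕ → ℕ) (b : ℕ) (edge : ∀ {j} → j < b → Σ[ e ∈ Fin m ] toℕ e ≡ c j) where

      Valid : (ℕ → ℕ) → Set
      Valid D = ∀ {j} → j < W → D j < b

      -- While `searching`, the fuel `k` is the number of tuples from the current one on. It cannot
      -- be 0, since the number of a valid tuple is below `b ^ W`. The other two states have cleared
      -- register 17, which ends the loop whatever `k` is.
      data State (k : ℕ) (σ : Store) : Set where
        searching : regs σ 17 ≡ 1 → regs σ 18 ≡ 0 → Valid (arrays σ 5) → k + number b (arrays σ 5) W ≡ b ^ W →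
                    (∀ D → Valid D → number b D W < number b (arrays σ 5) W → ¬ Pass (c ∘ D)) → State k σ
        found  : regs σ 17 ≡ 0 → regs σ 18 ≡ 1 → ∀ f → Pass f →
                 (∀ {i} → i < m → arrays σ 6 i ≡ fromBool (keep f W i)) → State k σ
        absent : regs σ 17 ≡ 0 → regs σ 18 ≡ 0 → (∀ D → Valid D → ¬ Pass (c ∘ D)) → State k σ

      enumerate : ∀ {k σ} → Ok σ → Env σ → regs σ 9 ≡ b → arrays σ 4 ≡ c → State k σ →
               Reach (while (reg 17) whileBody) σ (2 + k * (2 + bodyTime)) (λ σ′ → regs σ′ 17 ≡ 0 × ∃[ k′ ] State k′ σ′)
      enumerate {σ = σ₀} ok env b≡ c≡ = whilst (reg 17) State step ok
        where
        step : ∀ {k σ} → Ok σ → Agree (while (reg 17) whileBody) σ₀ σ → State k σ → regs σ 17 ≢ 0 →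
               ∃[ k′ ] k ≡ suc k′ × Reach whileBody σ bodyTime (State k′)
        step ok ag (found go _ _ _ _) ne = ⊥-elim (ne go)
        step ok ag (absent go _ _) ne = ⊥-elim (ne go)
        step {zero} {σ} ok ag (searching _ _ valid num _) ne = ⊥-elim (<⇒≢ (number< b W valid) num)
        step {suc k} {σ} ok ag (searching go new valid num before) ne = k , refl ,
          (check ok env₀ (trans (keepArray ag 4) c≡) refl then λ {σ₁} ok₁ ag₁ (marked , verdict) →
            branch (reg 13) ok₁
              (λ ok≢0 → straight (18 ≔ lit 1 ⨾ 17 ≔ lit 0) ok₁ (found refl refl (c ∘ D) (passed ok≢0 verdict) marked))
              (λ ok≡0 → straight (16 ≔ lit 1) {Q = λ σ′ → regs σ′ 16 ≡ 1} ok₁ refl then λ ok₂ ag₂ c≡₂ →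
                odometer ok₂ (keepEnv ag₂ (keepEnv ag₁ env₀))
                  (trans (keepReg ag₂ 9) (trans (keepReg ag₁ 9) (trans (keepReg ag 9) b≡)))
                  (trans (keepArray ag₂ 5) (keepArray ag₁ 5)) valid c≡₂ then λ {σ₃} ok₃ ag₃ cnt →
                straight (17 ≔ op monus (lit 1) (reg 16)) ok₃
                  (next cnt (trans (keepReg ag₃ 18) (trans (keepReg ag₂ 18) (trans (keepReg ag₁ 18) new)))
                    (failed ok≡0 verdict))))
          where
          D = arrays σ 5
          env₀ = keepEnv ag env
          open Tuple c D (edge ∘ valid)
          passed : ∀ {v} → v ≢ 0 → Verdict W v → Pass (c ∘ D)
          passed ne (inj₁ (_ , w , d)) = w , d
          passed ne (inj₂ (z , _)) = ⊥-elim (ne z)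
          failed : ∀ {v} → v ≡ 0 → Verdict W v → ¬ Pass (c ∘ D)
          failed z (inj₁ (o , _)) = ⊥-elim (0≢1+n (trans (sym z) o))
          failed z (inj₂ (_ , fail)) = fail
          next : ∀ {σ′} → Counted b D W (arrays σ′ 5) (regs σ′ 16) → regs σ′ 18 ≡ 0 → ¬ Pass (c ∘ D) →
                 State k (setReg 17 (1 ∸ regs σ′ 16) σ′)
          next {σ′} cnt new′ fail with regs σ′ 16 | bit cnt | total cnt
          ... | 0 | _ | tot = searching refl new′ (digits cnt) num′ before′
            where
            num≡ : number b (arrays σ′ 5) W ≡ suc (number b D W)
            num≡ = trans (sym (+-identityʳ _)) tot
            num′ = trans (cong (k +_) num≡) (trans (+-suc k _) num)
            before′ : ∀ D′ → Valid D′ → number b D′ W < number b (arrays σ′ 5) W → ¬ Pass (c ∘ D′)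
            before′ D′ valid′ lt with m≤n⇒m<n∨m≡n (≤-pred (subst (number b D′ W <_) num≡ lt))
            ... | inj₁ lt′ = before D′ valid′ lt′
            ... | inj₂ eq = fail ∘ pass-cong (λ j<W → cong c (number-injective b W valid′ valid eq j<W))
          -- A carry out of the last digit means that the odometer has wrapped around: the current
          -- tuple had the largest number, so every tuple has been tried.
          ... | 1 | _ | tot = absent refl new′ λ D′ valid′ → tried D′ valid′ (m≤n⇒m<n∨m≡n
                (≤-pred (≤-trans (number< b W valid′) last)))
            where
            last : b ^ W ≤ suc (number b D W)
            last = ≤-trans (≤-trans (≤-reflexive (sym (+-identityʳ (b ^ W)))) (m≤n+m _ (number b (arrays σ′ 5) W)))
                           (≤-reflexive tot)
            tried : ∀ D′ → Valid D′ → (number b D′ W < number b D W) ⊎ (number b D′ W ≡ number b D W) → ¬ Pass (c ∘ D′)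
            tried D′ valid′ (inj₁ lt) = before D′ valid′ lt
            tried D′ valid′ (inj₂ eq) = fail ∘ pass-cong (λ j<W → cong c (number-injective b W valid′ valid eq j<W))
          ... | suc (suc _) | s≤s () | _

-- Register 9 turns from remaining room into the number of candidates. The search starts if there is
-- one, or if `W` is 0, where the empty tuple must still be tested; for positive `W` without
-- candidates, 0 would not be a valid digit. The output has length `1 + v * m` for the success flag
-- `v`, which is 1 on failure.
startup outputBody writeOutput : Program
startup = 9 ≔ op monus (reg 8) (reg 9) ⨾ 17 ≔ op less (lit 0) (op add (reg 9) (op less (reg 4) (lit 1)))
outputBody = 1 [ op add (lit 1) (reg 10) ]≔ cell 6 (reg 10)
writeOutput = 1 [ lit 0 ]≔ reg 18 ⨾ for 10 3 outputBody ⨾ 1 ≔ op add (lit 1) (op mul (reg 18) (reg 3))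

networkLength : Expr
networkLength = op add (lit 2) (op mul (reg 3) (lit 3))

-- Absorbing overheads into the running times

-- Wrapping the inequalities in records lets Agda infer the constants.
module Linear (m r : ℕ) (m<r : m < r) where

  infix 4 _≲_
  record _≲_ (x c : ℕ) : Set where
    constructor at-most
    field bound : x ≤ c * r
  open _≲_ public

  infixr 5 _⊕_
  _⊕_ : ∀ {x y c d} → x ≲ c → y ≲ d → x + y ≲ c + d
  _⊕_ {c = c} {d} (at-most p) (at-most q) = at-most (≤-trans (+-mono-≤ p q) (≤-reflexive (sym (*-distribʳ-+ r c d))))

  constant : ∀ c → c ≲ c
  constant c = at-most (≤-trans (m≤m*n c (suc m)) (*-monoʳ-≤ c m<r))

  single : ∀ {x} → x ≤ r → x ≲ 1
  single x≤r = at-most (≤-trans x≤r (≤-reflexive (sym (*-identityˡ r))))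

  times-m : ∀ d → m * d ≲ d
  times-m d = at-most (≤-trans (≤-reflexive (*-comm m d)) (*-monoʳ-≤ d (<⇒≤ m<r)))

  edge-loop : ∀ d → 6 + m * (8 + d) ≲ 6 + (8 + d)
  edge-loop d = constant 6 ⊕ times-m (8 + d)

  call-bound : ∀ {x} → x ≤ r → 6 + x ≲ 7
  call-bound x≤r = constant 6 ⊕ single x≤r

  first≲ : ∀ {x} d₁ d₂ d₃ d₄ d₅ → x ≤ r →
    d₁ + ((6 + m * (8 + d₂)) + (d₃ + ((6 + m * (8 + d₄)) + (6 + x + (6 + m * (8 + d₅)))))) ≲
    d₁ + ((14 + d₂) + (d₃ + ((14 + d₄) + (7 + (14 + d₅)))))
  first≲ d₁ d₂ d₃ d₄ d₅ x≤ = constant d₁ ⊕ edge-loop d₂ ⊕ constant d₃ ⊕ edge-loop d₄ ⊕ call-bound x≤ ⊕ edge-loop d₅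

  second≲ : ∀ {x c} d₁ d₂ → x ≲ c →
    d₁ + ((2 + x) + (3 + ((6 + m * (8 + d₂)) + 6))) ≲ d₁ + ((2 + c) + (3 + ((14 + d₂) + 6)))
  second≲ d₁ d₂ x≲ = constant d₁ ⊕ (constant 2 ⊕ x≲) ⊕ constant 3 ⊕ edge-loop d₂ ⊕ constant 6

  io≲ : ∀ {x c y} → x ≲ c → y ≤ suc m → (5 + m * 4) + (x + 2) + y ≲ (5 + 4) + (c + 2) + 1
  io≲ x≲ y≤ = ((constant 5 ⊕ times-m 4) ⊕ (x≲ ⊕ constant 2)) ⊕ single (≤-trans y≤ m<r)

-- Here `q` is the time of a single-pair query. Costs linear in `m` are kept apart from costs of `W`
-- queries, because for `W = 0` the latter vanish and cannot absorb the former.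
module TupleBounds (m W q : ℕ) (m<q : m < q) where

  infix 4 _≲_,_
  record _≲_,_ (x c d : ℕ) : Set where
    constructor at-most₂
    field bound₂ : x ≤ c * suc m + W * (d * q)
  open _≲_,_ public

  infixr 5 _⊞_
  _⊞_ : ∀ {x y c c′ d d′} → x ≲ c , d → y ≲ c′ , d′ → x + y ≲ c + c′ , d + d′
  _⊞_ {c = c} {c′} {d} {d′} (at-most₂ p) (at-most₂ r) =
    at-most₂ (≤-trans (+-mono-≤ p r) (≤-reflexive (regroup c c′ d d′ (suc m) W q)))
    where
    regroup : ∀ c c′ d d′ s w q → c * s + w * (d * q) + (c′ * s + w * (d′ * q)) ≡ (c + c′) * s + w * ((d + d′) * q)
    regroup = solve-∀

  module L = Linear m (suc m) ≤-refl
  module Q = Linear m q m<q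

  linear : ∀ {x c} → x L.≲ c → x ≲ c , 0
  linear (L.at-most x≤) = at-most₂ (≤-trans x≤ (m≤m+n _ _))

  tuple-loop : ∀ {x d} → x Q.≲ d → 6 + W * (8 + x) ≲ 6 , 8 + d
  tuple-loop x≲ = at-most₂ (+-mono-≤ (m≤m*n 6 (suc m)) (*-monoʳ-≤ W (Q.bound (Q.constant 8 Q.⊕ x≲))))

  test≲ : ∀ d₁ d₂ d₃ → d₁ + ((6 + m * (8 + d₂)) + (6 + q + d₃)) Q.≲ d₁ + ((14 + d₂) + (7 + d₃))
  test≲ d₁ d₂ d₃ = Q.constant d₁ Q.⊕ Q.edge-loop d₂ Q.⊕ Q.call-bound ≤-refl Q.⊕ Q.constant d₃

  check≲ : ∀ {x d} d₁ d₂ d₃ → x Q.≲ d →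
    (6 + m * (8 + d₁)) + ((6 + W * (8 + d₂)) + (2 + ((6 + m * (8 + d₃)) + (4 + (6 + W * (8 + x)))))) ≲
    (14 + d₁) + (6 + (2 + ((14 + d₃) + 10))) , (8 + d₂) + (8 + d)
  check≲ d₁ d₂ d₃ x≲ = linear (L.edge-loop d₁) ⊞ tuple-loop (Q.constant d₂) ⊞ linear (L.constant 2) ⊞
    linear (L.edge-loop d₃) ⊞ linear (L.constant 4) ⊞ tuple-loop x≲

  advance≲ : ∀ d → 2 + ((6 + W * (8 + d)) + 4) ≲ 12 , (8 + d) + 0
  advance≲ d = linear (L.constant 2) ⊞ tuple-loop (Q.constant d) ⊞ linear (L.constant 4)

  body≲ : ∀ {x y c d c′ d′} → x ≲ c , d → y ≲ c′ , d′ → x + (2 + (4 + y)) ≲ c + (2 + (4 + c′)) , d + d′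
  body≲ x≲ y≲ = x≲ ⊞ linear (L.constant 2) ⊞ linear (L.constant 4) ⊞ y≲

  -- For positive `W` the linear part is at most `W * q`. For `W = 0` there is a single round, whose
  -- linear part is charged to `r`, which will be the all-pairs time.
  iterations≤ : ∀ {x c d r b} → x ≲ c , d → m < r → b ^ W * (2 + x) ≤ (2 + c + d) * (r + b ^ W * W * q)
  iterations≤ {x} {c} {d} {r} {b} (at-most₂ x≤) m<r with W ≟ 0
  ... | yes refl = begin
    1 * (2 + x)                        ≡⟨ *-identityˡ (2 + x) ⟩
    2 + x                              ≤⟨ +-mono-≤ (m≤m*n 2 (suc m)) (≤-trans x≤ (≤-reflexive (+-identityʳ _))) ⟩
    2 * suc m + c * suc m              ≡⟨ sym (*-distribʳ-+ (suc m) 2 c) ⟩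
    (2 + c) * suc m                    ≤⟨ *-mono-≤ (m≤m+n (2 + c) d) (≤-trans m<r (m≤m+n r _)) ⟩
    (2 + c + d) * (r + 1 * 0 * q)      ∎
    where open ≤-Reasoning
  ... | no W≢0 = begin
    P * (2 + x)                        ≤⟨ *-monoʳ-≤ P (+-mono-≤ (m≤m*n 2 (suc m)) x≤) ⟩
    P * (2 * suc m + (c * suc m + W * (d * q)))
                                       ≡⟨ regroup P c d (suc m) W q ⟩
    P * ((2 + c) * suc m + d * (W * q))
                                       ≤⟨ *-monoʳ-≤ P (+-monoˡ-≤ _ (*-monoʳ-≤ (2 + c) (≤-trans m<q (m≤n*m q W {{≢-nonZero W≢0}})))) ⟩
    P * ((2 + c) * (W * q) + d * (W * q))
                                       ≡⟨ factor P c d W q ⟩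
    (2 + c + d) * (P * W * q)          ≤⟨ *-monoʳ-≤ (2 + c + d) (m≤n+m _ r) ⟩
    (2 + c + d) * (r + P * W * q)      ∎
    where
    open ≤-Reasoning
    P = b ^ W
    regroup : ∀ p c d s w q → p * (2 * s + (c * s + w * (d * q))) ≡ p * ((2 + c) * s + d * (w * q))
    regroup = solve-∀
    factor : ∀ p c d w q → p * ((2 + c) * (w * q) + d * (w * q)) ≡ (2 + c + d) * (p * w * q)
    factor = solve-∀

-- The shape repeats that of the estimates above: 14 is the overhead 6 + 8 of a loop over the edges,
-- and 7 is the overhead 6 of a call plus one multiple of the time of the callee.
testBound bodyLinear bodyTuples iterationBound firstBound secondBound : ℕ
testBound = duration queryHead + ((14 + duration queryBody) + (7 + duration testAnswer))
bodyLinear = ((14 + duration markAllBody) + (6 + (2 + ((14 + duration restBody) + 10)))) + (2 + (4 + 12))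
bodyTuples = ((8 + duration markBody) + (8 + testBound)) + ((8 + duration odometerBody) + 0)
iterationBound = 2 + bodyLinear + bodyTuples
firstBound = duration readParameters + ((14 + duration lengthBody) + (duration prepare + ((14 + duration copyBody) +
               (7 + (14 + duration candidateBody)))))
secondBound = duration startup + ((2 + iterationBound) + (3 + ((14 + duration outputBody) + 6)))

-- The whole program

overwrite≤max : ∀ xs i → overwrite xs (λ _ → 0) i ≤ foldr _⊔_ 0 xs
overwrite≤max []       i       = z≤n
overwrite≤max (x ∷ xs) zero    = m≤m⊔n x _
overwrite≤max (x ∷ xs) (suc i) = ≤-trans (overwrite≤max xs i) (m≤n⊔m x _)

toList-tabulate : ∀ {k} (g : ℕ → ℕ) (h : Fin k → Bool) → (∀ e → g (toℕ e) ≡ fromBool (h e)) →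
                  applyUpTo g k ≡ map fromBool (Vec.toList (Vec.tabulate h))
toList-tabulate {zero}  g h eq = refl
toList-tabulate {suc k} g h eq = cong₂ _∷_ (eq zero) (toList-tabulate (g ∘ suc) (h ∘ suc) (eq ∘ suc))

module Solver (S : Algorithm singlePair) (A : Algorithm allPairsTwo) where
  open Tests S

  firstHalf secondHalf : Program
  firstHalf = readParameters ⨾ for 10 3 lengthBody ⨾ prepare ⨾ for 10 3 copyBody ⨾
              call (program A) 2 networkLength 3 ⨾ for 10 3 candidateBody
  secondHalf = startup ⨾ while (reg 17) whileBody ⨾ writeOutput

  module Run (spsp apsp₂ : ℕ → ℕ → ℕ)
             (fast-S : ∀ i → time S i ≤ spsp (Network.n (PairQuery.network i)) (Network.m (PairQuery.network i)))
             (fast-A : ∀ N → time A N ≤ apsp₂ (Network.n N) (Network.m N))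
             (I : Instance) (M B : ℕ) (2≤M : 2 ≤ M) (enough : M ^ maxDegree ≤ B)
             (fits-S : (M ^ 8) ^ wordExponent S ≤ B) (fits-A : (M ^ 8) ^ wordExponent A ≤ B)
             (length≤M : length (Instance.encodeInstance I) ≤ M)
             (entries≤M : ∀ i → overwrite (Instance.encodeInstance I) (λ _ → 0) i ≤ M) where

    open Instance I
    open Solutions (distanceOracle S) I
    open Verification (distanceOracle S) I M B 2≤M enough
    open Checking I M B 2≤M enough fits-S spsp fast-S

    cap : ℕ → ℕ
    cap L = 4 * W * (numα * L / denα)

    -- `count` and `L` survive for the time analysis. The first output cell is recorded separately
    -- because the decision version truncates the output to it.
    record Outcome (σ : Store) : Set where
      field
        count L : ℕ
        light : Light m L
        count≤cap : count ≤ cap L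
        count≤m   : count ≤ m
        verdict   : (∃[ F ] Witness F × output σ ≡ 1 ∷ map fromBool (Vec.toList F) × arrays σ 1 0 ≡ 1) ⊎
                    (¬ ∃ Witness × output σ ≡ 0 ∷ [] × arrays σ 1 0 ≡ 0)

    initial-ok : Ok (initial encodeInstance)
    initial-ok = setReg-ok {setArray 0 input (store (λ _ → 0) (λ _ _ → 0))} 0
      (≤-trans length≤M (≤-reflexive (sym (^-identityʳ M))))
      (setArray-ok {store (λ _ → 0) (λ _ _ → 0)} 0
        (λ i → ≤-trans (entries≤M i) (≤-reflexive (sym (^-identityʳ M)))) ((λ _ → z≤n) , λ _ _ → z≤n))

    write-output : ∀ {σ v} → Ok σ → Env σ → regs σ 18 ≡ v →
                   Reach writeOutput σ (3 + ((6 + m * (8 + duration outputBody)) + 6))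
                     (λ σ′ → arrays σ′ 1 0 ≡ v × (∀ {i} → i < m → arrays σ′ 1 (suc i) ≡ arrays σ 6 i) × regs σ′ 1 ≡ 1 + v * m)
    write-output {σ₀} {v} ok env v≡ =
      straight (1 [ lit 0 ]≔ reg 18) {Q = λ σ′ → arrays σ′ 1 0 ≡ v} ok v≡ then λ {σ₁} ok₁ ag₁ a≡ →
      let env₁ = keepEnv ag₁ env in
      iterate 10 3 refl refl (λ k σ → arrays σ 1 0 ≡ v × (∀ {i} → i < k → arrays σ 1 (suc i) ≡ arrays σ₀ 6 i))
        (λ {σ} ok ag lt (z , inv) → straight outputBody ok (z , λ {i} → copied {arrays σ 1 ∘ suc} (regs σ 10) inv
          (cong (λ a → a (regs σ 10)) (trans (keepArray ag 6) (keepArray ag₁ 6))) i))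
        ok₁ (m≡ env₁) (a≡ , λ ()) then λ ok₂ ag₂ (z , inv) →
      straight (1 ≔ op add (lit 1) (op mul (reg 18) (reg 3))) ok₂
        (z , inv , cong suc (cong₂ _*_ (trans (keepReg ag₂ 18) (trans (keepReg ag₁ 18) v≡)) (m≡ (keepEnv ag₂ env₁))))
      where
      copied : ∀ {a : ℕ → ℕ} k → (∀ {i} → i < k → a i ≡ arrays σ₀ 6 i) → ∀ {y} → y ≡ arrays σ₀ 6 k →
               ∀ i → i < suc k → update k y a i ≡ arrays σ₀ 6 i
      copied {a} k inv eq i lt with m≤n⇒m<n∨m≡n (≤-pred lt)
      ... | inj₁ lt′  = trans (update-≢ k a (λ eq → <⇒≢ lt′ (sym eq))) (inv lt′)
      ... | inj₂ refl = trans (update-at k a) eq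

    D = proj₁ (correct A N)
    open Candidates D (proj₁ (proj₂ (correct A N)))

    module Finish {L room c} (light : Light m L) (col : Collected (cap L) m room c) where

      ys : List (Σ (Fin m) Candidate)
      ys = list col

      b : ℕ
      b = cap L ∸ room

      b≡length : b ≡ length ys
      b≡length = trans (cong (_∸ room) (sym (count col))) (m+n∸m≡n room (length ys))

      listed : applyUpTo c b ≡ map toℕ (map proj₁ ys)
      listed = trans (cong (applyUpTo c) b≡length) (trans (stored col) (map-∘ ys))

      b≤m : b ≤ m
      b≤m = subst₂ _≤_ (trans (length-map proj₁ ys) (sym b≡length)) (length-tabulate {n = m} (λ e → e))
              (unique-length (unique col) (λ {e} _ → ∈-allFin e))

      edge : ∀ {j} → j < b → ∃[ e ] toℕ e ≡ c j
      edge j<b with ∈-map⁻ toℕ (subst (_ ∈ˡ_) listed (∈-applyUpTo⁺ c j<b))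
      ... | e , _ , eq = e , sym eq

      t : ℕ
      t = numα * L / denα

      -- A list with room left contains all candidates, among them the edges that the spanner omits
      -- and that have positive weight. A full list has `cap L = 4 * W * t` entries, enough to
      -- select a removal from the list itself.
      removal : ∀ {F} → Witness F → Removal (_∈ˡ map proj₁ ys)
      removal w with complete col
      ... | inj₂ all  = witness⇒removal w (λ {e} → all e (toℕ<n e))
      ... | inj₁ refl = many⇒removal t (1≤α⇒1≤/ α 1≤α (1≤L light)) (λ e light′ → /-monoˡ-≤ denα (*-monoʳ-≤ numα (covers light e (toℕ<n e) light′)))
                          ys (unique col) (λ e∈ → e∈) (≤-reflexive (sym (count col)))

      open Enumeration c b edge public

      complete′ : (∀ D → Valid D → ¬ Pass (c ∘ D)) → ¬ ∃ Witness
      complete′ fail (F , w) with removal⇒pass c b (λ e∈ → subst (_ ∈ˡ_) (sym listed) (∈-map⁺ toℕ e∈)) (removal w)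
      ... | D , valid , pass = fail D valid pass

      number-zero : ∀ k → number b (λ _ → 0) k ≡ 0
      number-zero zero    = refl
      number-zero (suc k) = trans (+-identityʳ _) (number-zero k)

      begin-search : ∀ {σ} → regs σ 18 ≡ 0 → arrays σ 5 ≡ (λ _ → 0) → regs σ 17 ≡ fromBool (0 <ᵇ b + fromBool (W <ᵇ 1)) →
                     Valid (λ _ → 0) → 0 < b + fromBool (W <ᵇ 1) → State (b ^ W) σ
      begin-search {σ} new zeros go valid go>0 = searching (trans go (true-go go>0)) new (λ {j} → valid′ {j})
        (trans (cong (b ^ W +_) zero≡) (+-identityʳ (b ^ W))) (λ D _ lt _ → case subst (number b D W <_) zero≡ lt of λ ())
        where
        zero≡ : number b (arrays σ 5) W ≡ 0
        zero≡ = trans (cong (λ a → number b a W) zeros) (number-zero W)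
        valid′ : Valid (arrays σ 5)
        valid′ {j} j<W = subst (λ a → a j < b) (sym zeros) (valid j<W)
        true-go : ∀ {x} → 0 < x → fromBool (0 <ᵇ x) ≡ 1
        true-go (s≤s _) = refl

      start : ∀ {σ} → regs σ 18 ≡ 0 → arrays σ 5 ≡ (λ _ → 0) → regs σ 17 ≡ fromBool (0 <ᵇ b + fromBool (W <ᵇ 1)) →
              State (b ^ W) σ
      start {σ} new zeros go with W ≟ 0 | b ≟ 0
      ... | yes W≡0 | _ = begin-search new zeros go (λ j<W → ⊥-elim (case subst (_ <_) W≡0 j<W of λ ()))
                            (subst (λ w → 0 < b + fromBool (w <ᵇ 1)) (sym W≡0) (m≤n+m 1 b))
      ... | no W≢0 | no b≢0 = begin-search new zeros go (λ _ → n≢0⇒n>0 b≢0) (≤-trans (n≢0⇒n>0 b≢0) (m≤m+n b _))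
      ... | no W≢0 | yes b≡0 = absent (trans go (stuck W b W≢0 b≡0)) new
              λ D valid _ → case subst (D 0 <_) b≡0 (valid (n≢0⇒n>0 W≢0)) of λ ()
        where
        stuck : ∀ w b → w ≢ 0 → b ≡ 0 → fromBool (0 <ᵇ b + fromBool (w <ᵇ 1)) ≡ 0
        stuck zero    b ne _    = ⊥-elim (ne refl)
        stuck (suc w) _ ne refl = refl

      finish : ∀ {σ σ′} → regs σ 17 ≡ 0 × (∃[ k ] State k σ) →
               arrays σ′ 1 0 ≡ regs σ 18 → (∀ {i} → i < m → arrays σ′ 1 (suc i) ≡ arrays σ 6 i) →
               regs σ′ 1 ≡ 1 + regs σ 18 * m → Outcome σ′
      finish {σ} {σ′} (stopped , k , state) flag≡ copied length≡ = record
        { count = b ; L = L ; light = light ; count≤cap = m∸n≤m (cap L) room ; count≤m = b≤m ; verdict = verdict′ state }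
        where
        output-length : ∀ {v} → regs σ 18 ≡ v → output σ′ ≡ applyUpTo (arrays σ′ 1) (1 + v * m)
        output-length eq = cong (applyUpTo (arrays σ′ 1)) (trans length≡ (cong (λ v → 1 + v * m) eq))
        verdict′ : State k σ → (∃[ F ] Witness F × output σ′ ≡ 1 ∷ map fromBool (Vec.toList F) × arrays σ′ 1 0 ≡ 1) ⊎
                               (¬ ∃ Witness × output σ′ ≡ 0 ∷ [] × arrays σ′ 1 0 ≡ 0)
        verdict′ (searching go _ _ _ _) = ⊥-elim (0≢1+n (trans (sym stopped) go))
        verdict′ (found _ yes′ f pass marks) = inj₁ (remaining f , pass⇒witness f pass ,
          trans (output-length yes′) (cong₂ _∷_ (trans flag≡ yes′)
            (trans (cong (applyUpTo (arrays σ′ 1 ∘ suc)) (+-identityʳ m))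
              (toList-tabulate _ _ (λ e → trans (copied (toℕ<n e)) (marks (toℕ<n e)))))) , trans flag≡ yes′)
        verdict′ (absent _ no′ fail) = inj₂ (complete′ fail ,
          trans (output-length no′) (cong {B = List ℕ} (_∷ []) (trans flag≡ no′)) , trans flag≡ no′)

    firstTime : ℕ
    firstTime = duration readParameters + ((6 + m * (8 + duration lengthBody)) + (duration prepare +
      ((6 + m * (8 + duration copyBody)) + (6 + apsp₂ n m + (6 + m * (8 + duration candidateBody))))))

    secondTime : ℕ → ℕ
    secondTime b = duration startup + ((2 + b ^ W * (2 + bodyTime)) + (3 + ((6 + m * (8 + duration outputBody)) + 6)))

    record Prepared (σ : Store) : Set where
      field
        L         : ℕ
        env       : Env σ
        light     : Light m L
        cap≡      : regs σ 8 ≡ cap L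
        collected : Collected (cap L) m (regs σ 9) (arrays σ 4)
        fresh     : regs σ 18 ≡ 0 × arrays σ 5 ≡ (λ _ → 0)

    first : Reach firstHalf (initial encodeInstance) firstTime Prepared
    first =
      straight readParameters {Q = λ σ → Env σ × regs σ 7 ≡ 1 × regs σ 18 ≡ 0 × arrays σ 5 ≡ (λ _ → 0)} initial-ok
        (record { n≡ = refl ; m≡ = refl ; W≡ = refl ; a≡ = refl ; b≡ = refl ; input≡ = refl } , refl , refl , refl)
      then λ ok₁ ag₁ (env₁ , L≡1 , new₁ , zeros₁) →
      lengths ok₁ env₁ L≡1 then λ {σ₂} ok₂ ag₂ light →
      let env₂ = keepEnv ag₂ env₁
          L = regs σ₂ 7
          cap-value : 4 * regs σ₂ 4 * applyOp quot (regs σ₂ 5 * L) (regs σ₂ 6) ≡ cap L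
          cap-value = trans (cong (λ z → 4 * regs σ₂ 4 * applyOp quot (regs σ₂ 5 * L) z) (b≡ env₂))
                        (cong₂ (λ x y → 4 * x * applyOp quot (y * L) denα) (W≡ env₂) (a≡ env₂))
      in
      straight prepare {Q = λ σ → regs σ 8 ≡ cap L × regs σ 9 ≡ cap L × arrays σ 2 0 ≡ n × arrays σ 2 1 ≡ m} ok₂
        (cap-value , cap-value , n≡ env₂ , m≡ env₂)
      then λ ok₃ ag₃ (cap≡ , room≡ , head₀ , head₁) →
      let env₃ = keepEnv ag₃ env₂ in
      copy ok₃ env₃ head₀ head₁ then λ {σ₄} ok₄ ag₄ code≡ →
      let env₄ = keepEnv ag₄ env₃ in
      invoke registerDegree arrayDegree M B 2≤M enough (entry-small registerDegrees) (entry-small arrayDegrees)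
        {d = 5} {k = wordExponent A} {Q = λ σ → Table 0 (arrays σ 3)} _ tt tt refl fits-A ok₄
        (trans (cong (λ z → applyUpTo (arrays σ₄ 2) (2 + z * 3)) (m≡ env₄)) code≡)
        (runs A N) (fast-A N)
        (λ u v {j} j<2 → trans
          (cong (λ l → overwrite l (arrays σ₄ 3) ((j + toℕ v * 2) + toℕ u * (n * 2))) (proj₂ (proj₂ (correct A N))))
          (table-entry 0 u v j<2))
      then λ ok₅ ag₅ tab →
      let env₅ = keepEnv ag₅ env₄ in
      consequence (collect (cap L) ok₅ env₅ (trans (keepReg ag₅ 8) (trans (keepReg ag₄ 8) cap≡))
                     (trans (keepReg ag₅ 9) (trans (keepReg ag₄ 9) room≡)) tab)
        (λ _ ag₆ col → record
          { L = L ; env = keepEnv ag₆ env₅ ; light = light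
          ; cap≡ = trans (keepReg ag₆ 8) (trans (keepReg ag₅ 8) (trans (keepReg ag₄ 8) cap≡))
          ; collected = col
          ; fresh = trans (keepReg ag₆ 18) (trans (keepReg ag₅ 18) (trans (keepReg ag₄ 18) (trans (keepReg ag₃ 18) (trans (keepReg ag₂ 18) new₁)))) ,
                    trans (keepArray ag₆ 5) (trans (keepArray ag₅ 5) (trans (keepArray ag₄ 5) (trans (keepArray ag₃ 5) (trans (keepArray ag₂ 5) zeros₁)))) })

    module SecondHalf {σ} (p : Prepared σ) where
      open Prepared p
      open Finish light collected
      room≡ : regs σ 8 ∸ regs σ 9 ≡ b
      room≡ = cong (_∸ regs σ 9) cap≡

      initialise : Ok σ → Reach startup σ (duration startup) (λ σ′ → regs σ′ 9 ≡ b × regs σ′ 17 ≡ fromBool (0 <ᵇ b + fromBool (W <ᵇ 1)))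
      initialise ok = straight startup ok
        (room≡ , cong₂ (λ x y → fromBool (0 <ᵇ x + fromBool (y <ᵇ 1))) room≡ (W≡ env))

      enumeration : ∀ {σ₁} → Ok σ₁ → Agree startup σ σ₁ → regs σ₁ 9 ≡ b → regs σ₁ 17 ≡ fromBool (0 <ᵇ b + fromBool (W <ᵇ 1)) →
           Reach (while (reg 17) whileBody) σ₁ (2 + b ^ W * (2 + bodyTime)) (λ σ′ → regs σ′ 17 ≡ 0 × ∃[ k′ ] State k′ σ′)
      enumeration ok₁ ag₁ b≡₁ go≡ = enumerate ok₁ (keepEnv ag₁ env) b≡₁ (keepArray ag₁ 4)
        (start (trans (keepReg ag₁ 18) (proj₁ fresh)) (trans (keepArray ag₁ 5) (proj₂ fresh)) go≡)

      finalise : ∀ {σ₂} → Ok σ₂ → Env σ₂ → regs σ₂ 17 ≡ 0 × (∃[ k′ ] State k′ σ₂) →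
           Reach writeOutput σ₂ (3 + ((6 + m * (8 + duration outputBody)) + 6)) (λ σ′ → Σ[ o ∈ Outcome σ′ ] Outcome.count o ≡ b)
      finalise {σ₂} ok₂ env₂ done = consequence (write-output ok₂ env₂ refl) post
        where
        post : ∀ {σ′} → Ok σ′ → Agree writeOutput σ₂ σ′ →
          arrays σ′ 1 0 ≡ regs σ₂ 18 × (∀ {i} → i < m → arrays σ′ 1 (suc i) ≡ arrays σ₂ 6 i) × regs σ′ 1 ≡ 1 + regs σ₂ 18 * m →
          Σ[ o ∈ Outcome σ′ ] Outcome.count o ≡ b
        post {σ′} _ _ (flag≡ , copied , length≡) = finish {σ₂} {σ′} done flag≡ (λ {i} → copied {i}) length≡ , refl

      second : Ok σ → Reach secondHalf σ (secondTime b) (λ σ′ → Σ[ o ∈ Outcome σ′ ] Outcome.count o ≡ b)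
      second ok = initialise ok then λ ok₁ ag₁ (b≡₁ , go≡) → enumeration ok₁ ag₁ b≡₁ go≡ then λ ok₂ ag₂ done →
        finalise ok₂ (keepEnv ag₂ (keepEnv ag₁ env)) done

    solve : Σ[ σ ∈ Store ] Σ[ t ∈ ℕ ] Exec B (firstHalf ⨾ secondHalf) (initial encodeInstance) σ t ×
            Σ[ o ∈ Outcome σ ] t ≤ firstTime + secondTime (Outcome.count o)
    solve = reach-second first
      where
      open Reach using (final; steps; exec; within; ok; post)
      reach-second : Reach firstHalf (initial encodeInstance) firstTime Prepared →
                     Σ[ σ ∈ Store ] Σ[ t ∈ ℕ ] Exec B (firstHalf ⨾ secondHalf) (initial encodeInstance) σ t ×
                     Σ[ o ∈ Outcome σ ] t ≤ firstTime + secondTime (Outcome.count o)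
      reach-second r = final r′ , steps r + steps r′ , seq (exec r) (exec r′) , proj₁ (post r′) ,
        +-mono-≤ (within r) (≤-trans (within r′) (≤-reflexive (cong secondTime (sym (proj₂ (post r′))))))
        where r′ = SecondHalf.second (post r) (ok r)

    module _ (m<spsp : m < spsp n m) (m<apsp₂ : m < apsp₂ n m) (b : ℕ) where
      private
        r = apsp₂ n m + b ^ W * W * spsp n m
        m<r : m < r
        m<r = ≤-trans m<apsp₂ (m≤m+n (apsp₂ n m) _)
      open TupleBounds m W (spsp n m) m<spsp
      module Total = Linear m r m<r

      bodyTime≲ : bodyTime ≲ bodyLinear , bodyTuples
      bodyTime≲ = body≲ (check≲ (duration markAllBody) (duration markBody) (duration restBody)
                          (test≲ (duration queryHead) (duration queryBody) (duration testAnswer)))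
                        (advance≲ (duration odometerBody))

      firstTime≲ : firstTime Total.≲ firstBound
      firstTime≲ = Total.first≲ {apsp₂ n m} (duration readParameters) (duration lengthBody) (duration prepare) (duration copyBody)
                     (duration candidateBody) (m≤m+n (apsp₂ n m) _)

      enumeration≲ : b ^ W * (2 + bodyTime) Total.≲ iterationBound
      enumeration≲ = Total.at-most (iterations≤ {b = b} bodyTime≲ m<apsp₂)

      secondTime≲ : secondTime b Total.≲ secondBound
      secondTime≲ = Total.second≲ (duration startup) (duration outputBody) enumeration≲

      totalTime≲ : firstTime + secondTime b Total.≲ firstBound + secondBound
      totalTime≲ = firstTime≲ Total.⊕ secondTime≲

-- From the program to the search and decision algorithms

anyFin : ∀ {n} → NonZero n → Fin n
anyFin {suc n} _ = zero

length-encodeNetwork : ∀ N → length (encodeNetwork N) ≡ 2 + Network.m N * 3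
length-encodeNetwork N = cong (2 +_) (length-concatMap {3} {g = λ e → toℕ (proj₁ (ends e)) ∷ toℕ (proj₂ (ends e)) ∷ len e ∷ []}
                           (λ e → e) (λ _ → refl))
  where open Network N

length-encodeInstance : ∀ I → length (Instance.encodeInstance I) ≡ 5 + Instance.m I * 4
length-encodeInstance I = cong (5 +_) (length-concatMap {4}
    {g = λ e → toℕ (proj₁ (ends e)) ∷ toℕ (proj₂ (ends e)) ∷ weight e ∷ len e ∷ []} (λ e → e) (λ _ → refl))
  where open Instance I

-- Reading the input is charged, so both assumed running times exceed `m`. This is what lets them
-- absorb all overheads linear in `m`.
time≥input : ∀ {P} (A : Algorithm P) i → length (encode P i) ≤ time A i
time≥input {P} A i with runs A i
... | _ , s , _ , _ , eq = subst (length (encode P i) ≤_) (sym eq)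
        (≤-trans (m≤m+n (length (encode P i)) s) (m≤m+n _ (length (answer A i))))

record WordBase (k : ℕ) (x : List ℕ) : Set where
  field
    base     : ℕ
    limit    : base ^ k ≡ wordLimit k x
    2≤base   : 2 ≤ base
    length≤  : length x ≤ base
    entries≤ : ∀ i → overwrite x (λ _ → 0) i ≤ base

wordBase : ∀ k x → WordBase k x
wordBase k x = record
  { base     = 2 + length x + foldr _⊔_ 0 x
  ; limit    = refl
  ; 2≤base   = s≤s (s≤s z≤n)
  ; length≤  = ≤-trans (m≤n+m (length x) 2) (m≤m+n (2 + length x) _)
  ; entries≤ = λ i → ≤-trans (overwrite≤max x i) (m≤n+m (foldr _⊔_ 0 x) (2 + length x))
  }

exec⇒run : ∀ (P : Problem) i k {p σ t} x → x ≡ encode P i → Exec (wordLimit k x) p (initial x) σ t →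
           Run (wordLimit k (encode P i)) p (encode P i) (output σ) (length (encode P i) + t + length (output σ))
exec⇒run P i k {σ = σ} {t} x refl exec = σ , t , exec , refl , refl

truncate-output : ∀ k x {p σ t} → Exec (wordLimit k x) p (initial x) σ t →
                  Exec (wordLimit k x) (p ⨾ 1 ≔ lit 1) (initial x) (setReg 1 1 σ) (t + 2)
truncate-output k x exec = seq exec (assign (m^n>0 (2 + length x + foldr _⊔_ 0 x) k , _))

module Summaries (S : Algorithm singlePair) (A : Algorithm allPairsTwo) (spsp apsp₂ : ℕ → ℕ → ℕ)
  (fast-S : ∀ i → time S i ≤ spsp (Network.n (PairQuery.network i)) (Network.m (PairQuery.network i)))
  (fast-A : ∀ N → time A N ≤ apsp₂ (Network.n N) (Network.m N)) where
  open Solver S A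

  -- Abstract, so that the numerals are not normalised.
  abstract
    exponent : ℕ
    exponent = maxDegree + (8 * wordExponent S + 8 * wordExponent A)

    exponent≥degree : maxDegree ≤ exponent
    exponent≥degree = m≤m+n maxDegree _

    exponent≥S : 8 * wordExponent S ≤ exponent
    exponent≥S = ≤-trans (m≤m+n (8 * wordExponent S) _) (m≤n+m _ maxDegree)

    exponent≥A : 8 * wordExponent A ≤ exponent
    exponent≥A = ≤-trans (m≤n+m (8 * wordExponent A) (8 * wordExponent S)) (m≤n+m _ maxDegree)

    runtimeBound : ℕ
    runtimeBound = (5 + 4) + ((firstBound + secondBound) + 2) + 1

    runtimeBound≡ : (5 + 4) + ((firstBound + secondBound) + 2) + 1 ≡ runtimeBound
    runtimeBound≡ = refl

  module _ (I : Instance) where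
    open Instance I

    Verdict : Store → Set
    Verdict σ = (∃[ F ] Witness F × output σ ≡ 1 ∷ map fromBool (Vec.toList F) × arrays σ 1 0 ≡ 1) ⊎
                (¬ ∃ Witness × output σ ≡ 0 ∷ [] × arrays σ 1 0 ≡ 0)

    verdict-length : ∀ {σ} → Verdict σ → length (output σ) ≤ suc m
    verdict-length (inj₁ (F , _ , eq , _)) = ≤-reflexive (trans (cong length eq)
      (cong suc (trans (length-map fromBool (Vec.toList F)) (Vec.length-toList F))))
    verdict-length (inj₂ (_ , eq , _)) = ≤-trans (≤-reflexive (cong length eq)) (s≤s z≤n)

    search-answer : ∀ {σ} → Verdict σ → (∃[ F ] Witness F × output σ ≡ 1 ∷ map fromBool (Vec.toList F)) ⊎
                                        (¬ ∃ Witness × output σ ≡ 0 ∷ [])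
    search-answer (inj₁ (F , w , eq , _)) = inj₁ (F , w , eq)
    search-answer (inj₂ (no-witness , eq , _)) = inj₂ (no-witness , eq)

    decision-answer : ∀ {σ} → Verdict σ → (∃ Witness × arrays σ 1 0 ∷ [] ≡ 1 ∷ []) ⊎
                                          (¬ ∃ Witness × arrays σ 1 0 ∷ [] ≡ 0 ∷ [])
    decision-answer (inj₁ (F , w , _ , eq)) = inj₁ ((F , w) , cong {B = List ℕ} (_∷ []) eq)
    decision-answer (inj₂ (no-witness , _ , eq)) = inj₂ (no-witness , cong {B = List ℕ} (_∷ []) eq)

    -- `runtime` leaves room for both versions: the decision version spends 2 more steps on
    -- truncating the output, the search version emits up to `suc m` words.
    record Summary (B : ℕ) : Set where
      field
        result    : Store
        steps     : ℕ
        exec      : Exec B (firstHalf ⨾ secondHalf) (initial encodeInstance) result steps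
        verdict   : Verdict result
        count L   : ℕ
        1≤L       : 1 ≤ L
        attained  : L ≡ 1 ⊎ ∃[ e ] weight e < W × L ≡ len e
        count≤cap : count ≤ 4 * W * (numα * L / denα)
        count≤m   : count ≤ m
        runtime   : ∀ {s y} → s ≤ steps + 2 → y ≤ suc m →
                    length encodeInstance + s + y ≤ runtimeBound * (apsp₂ n m + count ^ W * W * spsp n m)

    private
      N = Instance.network I

      vertex : Fin n
      vertex = anyFin (proj₁ connected)

      m<spsp : m < spsp n m
      m<spsp = ≤-trans (s≤s (≤-trans (m≤m*n m 3) (m≤n+m (m * 3) 3)))
        (≤-trans (≤-reflexive (sym (cong (2 +_) (length-encodeNetwork N))))
          (≤-trans (time≥input S q) (fast-S q)))
        where q = record { network = N ; source = vertex ; target = vertex }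

      m<apsp₂ : m < apsp₂ n m
      m<apsp₂ = ≤-trans (s≤s (≤-trans (m≤m*n m 3) (m≤n+m (m * 3) 1)))
        (≤-trans (≤-reflexive (sym (length-encodeNetwork N))) (≤-trans (time≥input A N) (fast-A N)))

    -- The base is a variable here, since powers of a concrete number are
    -- expensive to normalise.
    summarise : ∀ {B} M → M ^ exponent ≡ B → 2 ≤ M → length encodeInstance ≤ M →
                (∀ i → overwrite encodeInstance (λ _ → 0) i ≤ M) → Summary B
    summarise M refl 2≤M length≤ entries≤ = case solve of λ (_ , _ , x , o , t≤) → package x o t≤
      where
      instance
        M≢0 : NonZero M
        M≢0 = >-nonZero (≤-trans (s≤s z≤n) 2≤M)
      fits : ∀ k → 8 * k ≤ exponent → (M ^ 8) ^ k ≤ M ^ exponent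
      fits k le = ≤-trans (≤-reflexive (^-*-assoc M 8 k)) (^-monoʳ-≤ M le)
      open Run spsp apsp₂ fast-S fast-A I M (M ^ exponent) 2≤M (^-monoʳ-≤ M exponent≥degree)
        (fits (wordExponent S) exponent≥S) (fits (wordExponent A) exponent≥A) length≤ entries≤
      package : ∀ {σ t} → Exec (M ^ exponent) (firstHalf ⨾ secondHalf) (initial encodeInstance) σ t →
                (o : Outcome σ) → t ≤ firstTime + secondTime (Outcome.count o) → Summary (M ^ exponent)
      package {σ} {t} x o t≤ = record
        { result = σ ; steps = t ; exec = x ; verdict = verdict ; count = count ; L = L
        ; 1≤L = Verification.Light.1≤L light ; attained = Verification.Light.attained light
        ; count≤cap = count≤cap ; count≤m = count≤m ; runtime = λ s≤ y≤ → runtime′ s≤ y≤ }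
        where
        open Outcome o
        module T = Linear m (apsp₂ n m + count ^ W * W * spsp n m) (≤-trans m<apsp₂ (m≤m+n (apsp₂ n m) _))
        steps≲ : t T.≲ firstBound + secondBound
        steps≲ = T.at-most (≤-trans t≤ (T.bound {c = firstBound + secondBound} (totalTime≲ m<spsp m<apsp₂ count)))
        runtime′ : ∀ {s y} → s ≤ t + 2 → y ≤ suc m →
                   length encodeInstance + s + y ≤ runtimeBound * (apsp₂ n m + count ^ W * W * spsp n m)
        runtime′ {s} {y} s≤ y≤ = ≤-trans (+-monoˡ-≤ y (+-mono-≤ (≤-reflexive (length-encodeInstance I)) s≤))
          (T.bound {c = runtimeBound} runtime≲)
          where
          runtime≲ : 5 + m * 4 + (t + 2) + y T.≲ runtimeBound
          runtime≲ = subst (5 + m * 4 + (t + 2) + y T.≲_) runtimeBound≡ (T.io≲ steps≲ y≤)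

    fromBase : WordBase exponent encodeInstance → Summary (wordLimit exponent encodeInstance)
    fromBase b = summarise base limit 2≤base length≤ entries≤
      where open WordBase b

    abstract
      summary : Summary (wordLimit exponent encodeInstance)
      summary = fromBase (wordBase exponent encodeInstance)

  module _ {Idx : Set} (inst : Idx → Instance) where
    module _ (i : Idx) where
      open Summary (summary (inst i)) public

    searchAlgorithm : Algorithm (search inst)
    searchAlgorithm = record
      { program      = firstHalf ⨾ secondHalf
      ; wordExponent = exponent
      ; answer       = λ i → output (result i)
      ; time         = λ i → length (Instance.encodeInstance (inst i)) + steps i + length (output (result i))
      ; runs         = λ i → exec⇒run (search inst) i exponent (Instance.encodeInstance (inst i)) refl (exec i)
      ; correct      = λ i → search-answer (inst i) {result i} (verdict i)
      }

    decisionAlgorithm : Algorithm (decision inst)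
    decisionAlgorithm = record
      { program      = (firstHalf ⨾ secondHalf) ⨾ 1 ≔ lit 1
      ; wordExponent = exponent
      ; answer       = λ i → arrays (result i) 1 0 ∷ []
      ; time         = λ i → length (Instance.encodeInstance (inst i)) + (steps i + 2) + 1
      ; runs         = λ i → exec⇒run (decision inst) i exponent (Instance.encodeInstance (inst i)) refl
                               (truncate-output exponent (Instance.encodeInstance (inst i)) (exec i))
      ; correct      = λ i → decision-answer (inst i) {result i} (verdict i)
      }

    Fast : (Idx → ℕ) → Set
    Fast t = ∀ i → let open Instance (inst i) in t i ≤ runtimeBound * (apsp₂ n m + count i ^ W * W * spsp n m)

    search-time : Fast (time searchAlgorithm)
    search-time i = runtime i (m≤m+n _ 2) (verdict-length (inst i) {result i} (verdict i))

    decision-time : Fast (time decisionAlgorithm)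
    decision-time i = runtime i ≤-refl (s≤s z≤n)

-- Running times

fromℕ-mono : ∀ {x y} → x ≤ y → fromℕ x ≤ℚ fromℕ y
fromℕ-mono {x} {y} x≤y = ℚ.toℚᵘ-cancel-≤ (ℚᵘ.≤-trans (ℚᵘ.≤-reflexive (toℚᵘ-fromℕ x))
  (ℚᵘ.≤-trans (*≤* (ℤ.*-monoʳ-≤-nonNeg (ℤ.+ 1) (ℤ.+≤+ x≤y))) (ℚᵘ.≤-reflexive (ℚᵘ.≃-sym (toℚᵘ-fromℕ y)))))

fromℕ-* : ∀ x y → fromℕ (x * y) ≡ fromℕ x *ℚ fromℕ y
fromℕ-* x y = ℚ.toℚᵘ-injective (ℚᵘ.≃-trans (toℚᵘ-fromℕ (x * y)) (ℚᵘ.≃-sym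
  (ℚᵘ.≃-trans (ℚ.toℚᵘ-homo-* (fromℕ x) (fromℕ y)) (ℚᵘ.≃-trans (ℚᵘ.*-cong (toℚᵘ-fromℕ x) (toℚᵘ-fromℕ y))
    (*≡* (cong (ℤ._* ℤ.+ 1) (sym (ℤ.pos-* x y))))))))

fromℕ-+ : ∀ x y → fromℕ (x + y) ≡ fromℕ x +ℚ fromℕ y
fromℕ-+ x y = ℚ.toℚᵘ-injective (ℚᵘ.≃-trans (toℚᵘ-fromℕ (x + y)) (ℚᵘ.≃-sym
  (ℚᵘ.≃-trans (ℚ.toℚᵘ-homo-+ (fromℕ x) (fromℕ y)) (ℚᵘ.≃-trans (ℚᵘ.+-cong (toℚᵘ-fromℕ x) (toℚᵘ-fromℕ y))
    (*≡* (cong (ℤ._* ℤ.+ 1) (trans (cong₂ ℤ._+_ (ℤ.*-identityʳ (ℤ.+ x)) (ℤ.*-identityʳ (ℤ.+ y))) (sym (ℤ.pos-+ x y)))))))))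

fromℕ-nonNeg : ∀ x → NonNegative (fromℕ x)
fromℕ-nonNeg x = nonNegative {fromℕ x} (fromℕ-mono {0} {x} z≤n)

^ℚ-nonNeg : ∀ p .{{_ : NonNegative p}} k → NonNegative (p ^ℚ k)
^ℚ-nonNeg p zero    = _
^ℚ-nonNeg p (suc k) = ℚ.nonNeg*nonNeg⇒nonNeg p (p ^ℚ k) {{^ℚ-nonNeg p k}}

fromℕ-^ : ∀ x {p} k → fromℕ x ≤ℚ p → fromℕ (x ^ k) ≤ℚ p ^ℚ k
fromℕ-^ x zero    x≤p = ℚ.≤-refl
fromℕ-^ x {p} (suc k) x≤p = ℚ.≤-trans (ℚ.≤-reflexive (fromℕ-* x (x ^ k)))
  (ℚ.≤-trans (ℚ.*-monoˡ-≤-nonNeg (fromℕ x) {{fromℕ-nonNeg x}} (fromℕ-^ x k x≤p))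
    (ℚ.*-monoʳ-≤-nonNeg (p ^ℚ k) {{^ℚ-nonNeg p {{p≥0}} k}} x≤p))
  where
  p≥0 : NonNegative p
  p≥0 = nonNegative (ℚ.≤-trans (fromℕ-mono {0} {x} z≤n) x≤p)

-- From 4 on, the base 4 is at most `w`; below that, `4 ^ w` is at most `4 ^ 3 = 64`, and `w ^ w` is
-- at least 1, also for `w = 0`.
4^≤64*^ : ∀ w → 4 ^ w ≤ 64 * w ^ w
4^≤64*^ 0 = m≤m+n 1 63
4^≤64*^ 1 = m≤m+n 4 60
4^≤64*^ 2 = m≤m+n 16 240
4^≤64*^ 3 = m≤m+n 64 1664
4^≤64*^ w@(suc (suc (suc (suc _)))) = ≤-trans (^-monoˡ-≤ w (s≤s (s≤s (s≤s (s≤s z≤n))))) (m≤n*m _ 64)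

^-distribʳ-* : ∀ k m n → (m * n) ^ k ≡ m ^ k * n ^ k
^-distribʳ-* zero    m n = refl
^-distribʳ-* (suc k) m n = trans (cong (m * n *_) (^-distribʳ-* k m n)) (regroup m n (m ^ k) (n ^ k))
  where
  regroup : ∀ m n x y → m * n * (x * y) ≡ m * x * (n * y)
  regroup = solve-∀

-- One factor `W ^ W` stems from the `4 * W * t` candidates, a second one absorbs `4 ^ W`, and the
-- last factor `W` counts the queries per tuple. As `1 ≤ t`, its exponent may be doubled to match
-- the claimed bound.
power-bound : ∀ W t b → 1 ≤ t → b ≤ 4 * W * t → b ^ W * W ≤ 64 * (W ^ (2 * W + 1) * t ^ (2 * W))
power-bound W t b 1≤t b≤ = begin
  b ^ W * W
    ≤⟨ *-monoˡ-≤ W (^-monoˡ-≤ W b≤) ⟩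
  (4 * W * t) ^ W * W
    ≡⟨ cong (_* W) (trans (^-distribʳ-* W (4 * W) t) (cong (_* t ^ W) (^-distribʳ-* W 4 W))) ⟩
  4 ^ W * W ^ W * t ^ W * W
    ≤⟨ *-monoˡ-≤ W (*-mono-≤ (*-monoˡ-≤ (W ^ W) (4^≤64*^ W)) (^-monoʳ-≤ t {{>-nonZero 1≤t}} (m≤m+n W _))) ⟩
  64 * W ^ W * W ^ W * t ^ (2 * W) * W
    ≡⟨ regroup (W ^ W) (t ^ (2 * W)) W ⟩
  64 * (W ^ W * W ^ W * W * t ^ (2 * W))
    ≡⟨ cong (λ z → 64 * (z * t ^ (2 * W))) power ⟩
  64 * (W ^ (2 * W + 1) * t ^ (2 * W))
    ∎
  where
  open ≤-Reasoning
  regroup : ∀ x y w → 64 * x * x * y * w ≡ 64 * (x * x * w * y)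
  regroup = solve-∀
  power : W ^ W * W ^ W * W ≡ W ^ (2 * W + 1)
  power = trans (cong₂ _*_ (trans (sym (^-distribˡ-+-* W W W)) (cong (λ z → W ^ (W + z)) (sym (+-identityʳ W))))
                           (sym (*-identityʳ W)))
                (sym (^-distribˡ-+-* W (2 * W) 1))

-- Computability of the parameter functions

fits-some : ∀ e σ → ∃[ B ] Fits B e σ
fits-some (lit v)    σ = v , ≤-refl , _
fits-some (reg r)    σ = regs σ r , ≤-refl , _
fits-some (cell a e) σ with fits-some e σ
... | B , f = v ⊔ B , m≤m⊔n v B , Fits-mono (m≤n⊔m v B) e f
  where v = ⟦ cell a e ⟧ σ
fits-some (op o d e) σ with fits-some d σ | fits-some e σ
... | B , f | C , g = v ⊔ (B ⊔ C) , m≤m⊔n v _ ,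
      Fits-mono (≤-trans (m≤m⊔n B C) (m≤n⊔m v (B ⊔ C))) d f , Fits-mono (≤-trans (m≤n⊔m B C) (m≤n⊔m v (B ⊔ C))) e g
  where v = ⟦ op o d e ⟧ σ

-- `Computable` allows a word limit for each input, so limits and times are merely collected,
-- without estimates.
Halts : Program → Store → (Store → Set) → Set
Halts p σ Q = ∃[ B ] ∃[ σ′ ] ∃[ t ] Exec B p σ σ′ t × Q σ′

halts-assign : ∀ r e {σ} {Q : Store → Set} → Q (setReg r (⟦ e ⟧ σ) σ) → Halts (r ≔ e) σ Q
halts-assign r e {σ} q with fits-some e σ
... | B , f = B , _ , _ , assign f , q

halts-seq : ∀ {p q σ} {P Q : Store → Set} → Halts p σ P → (∀ {σ′} → P σ′ → Halts q σ′ Q) → Halts (p ⨾ q) σ Q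
halts-seq (B , σ₁ , s , x , p) f with f p
... | C , σ₂ , t , y , q = B ⊔ C , σ₂ , s + t , seq (Exec-mono (m≤m⊔n B C) x) (Exec-mono (m≤n⊔m B C) y) , q

-- Computes (1 + u + v w) ^ (4 u + 1) for the entries u, v and w at the
-- positions 0, i and j of the input.
powerBody : Program
powerBody = 4 ≔ op mul (reg 4) (reg 2) ⨾ 3 ≔ op monus (reg 3) (lit 1)

powerProgram : ℕ → ℕ → Program
powerProgram i j =
  2 ≔ op add (op add (lit 1) (cell 0 (lit 0))) (op mul (cell 0 (lit i)) (cell 0 (lit j))) ⨾
  3 ≔ op add (op mul (lit 4) (cell 0 (lit 0))) (lit 1) ⨾ 4 ≔ lit 1 ⨾
  while (reg 3) powerBody ⨾ 1 [ lit 0 ]≔ reg 4 ⨾ 1 ≔ lit 1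

powerLoop : ∀ k {σ} → regs σ 3 ≡ k → Halts (while (reg 3) powerBody) σ (λ σ′ → regs σ′ 4 ≡ regs σ 4 * regs σ 2 ^ k)
powerLoop zero {σ} eq = regs σ 3 , σ , _ , stop (≤-refl , _) eq , sym (*-identityʳ _)
powerLoop (suc k) {σ} eq
  with halts-seq {P = λ σ′ → regs σ′ 4 ≡ regs σ 4 * regs σ 2 × regs σ′ 3 ≡ suc k × regs σ′ 2 ≡ regs σ 2}
         (halts-assign 4 (op mul (reg 4) (reg 2)) (refl , eq , refl))
         (λ {σ₁} (eq₄ , eq₃ , eq₂) → halts-assign 3 (op monus (reg 3) (lit 1))
           {Q = λ σ′ → regs σ′ 4 ≡ regs σ 4 * regs σ 2 × regs σ′ 3 ≡ k × regs σ′ 2 ≡ regs σ 2} (eq₄ , cong (_∸ 1) eq₃ , eq₂))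
... | B , σ₁ , s , x , eq₄ , eq₃ , eq₂ with powerLoop k {σ₁} eq₃
...   | C , σ₂ , t , y , eq₅ = D ⊔ (B ⊔ C) , σ₂ , _ ,
  loop (m≤m⊔n D (B ⊔ C) , _) (λ z → 0≢1+n (trans (sym z) eq))
    (Exec-mono (≤-trans (m≤m⊔n B C) (m≤n⊔m D (B ⊔ C))) x) (Exec-mono (≤-trans (m≤n⊔m B C) (m≤n⊔m D (B ⊔ C))) y) ,
  trans eq₅ (trans (cong₂ (λ a b → a * b ^ k) eq₄ eq₂) (*-assoc (regs σ 4) (regs σ 2) _))
  where D = regs σ 3

-- The parameter-dependent factor, with `u = W` and `y = numα * ℓ`. The exponent is
-- `(2 W + 1) + 2 W` and the base dominates both `W` and `y`; the summand 1 makes the value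
-- positive, so that it also covers the all-pairs term.
power : ℕ → ℕ → ℕ
power u y = (1 + u + y) ^ (4 * u + 1)

power-runs : ∀ i j x → let at = overwrite x (λ _ → 0) in
             ∃[ B ] ∃[ t ] Run B (powerProgram i j) x (power (at 0) (at i * at j) ∷ []) t
power-runs i j x with
    halts-seq {P = λ σ → regs σ 2 ≡ 1 + at 0 + at i * at j × arrays σ 0 0 ≡ at 0} (halts-assign 2 _ (refl , refl)) (λ {σ₁} (g≡ , u≡) →
    halts-seq {P = λ σ → regs σ 2 ≡ 1 + at 0 + at i * at j × regs σ 3 ≡ 4 * at 0 + 1} (halts-assign 3 _ (g≡ , cong (λ u → 4 * u + 1) u≡)) (λ {σ₂} (g≡ , c≡) →
    halts-seq {P = λ σ → regs σ 2 ≡ 1 + at 0 + at i * at j × regs σ 3 ≡ 4 * at 0 + 1 × regs σ 4 ≡ 1} (halts-assign 4 (lit 1) (g≡ , c≡ , refl)) (λ {σ₃} (g≡ , c≡ , o≡) →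
    halts-seq (powerLoop (4 * at 0 + 1) {σ₃} c≡) (λ {σ₄} r≡ →
    halts-seq {P = λ σ → arrays σ 1 0 ≡ power (at 0) (at i * at j)}
      (regs σ₄ 4 , _ , _ , write {d = lit 0} {reg 4} (z≤n , _) (≤-refl , _) ,
        trans r≡ (trans (cong₂ (λ a b → a * b ^ (4 * at 0 + 1)) o≡ g≡) (*-identityˡ (power (at 0) (at i * at j))))) (λ {σ₅} p≡ →
    halts-assign 1 (lit 1) {Q = λ σ → output σ ≡ power (at 0) (at i * at j) ∷ []} (cong {B = List ℕ} (_∷ []) p≡))))))
  where at = overwrite x (λ _ → 0)
... | B , σ , s , exec , out = B , _ , σ , s , exec , out , refl

-- Polynomial bounds in the encoding length

n≤2^n : ∀ n → n ≤ 2 ^ n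
n≤2^n zero    = z≤n
n≤2^n (suc n) = ≤-trans (+-mono-≤ (m^n>0 2 n) (n≤2^n n)) (≤-reflexive (cong (2 ^ n +_) (sym (+-identityʳ _))))

⌈log₂⌉≤ : ∀ n → ⌈log₂ n ⌉ ≤ n
⌈log₂⌉≤ n = ≤-trans (⌈log₂⌉-mono-≤ (n≤2^n n)) (≤-reflexive (⌈log₂2^n⌉≡n n))

length≤size : ∀ x → length x ≤ size x
length≤size []       = z≤n
length≤size (a ∷ x) = s≤s (≤-trans (length≤size x) (m≤n+m (size x) ⌊log₂ a ⌋))

monomial : ℕ → List ℕ
monomial d = replicate d 0 ++ 1 ∷ []

evalPoly-monomial : ∀ d s → evalPoly (monomial d) s ≡ s ^ d
evalPoly-monomial zero    s = cong suc (*-zeroʳ s)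
evalPoly-monomial (suc d) s = cong (s *_) (evalPoly-monomial d s)

-- Every vertex is the root or an end of the first edge on a path to the root. The bound is needed
-- because `n` is encoded in binary, so that only connectedness makes it polynomial in the encoding
-- length.
vertices≤ : ∀ N → Connected N → Network.n N ≤ 1 + Network.m N * 2
vertices≤ N (nz , path) = subst₂ _≤_ (length-tabulate {n = n} id)
  (cong suc (length-concatMap {2} {g = ends′} id (λ _ → refl)))
  (unique-length (Unique.allFin⁺ n) (λ {v} _ → cover v))
  where
  open Network N
  root : Fin n
  root = anyFin nz
  ends′ : Fin m → List (Fin n)
  ends′ e = proj₁ (ends e) ∷ proj₂ (ends e) ∷ []
  cover : ∀ v → v ∈ˡ root ∷ concatMap ends′ (allFin m)
  cover v with proj₁ (path v root)
  ... | nil = here refl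
  ... | cons e _ (inj₁ eq) _ = there (∈-concatMap⁺ ends′ (lose (∈-allFin e) (here (sym (cong proj₁ eq)))))
  ... | cons e _ (inj₂ eq) _ = there (∈-concatMap⁺ ends′ (lose (∈-allFin e) (there (here (sym (cong proj₂ eq))))))

-- The bound on `apsp₂` starts at two vertices. Without edges, a single vertex contributes only the
-- constant `apsp₂ 1 0`, which is part of `graphFactor`.
no-edges : ∀ N → Network.n N ≤ 1 → Network.m N ≡ 0
no-edges N n≤1 with Network.m N in eq
... | zero  = refl
... | suc k = ⊥-elim (edge (subst Fin (sym eq) zero))
  where
  open Network N
  edge : ¬ Fin m
  edge e = <⇒≱ (≤-trans (s≤s (≤-trans (s≤s z≤n) (ordered e))) (toℕ<n (proj₂ (ends e)))) n≤1

-- Asked only for positive `m` and `W`: otherwise the default `L = 1` may exceed a bound that is 0,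
-- but then the term for the tuples vanishes as well.
CoversLengths : {Idx : Set} → (Idx → Instance) → (Idx → ℕ) → Set
CoversLengths inst ℓ = ∀ i → let open Instance (inst i) in 1 ≤ m → 1 ≤ W → ∀ {L} →
                       L ≡ 1 ⊎ ∃[ e ] weight e < W × L ≡ len e → L ≤ ℓ i

module Conclusions (spsp apsp₂ : ℕ → ℕ → ℕ) (isSPSP : IsSPSPTime spsp) (isAPSP₂ : IsAPSP₂Time apsp₂) where
  open Summaries (proj₁ (proj₁ isSPSP)) (proj₁ (proj₁ isAPSP₂)) spsp apsp₂ (proj₂ (proj₁ isSPSP)) (proj₂ (proj₁ isAPSP₂)) public

  cₛ dₛ cₐ degreeBound graphFactor : ℕ
  cₛ = proj₁ (proj₂ isSPSP)
  dₛ = proj₁ (proj₂ (proj₂ isSPSP))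
  cₐ = proj₁ (proj₂ isAPSP₂)
  -- The 3 accounts for `n ^ 2 * ⌈log₂ n ⌉`, which is at most cubic.
  degreeBound = dₛ + 3
  graphFactor = cₛ + (cₐ * 2 + apsp₂ 1 0)

  graph-time : ∀ I → let open Instance I in
               spsp n m + apsp₂ n m ≤ graphFactor * evalPoly (monomial degreeBound) (size encodeInstance)
  graph-time I = begin
    spsp n m + apsp₂ n m
      ≤⟨ +-mono-≤ spsp≤ apsp₂≤ ⟩
    cₛ * s ^ degreeBound + (cₐ * 2 + apsp₂ 1 0) * s ^ degreeBound
      ≡⟨ sym (*-distribʳ-+ (s ^ degreeBound) cₛ _) ⟩
    graphFactor * s ^ degreeBound
      ≡⟨ cong (graphFactor *_) (sym (evalPoly-monomial degreeBound s)) ⟩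
    graphFactor * evalPoly (monomial degreeBound) s
      ∎
    where
    open Instance I
    open ≤-Reasoning
    N = Instance.network I
    s = size encodeInstance
    m≤ : 5 + m * 4 ≤ s
    m≤ = ≤-trans (≤-reflexive (sym (length-encodeInstance I))) (length≤size encodeInstance)
    n+m≤ : 1 + n + m ≤ s
    n+m≤ = ≤-trans (+-monoˡ-≤ m (s≤s (vertices≤ N connected))) (≤-trans few m≤)
      where
      few : 2 + m * 2 + m ≤ 5 + m * 4
      few = ≤-trans (≤-reflexive (regroup m)) (+-mono-≤ (m≤m+n 2 3) (*-monoʳ-≤ m (n≤1+n 3)))
        where
        regroup : ∀ m → 2 + m * 2 + m ≡ 2 + m * 3
        regroup = solve-∀
    n≤ : n ≤ s
    n≤ = ≤-trans (≤-trans (n≤1+n n) (m≤m+n (1 + n) m)) n+m≤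
    instance
      s≢0 : NonZero s
      s≢0 = >-nonZero (≤-trans (s≤s z≤n) n+m≤)
    spsp≤ : spsp n m ≤ cₛ * s ^ degreeBound
    spsp≤ = ≤-trans (proj₂ (proj₂ (proj₂ isSPSP)) n m) (*-monoʳ-≤ cₛ
      (≤-trans (^-monoˡ-≤ dₛ n+m≤) (^-monoʳ-≤ s (m≤m+n dₛ 3))))
    cubic : n * m + n ^ 2 * ⌈log₂ n ⌉ ≤ 2 * s ^ degreeBound
    cubic = begin
      n * m + n ^ 2 * ⌈log₂ n ⌉
        ≤⟨ +-mono-≤ (*-mono-≤ n≤ (≤-trans (m≤n+m m (1 + n)) n+m≤)) (*-mono-≤ (^-monoˡ-≤ 2 n≤) (≤-trans (⌈log₂⌉≤ n) n≤)) ⟩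
      s * s + s ^ 2 * s
        ≡⟨ cong₂ _+_ (cong (s *_) (sym (*-identityʳ s))) (*-comm (s ^ 2) s) ⟩
      s ^ 2 + s ^ 3
        ≤⟨ +-mono-≤ (^-monoʳ-≤ s (≤-trans (n≤1+n 2) (m≤n+m 3 dₛ))) (^-monoʳ-≤ s (m≤n+m 3 dₛ)) ⟩
      s ^ degreeBound + s ^ degreeBound
        ≡⟨ cong (s ^ degreeBound +_) (sym (+-identityʳ _)) ⟩
      2 * s ^ degreeBound
        ∎
    apsp₂≤ : apsp₂ n m ≤ (cₐ * 2 + apsp₂ 1 0) * s ^ degreeBound
    apsp₂≤ with 2 ≤? n
    ... | yes 2≤n = ≤-trans (proj₂ (proj₂ isAPSP₂) n m 2≤n)
          (≤-trans (*-monoʳ-≤ cₐ cubic) (≤-trans (≤-reflexive (sym (*-assoc cₐ 2 (s ^ degreeBound))))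
            (*-monoˡ-≤ (s ^ degreeBound) (m≤m+n (cₐ * 2) (apsp₂ 1 0)))))
    ... | no 2≰n = ≤-trans (≤-reflexive (cong₂ apsp₂ n≡1 (no-edges N n≤1)))
          (≤-trans (m≤n+m (apsp₂ 1 0) (cₐ * 2)) (m≤m*n (cₐ * 2 + apsp₂ 1 0) (s ^ degreeBound) {{m^n≢0 s degreeBound}}))
      where
      n≤1 = ≤-pred (≰⇒> 2≰n)
      n≡1 : n ≡ 1
      n≡1 = ≤-antisym n≤1 (>-nonZero⁻¹ n {{proj₁ connected}})

  module Bounds {Idx : Set} (inst : Idx → Instance) (ℓ : Idx → ℕ) (bounds : CoversLengths inst ℓ) where

    module _ (i : Idx) where
      open Instance (inst i)

      τ : ℚ
      τ = α *ℚ fromℕ (ℓ i)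

      α≥0 : NonNegative α
      α≥0 = nonNegative (ℚ.≤-trans (fromℕ-mono {0} {1} z≤n) 1≤α)

      -- `Y` is a natural number in place of the rational power of `τ`, so that estimates stay in
      -- `ℕ` until the last step. `Y≤τ` serves the claimed running time, `Y≤` the computable factor
      -- of the FPT bound.
      record Factor : Set where
        field
          Y      : ℕ
          tuples : count inst i ^ W * W ≤ 64 * (W ^ (2 * W + 1) * Y)
          Y≤τ    : fromℕ Y ≤ℚ τ ^ℚ (2 * W)
          Y≤     : Y ≤ (numα * ℓ i) ^ (2 * W)

      factor : Factor
      factor = go (W ≟ 0) (m ≟ 0)
        where
        c = count inst i
        no-tuples : c ^ W * W ≡ 0 → Factor
        no-tuples eq = record
          { Y = 0 ; tuples = ≤-trans (≤-reflexive eq) z≤n ; Y≤ = z≤n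
          ; Y≤τ = ℚ.nonNegative⁻¹ (τ ^ℚ (2 * W)) {{^ℚ-nonNeg τ {{τ≥0}} (2 * W)}} }
          where
          τ≥0 : NonNegative τ
          τ≥0 = ℚ.nonNeg*nonNeg⇒nonNeg α {{α≥0}} (fromℕ (ℓ i)) {{fromℕ-nonNeg (ℓ i)}}
        zero-power : ∀ {c W} → c ≤ 0 → W ≢ 0 → c ^ W * W ≡ 0
        zero-power {W = zero} z≤n ne = ⊥-elim (ne refl)
        zero-power {W = suc w} z≤n ne = refl
        go : _ → _ → Factor
        go (yes W≡0) _ = no-tuples (trans (cong (c ^ W *_) W≡0) (*-zeroʳ (c ^ W)))
        go (no W≢0) (yes m≡0) = no-tuples (zero-power (subst (c ≤_) m≡0 (count≤m inst i)) W≢0)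
        go (no W≢0) (no m≢0) = record
          { Y      = t ^ (2 * W)
          ; tuples = power-bound W t c (1≤α⇒1≤/ α 1≤α (1≤L inst i)) (count≤cap inst i)
          ; Y≤τ    = fromℕ-^ t (2 * W) t≤τ
          ; Y≤     = ^-monoˡ-≤ (2 * W) (≤-trans (m/n≤m (numα * l) denα) (*-monoʳ-≤ numα l≤ℓ))
          }
          where
          l = L inst i
          t = numα * l / denα
          l≤ℓ : l ≤ ℓ i
          l≤ℓ = bounds i (n≢0⇒n>0 m≢0) (n≢0⇒n>0 W≢0) (attained inst i)
          t≤τ : fromℕ t ≤ℚ τ
          t≤τ = ℚ.≤-trans (Equivalence.from (≤α*⇔ α 1≤α t l) (m/n*n≤m (numα * l) denα))
                  (ℚ.*-monoˡ-≤-nonNeg α {{α≥0}} (fromℕ-mono l≤ℓ))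

    boundFactor : ℕ
    boundFactor = runtimeBound * 64

    ℕ-bound : ∀ i {t} → let open Instance (inst i) in
      t ≤ runtimeBound * (apsp₂ n m + count inst i ^ W * W * spsp n m) →
      t ≤ boundFactor * (W ^ (2 * W + 1) * Factor.Y (factor i) * spsp n m + apsp₂ n m)
    ℕ-bound i {t} t≤ = begin
      t
        ≤⟨ t≤ ⟩
      runtimeBound * (apsp₂ n m + count inst i ^ W * W * spsp n m)
        ≤⟨ *-monoʳ-≤ runtimeBound (+-mono-≤ (m≤n*m (apsp₂ n m) 64) (*-monoˡ-≤ (spsp n m) (Factor.tuples (factor i)))) ⟩
      runtimeBound * (64 * apsp₂ n m + 64 * X * spsp n m)
        ≡⟨ regroup runtimeBound (apsp₂ n m) X (spsp n m) ⟩
      boundFactor * (X * spsp n m + apsp₂ n m)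
        ∎
      where
      open Instance (inst i)
      open ≤-Reasoning
      X = W ^ (2 * W + 1) * Factor.Y (factor i)
      regroup : ∀ c a x s → c * (64 * a + 64 * x * s) ≡ c * 64 * (x * s + a)
      regroup = solve-∀

    O-bound : ∀ t → Fast inst t → t ∈O (λ i → let open Instance (inst i) in timeBound W (τ i) (spsp n m) (apsp₂ n m))
    O-bound t t≤ = boundFactor , bound
      where
      bound : ∀ i → let open Instance (inst i) in
              fromℕ (t i) ≤ℚ fromℕ boundFactor *ℚ timeBound W (τ i) (spsp n m) (apsp₂ n m)
      bound i = ℚ.≤-trans (fromℕ-mono (ℕ-bound i (t≤ i)))
        (ℚ.≤-trans (ℚ.≤-reflexive (fromℕ-* boundFactor _))
          (ℚ.*-monoˡ-≤-nonNeg (fromℕ boundFactor) {{fromℕ-nonNeg boundFactor}} total))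
        where
        open Instance (inst i)
        X = W ^ (2 * W + 1)
        Y = Factor.Y (factor i)
        s = spsp n m
        total : fromℕ (X * Y * s + apsp₂ n m) ≤ℚ timeBound W (τ i) s (apsp₂ n m)
        total = ℚ.≤-trans (ℚ.≤-reflexive (trans (fromℕ-+ (X * Y * s) (apsp₂ n m))
                  (cong (_+ℚ fromℕ (apsp₂ n m)) (trans (fromℕ-* (X * Y) s) (cong (_*ℚ fromℕ s) (fromℕ-* X Y))))))
          (ℚ.+-monoˡ-≤ (fromℕ (apsp₂ n m)) (ℚ.*-monoʳ-≤-nonNeg (fromℕ s) {{fromℕ-nonNeg s}}
            (ℚ.*-monoˡ-≤-nonNeg (fromℕ X) {{fromℕ-nonNeg X}} (Factor.Y≤τ (factor i)))))

    fpt : ∀ {k} (κ : Idx → Vec ℕ k) (f : Vec ℕ k → ℕ) → Computable f →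
          (∀ i → let open Instance (inst i) in f (κ i) ≡ power W (numα * ℓ i)) →
          IsFPT κ (decisionAlgorithm inst)
    fpt κ f computable f≡ = f , computable , monomial degreeBound , boundFactor * graphFactor , bound
      where
      bound : ∀ i → fromℕ (time (decisionAlgorithm inst) i) ≤ℚ fromℕ (boundFactor * graphFactor) *ℚ
              fromℕ (f (κ i) * evalPoly (monomial degreeBound) (size (Instance.encodeInstance (inst i))))
      bound i = ℚ.≤-trans (fromℕ-mono (begin
        time (decisionAlgorithm inst) i
          ≤⟨ ℕ-bound i (decision-time inst i) ⟩
        boundFactor * (X * Y * spsp n m + apsp₂ n m)
          ≤⟨ *-monoʳ-≤ boundFactor (+-mono-≤ (*-monoˡ-≤ (spsp n m) XY≤) (m≤n*m (apsp₂ n m) p {{m^n≢0 g (4 * W + 1)}})) ⟩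
        boundFactor * (p * spsp n m + p * apsp₂ n m)
          ≡⟨ cong (boundFactor *_) (sym (*-distribˡ-+ p (spsp n m) (apsp₂ n m))) ⟩
        boundFactor * (p * (spsp n m + apsp₂ n m))
          ≤⟨ *-monoʳ-≤ boundFactor (*-monoʳ-≤ p (graph-time (inst i))) ⟩
        boundFactor * (p * (graphFactor * e))
          ≡⟨ regroup boundFactor p graphFactor e ⟩
        boundFactor * graphFactor * (p * e)
          ≡⟨ cong (λ z → boundFactor * graphFactor * (z * e)) (sym (f≡ i)) ⟩
        boundFactor * graphFactor * (f (κ i) * e)
          ∎))
        (ℚ.≤-reflexive (fromℕ-* (boundFactor * graphFactor) _))
        where
        open Instance (inst i)
        open ≤-Reasoning
        X = W ^ (2 * W + 1)
        Y = Factor.Y (factor i)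
        g = 1 + W + numα * ℓ i
        p = power W (numα * ℓ i)
        e = evalPoly (monomial degreeBound) (size encodeInstance)
        exponents : ∀ w → 2 * w + 1 + 2 * w ≡ 4 * w + 1
        exponents = solve-∀
        XY≤ : X * Y ≤ p
        XY≤ = ≤-trans (*-mono-≤ (^-monoˡ-≤ (2 * W + 1) (≤-trans (n≤1+n W) (m≤m+n (1 + W) _)))
                                (≤-trans (Factor.Y≤ (factor i)) (^-monoˡ-≤ (2 * W) (m≤n+m (numα * ℓ i) (1 + W)))))
          (≤-reflexive (trans (sym (^-distribˡ-+-* g (2 * W + 1) (2 * W))) (cong (g ^_)
            (exponents W))))
        regroup : ∀ b p t e → b * (p * (t * e)) ≡ b * t * (p * e)
        regroup = solve-∀

-- The bounded and the coupled case

boundedPower : Vec ℕ 4 → ℕ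
boundedPower (W ∷ᵛ ℓ ∷ᵛ a ∷ᵛ b ∷ᵛ []ᵛ) = power W (a * ℓ)

coupledPower : Vec ℕ 3 → ℕ
coupledPower (W ∷ᵛ a ∷ᵛ b ∷ᵛ []ᵛ) = power W (a * W)

boundedPower-computable : Computable boundedPower
boundedPower-computable = powerProgram 2 1 , λ { (W ∷ᵛ ℓ ∷ᵛ a ∷ᵛ b ∷ᵛ []ᵛ) → power-runs 2 1 (W ∷ ℓ ∷ a ∷ b ∷ []) }

coupledPower-computable : Computable coupledPower
coupledPower-computable = powerProgram 1 0 , λ { (W ∷ᵛ a ∷ᵛ b ∷ᵛ []ᵛ) → power-runs 1 0 (W ∷ a ∷ b ∷ []) }

bounded-length : CoversLengths BoundedInstance.inst BoundedInstance.ℓmax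
bounded-length i 1≤m _ (inj₁ refl) = ≤-trans (positive e) (bounded e)
  where
  open BoundedInstance i
  e : Fin m
  e = anyFin (>-nonZero 1≤m)
bounded-length i _ _ (inj₂ (e , _ , refl)) = BoundedInstance.bounded i e

coupled-length : CoversLengths CoupledInstance.inst (λ i → CoupledInstance.W i)
coupled-length i _ 1≤W (inj₁ refl) = 1≤W
coupled-length i _ _ (inj₂ (e , w< , refl)) = subst (_≤ W) (proj₁ (coupled e)) (<⇒≤ w<)
  where open CoupledInstance i

corollary4 : (spsp apsp₂ : ℕ → ℕ → ℕ) → IsSPSPTime spsp → IsAPSP₂Time apsp₂ →
    ((Σ[ A ∈ Algorithm (decision BoundedInstance.inst) ]
    IsFPT boundedParameter A × time A ∈O boundedTime spsp apsp₂) ×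
    (Σ[ A ∈ Algorithm (search BoundedInstance.inst) ]
    time A ∈O boundedTime spsp apsp₂)) ×
    ((Σ[ A ∈ Algorithm (decision CoupledInstance.inst) ]
    IsFPT coupledParameter A × time A ∈O coupledTime spsp apsp₂) ×
    (Σ[ A ∈ Algorithm (search CoupledInstance.inst) ]
    time A ∈O coupledTime spsp apsp₂))
corollary4 spsp apsp₂ isSPSP isAPSP₂ =
  ((decisionAlgorithm BoundedInstance.inst ,
      B.fpt boundedParameter boundedPower boundedPower-computable (λ _ → refl) ,
      B.O-bound (time (decisionAlgorithm BoundedInstance.inst)) (decision-time BoundedInstance.inst)) ,
   (searchAlgorithm BoundedInstance.inst ,
      B.O-bound (time (searchAlgorithm BoundedInstance.inst)) (search-time BoundedInstance.inst))) ,
  ((decisionAlgorithm CoupledInstance.inst ,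
      C.fpt coupledParameter coupledPower coupledPower-computable (λ _ → refl) ,
      C.O-bound (time (decisionAlgorithm CoupledInstance.inst)) (decision-time CoupledInstance.inst)) ,
   (searchAlgorithm CoupledInstance.inst ,
      C.O-bound (time (searchAlgorithm CoupledInstance.inst)) (search-time CoupledInstance.inst)))
  where
  open Conclusions spsp apsp₂ isSPSP isAPSP₂
  module B = Bounds BoundedInstance.inst BoundedInstance.ℓmax bounded-length
  module C = Bounds CoupledInstance.inst (λ i → CoupledInstance.W i) coupled-length
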